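{- Let $r,k,e$ be fixed integers with $r\ge k+1\ge e\ge 3$. Then $f_r(n,e(r-k)+k+1,e)=o(n^k)$ as $n\to\infty$.
   Context: For integers $r,v,e$, an $r$-uniform hypergraph is called $\mathcal{G}_r(v,e)$-free if it does not contain $e$ distinct edges whose union has at most $v$ vertices (equivalently, the union of any $e$ distinct edges has at least $v+1$ vertices). $f_r(n,v,e)$ denotes the maximum number of edges in a $\mathcal{G}_r(v,e)$-free $r$-uniform hypergraph on $n$ vertices. -}

module Defs where

open import Data.Nat using (ℕ; _<_; _≤_; _+_; _*_; _∸_; _^_)
open import Data.Fin.Subset using (Subset; ⋃; ∣_∣)
open import Data.List using (List; length)
open import Data.List.Relation.Unary.All using (All)
open import Data.List.Relation.Unary.Unique.Propositional using (Unique)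
open import Data.List.Relation.Binary.Subset.Propositional using (_⊆_)
open import Relation.Binary.PropositionalEquality using (_≡_)

record Hypergraph (n : ℕ) : Set where
  field
    edges  : List (Subset n)
    unique : Unique edges

open Hypergraph public

numEdges : ∀ {n} → Hypergraph n → ℕ
numEdges H = length (edges H)

Uniform : ∀ {n} → ℕ → Hypergraph n → Set
Uniform r H = All (λ E → ∣ E ∣ ≡ r) (edges H)

GFree : ∀ {n} → ℕ → ℕ → Hypergraph n → Set
GFree {n} v e H =
  (Es : List (Subset n)) → Es ⊆ edges H → Unique Es → length Es ≡ e →
  v < ∣ ⋃ Es ∣

{-# OPTIONS --safe #-}
module Submission where

-- Put d = k + 1 and let τ(E) ∈ [n]^d list d vertices of the edge E.  By freeness at most e edges agree with a
-- given point off one coordinate.  If H had more than nᵏ/m edges, a removal-type counting statement (Claim) for the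
-- d shadows of τ(H) would produce a box of at least δ n^d points y such that, for each i, some τ(Eᵢ) agrees with y
-- off i; since |H| = O(nᵏ), some such y is not in τ(H), the Eᵢ are then distinct, and e of them span too few vertices.
--
-- The Claim is hypergraph regularity for the simplex, with the counting lemma built into an induction that discards one
-- coordinate set f after another, largest first: each cell of the labelling of f is replaced by its conditional
-- expectation on the algebra generated by the smaller sets.  The fine expectation (taken accurate in the cut sense) is
-- compared with a coarse one, and their squared difference, small in mean by energy increment, is passed on to the
-- next stage as an additional weight β which may spoil a small part of the space.  Only the means of the weights, not
-- their sizes, have to be small independently of the complexity, so that no circularity arises.
-- Data-level existence is proved up to double negation, which suffices because the conclusion is decidable.

open import Defs
open import Data.Bool using (Bool; true; false; _∧_; _∨_; not; if_then_else_; T)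
open import Data.Bool.ListAction using (all; any)
import Data.Bool.Properties as Boolₚ
open import Data.Empty using (⊥; ⊥-elim)
open import Data.Fin using (Fin; zero; suc; inject≤)
import Data.Fin.Properties as Finₚ
import Data.Fin.Subset as Sub
open Sub using (Subset; ⋃; ∣_∣; ⁅_⁆; _∪_)
import Data.Fin.Subset.Properties as Subₚ
open import Data.Integer as ℤ using (ℤ)
import Data.Integer.Properties as ℤₚ
open import Data.List using (List; []; _∷_; _++_; map; length; concatMap; allFin; downFrom; take; drop; filter)
import Data.List.Properties as Listₚ
open import Data.List.Membership.Propositional using (_∈_)
open import Data.List.Membership.Propositional.Properties using (∈-allFin; ∈-map⁺; ∈-map⁻; ∈-concatMap⁺; ∈-downFrom⁺; ∈-++⁺ˡ; ∈-++⁺ʳ; ∈-filter⁻)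
open import Data.List.Relation.Binary.Subset.Propositional using () renaming (_⊆_ to _⊆ₗ_)
open import Data.List.Relation.Unary.All using (All)
import Data.List.Relation.Unary.All as All
import Data.List.Relation.Unary.All.Properties as Allₚ
open import Data.List.Relation.Unary.Any using (here; there)
import Data.List.Relation.Unary.Any as Any
open import Data.List.Relation.Unary.Unique.Propositional using (Unique)
import Data.List.Relation.Unary.Unique.Propositional.Properties as Uniqueₚ
open import Data.Nat as ℕ using (ℕ; zero; suc)
import Data.Nat.Properties as ℕₚ
open import Data.Product using (Σ; ∃-syntax; _×_; _,_; proj₁; proj₂)
open import Data.Rational using (ℚ; 0ℚ; 1ℚ; ½; _+_; _*_; _-_; -_; _≤_; _<_; _≤?_; _<?_; _⊓_; 1/_; mkℚ; toℚᵘ; positive; nonNegative; ≢-nonZero)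
open import Data.Rational.Properties
open import Data.Rational.Unnormalised as ℚᵘ using (mkℚᵘ)
import Data.Rational.Unnormalised.Properties as ℚᵘₚ
open import Data.Sum using (_⊎_; inj₁; inj₂)
open import Data.Unit using (tt)
open import Relation.Binary.Definitions using (DecidableEquality)
open import Relation.Binary.PropositionalEquality
open import Relation.Nullary using (¬_; Dec; yes; no; does)
open import Relation.Nullary.Decidable using (dec⇒maybe; dec-true)
open import Tactic.RingSolver using (solve; solve-∀)
open import Tactic.RingSolver.Core.AlmostCommutativeRing using (AlmostCommutativeRing; fromCommutativeRing)

-- The energy increment bounds the distance between fine and coarse expectations only in mean square
-- over the whole space, whereas a box may be tiny and the error could concentrate on it. Hence the
-- next stage is asked for a box on which the squared error has little mass as well. To fit the
-- induction, every weight has to ignore one coordinate; each member of the regularised family omits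
-- a coordinate, so the squared errors can be sorted by what they omit. The old weights must survive
-- at the same time: if f contains i, then β i acts on the cells of f as a bounded multiplier living
-- on a smaller set; if not, its product with a cell is regularised as a function in its own right.
-- All numbers are rational, so Cauchy-Schwarz gives way to t ≤ l + t²/l for l > 0. The bound e ≤ k
-- + 1 enters by giving the e edges pairwise different free coordinates.

ℚr : AlmostCommutativeRing _ _
ℚr = fromCommutativeRing +-*-commutativeRing (λ x → dec⇒maybe (0ℚ ≟ x))

-- Ordered-field arithmetic of the rationals.

module _ {a b : ℚ} where

  add-nonneg : 0ℚ ≤ a → 0ℚ ≤ b → 0ℚ ≤ a + b
  add-nonneg p q = subst (_≤ a + b) (+-identityˡ 0ℚ) (+-mono-≤ p q)

  mul-nonneg : 0ℚ ≤ a → 0ℚ ≤ b → 0ℚ ≤ a * b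
  mul-nonneg p q = nonNegative⁻¹ (a * b) {{nonNeg*nonNeg⇒nonNeg a {{nonNegative p}} b {{nonNegative q}}}}

  mul-pos : 0ℚ < a → 0ℚ < b → 0ℚ < a * b
  mul-pos p q = positive⁻¹ (a * b) {{pos*pos⇒pos a {{positive p}} b {{positive q}}}}

  sub-nonneg : a ≤ b → 0ℚ ≤ b - a
  sub-nonneg p = subst (_≤ b - a) (+-inverseʳ a) (+-monoˡ-≤ (- a) p)

  sub-pos : a < b → 0ℚ < b - a
  sub-pos p = subst (_< b - a) (+-inverseʳ a) (+-monoˡ-< (- a) p)

-- Linear arithmetic: b − a is exhibited as a nonnegative expression s, the identity being left to the ring solver.
≤-by : ∀ {a b s} → 0ℚ ≤ s → a + s ≡ b → a ≤ b
≤-by {a} {b} {s} p e = subst₂ _≤_ (+-identityʳ a) e (+-monoʳ-≤ a p)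

<-by : ∀ {a b s} → 0ℚ < s → a + s ≡ b → a < b
<-by {a} {b} {s} p e = subst₂ _<_ (+-identityʳ a) e (+-monoʳ-< a p)

infixl 6 _⊕_
infixl 7 _⊗_
_⊕_ : ∀ {a b} → 0ℚ ≤ a → 0ℚ ≤ b → 0ℚ ≤ a + b
_⊕_ = add-nonneg
_⊗_ : ∀ {a b} → 0ℚ ≤ a → 0ℚ ≤ b → 0ℚ ≤ a * b
_⊗_ = mul-nonneg

sq-nonneg : ∀ a → 0ℚ ≤ a * a
sq-nonneg a with ≤-total 0ℚ a
... | inj₁ p = p ⊗ p
... | inj₂ p = subst (0ℚ ≤_) eq (sub-nonneg p ⊗ sub-nonneg p)
  where
  eq : (0ℚ - a) * (0ℚ - a) ≡ a * a
  eq = solve (a ∷ []) ℚr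

*-mono-≤ : ∀ {a b c} → 0ℚ ≤ c → a ≤ b → c * a ≤ c * b
*-mono-≤ {a} {b} {c} p q = ≤-by (p ⊗ sub-nonneg q) (solve (a ∷ b ∷ c ∷ []) ℚr)

0≤1 : 0ℚ ≤ 1ℚ
0≤1 = nonNegative⁻¹ 1ℚ

0<1 : 0ℚ < 1ℚ
0<1 = positive⁻¹ 1ℚ

0<½ : 0ℚ < ½
0<½ = positive⁻¹ ½

recip : (q : ℚ) → Σ ℚ λ r → 0ℚ < q → q * r ≡ 1ℚ
recip q with q ≟ 0ℚ
... | yes q≡0 = 0ℚ , λ 0<q → ⊥-elim (<-irrefl (sym q≡0) 0<q)
... | no q≢0 = (1/ q) {{≢-nonZero q≢0}} , λ _ → *-inverseʳ q {{≢-nonZero q≢0}}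

abstract

  -- Junk value: inv 0ℚ = 0ℚ.
  inv : ℚ → ℚ
  inv q = proj₁ (recip q)

  *-inv : ∀ {q} → 0ℚ < q → q * inv q ≡ 1ℚ
  *-inv {q} = proj₂ (recip q)

module _ {q : ℚ} (0<q : 0ℚ < q) where

  inv-pos : 0ℚ < inv q
  inv-pos with inv q ≤? 0ℚ
  ... | no i≰0 = ≰⇒> i≰0
  ... | yes i≤0 = ⊥-elim (<-irrefl refl (<-≤-trans 0<1 (subst₂ _≤_ (*-inv 0<q) (*-zeroʳ q) (*-mono-≤ (<⇒≤ 0<q) i≤0))))

  inv-nonneg : 0ℚ ≤ inv q
  inv-nonneg = <⇒≤ inv-pos

⊓-pos : ∀ {a b} → 0ℚ < a → 0ℚ < b → 0ℚ < a ⊓ b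
⊓-pos {a} {b} p q with ⊓-sel a b
... | inj₁ e = subst (0ℚ <_) (sym e) p
... | inj₂ e = subst (0ℚ <_) (sym e) q

-- Naturals inside the rationals and the archimedean property.

ι : ℕ → ℚ
ι zero = 0ℚ
ι (suc n) = 1ℚ + ι n

ι-nonneg : ∀ n → 0ℚ ≤ ι n
ι-nonneg zero = ≤-refl
ι-nonneg (suc n) = 0≤1 ⊕ ι-nonneg n

ι-pos : ∀ n → 0ℚ < ι (suc n)
ι-pos n = <-≤-trans 0<1 (≤-by (ι-nonneg n) refl)

ι-+ : ∀ m n → ι (m ℕ.+ n) ≡ ι m + ι n
ι-+ zero n = sym (+-identityˡ (ι n))
ι-+ (suc m) n = trans (cong (1ℚ +_) (ι-+ m n)) (sym (+-assoc 1ℚ (ι m) (ι n)))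

ι-* : ∀ m n → ι (m ℕ.* n) ≡ ι m * ι n
ι-* zero n = sym (*-zeroˡ (ι n))
ι-* (suc m) n = trans (ι-+ n (m ℕ.* n)) (trans (cong (ι n +_) (ι-* m n)) (lem (ι m) (ι n)))
  where
  lem : ∀ a b → b + a * b ≡ (1ℚ + a) * b
  lem = solve-∀ ℚr

ι-mono : ∀ {m n} → m ℕ.≤ n → ι m ≤ ι n
ι-mono {n = n} ℕ.z≤n = ι-nonneg n
ι-mono (ℕ.s≤s p) = +-monoʳ-≤ 1ℚ (ι-mono p)

ι-mono-< : ∀ {m n} → m ℕ.< n → ι m < ι n
ι-mono-< {m} {suc n} (ℕ.s≤s p) = ≤-<-trans (ι-mono p) (<-by 0<1 (+-comm (ι n) 1ℚ))

ι-cancel-≤ : ∀ {m n} → ι m ≤ ι n → m ℕ.≤ n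
ι-cancel-≤ {m} {n} p with m ℕ.≤? n
... | yes q = q
... | no ¬q = ⊥-elim (<-irrefl refl (<-≤-trans (ι-mono-< (ℕₚ.≰⇒> ¬q)) p))

toℚᵘ-ι : ∀ m → toℚᵘ (ι m) ℚᵘ.≃ mkℚᵘ (ℤ.+ m) 0
toℚᵘ-ι zero = ℚᵘ.*≡* refl
toℚᵘ-ι (suc m) = ℚᵘₚ.≃-trans (toℚᵘ-homo-+ 1ℚ (ι m)) (ℚᵘₚ.≃-trans (ℚᵘₚ.+-congʳ (toℚᵘ 1ℚ) (toℚᵘ-ι m)) (ℚᵘ.*≡* eq))
  where
  eq : ((ℤ.+ 1) ℤ.* (ℤ.+ 1) ℤ.+ (ℤ.+ m) ℤ.* (ℤ.+ 1)) ℤ.* (ℤ.+ 1) ≡ (ℤ.+ suc m) ℤ.* (ℤ.+ 1)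
  eq = cong (ℤ._* (ℤ.+ 1)) (cong (λ z → (ℤ.+ 1) ℤ.+ z) (ℤₚ.*-identityʳ (ℤ.+ m)))

archimedean : ∀ q → ∃[ m ] q < ι m
archimedean q@(mkℚ n d-1 _) = suc ℤ.∣ n ∣ , toℚᵘ-cancel-< (ℚᵘₚ.<-respʳ-≃ (ℚᵘₚ.≃-sym (toℚᵘ-ι (suc ℤ.∣ n ∣))) (ℚᵘ.*<* lem))
  where
  i≤∣i∣ : ∀ i → i ℤ.≤ ℤ.+ ℤ.∣ i ∣
  i≤∣i∣ (ℤ.+ m) = ℤₚ.≤-refl
  i≤∣i∣ (ℤ.-[1+ m ]) = ℤ.-≤+
  lem : n ℤ.* (ℤ.+ 1) ℤ.< (ℤ.+ suc ℤ.∣ n ∣) ℤ.* (ℤ.+ suc d-1)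
  lem = ℤₚ.≤-<-trans (subst (ℤ._≤ ℤ.+ ℤ.∣ n ∣) (sym (ℤₚ.*-identityʳ n)) (i≤∣i∣ n))
          (subst (λ z → ℤ.+ ℤ.∣ n ∣ ℤ.< z) (ℤₚ.pos-* (suc ℤ.∣ n ∣) (suc d-1)) (ℤ.+<+ (ℕₚ.m≤m*n (suc ℤ.∣ n ∣) (suc d-1))))

archimedean* : ∀ a {b} → 0ℚ < b → ∃[ m ] a < ι m * b
archimedean* a {b} p with archimedean (a * inv b)
... | m , l = m , <-by (mul-pos (sub-pos l) p) (trans (lem a b (inv b) (ι m)) (trans (cong (λ z → (ι m * b + a) - a * z) (*-inv p)) (lem2 a (ι m * b))))
  where
  lem : ∀ a b i m → a + (m - a * i) * b ≡ (m * b + a) - a * (b * i)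
  lem = solve-∀ ℚr
  lem2 : ∀ a c → (c + a) - a * 1ℚ ≡ c
  lem2 = solve-∀ ℚr

⟦_⟧ : Bool → ℚ
⟦ true ⟧ = 1ℚ
⟦ false ⟧ = 0ℚ

⟦⟧-nonneg : ∀ b → 0ℚ ≤ ⟦ b ⟧
⟦⟧-nonneg true = 0≤1
⟦⟧-nonneg false = ≤-refl

⟦⟧-≤1 : ∀ b → ⟦ b ⟧ ≤ 1ℚ
⟦⟧-≤1 true = ≤-refl
⟦⟧-≤1 false = 0≤1

⟦⟧-∧ : ∀ a b → ⟦ a ∧ b ⟧ ≡ ⟦ a ⟧ * ⟦ b ⟧
⟦⟧-∧ true b = sym (*-identityˡ ⟦ b ⟧)
⟦⟧-∧ false b = sym (*-zeroˡ ⟦ b ⟧)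

⟦⟧-∨ : ∀ a b → ⟦ a ∨ b ⟧ ≤ ⟦ a ⟧ + ⟦ b ⟧
⟦⟧-∨ true b = ≤-by (⟦⟧-nonneg b) refl
⟦⟧-∨ false b = ≤-reflexive (sym (+-identityˡ ⟦ b ⟧))

-- Sums over lists.

∑ : ∀ {A : Set} → List A → (A → ℚ) → ℚ
∑ [] f = 0ℚ
∑ (x ∷ xs) f = f x + ∑ xs f

module _ {A : Set} where

  ∑-cong-∈ : ∀ (xs : List A) {f g : A → ℚ} → (∀ x → x ∈ xs → f x ≡ g x) → ∑ xs f ≡ ∑ xs g
  ∑-cong-∈ [] h = refl
  ∑-cong-∈ (x ∷ xs) h = cong₂ _+_ (h x (here refl)) (∑-cong-∈ xs (λ y m → h y (there m)))

  ∑-cong : ∀ (xs : List A) {f g : A → ℚ} → (∀ x → f x ≡ g x) → ∑ xs f ≡ ∑ xs g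
  ∑-cong xs h = ∑-cong-∈ xs (λ x _ → h x)

  ∑-mono-∈ : ∀ (xs : List A) {f g : A → ℚ} → (∀ x → x ∈ xs → f x ≤ g x) → ∑ xs f ≤ ∑ xs g
  ∑-mono-∈ [] h = ≤-refl
  ∑-mono-∈ (x ∷ xs) h = +-mono-≤ (h x (here refl)) (∑-mono-∈ xs (λ y m → h y (there m)))

  ∑-mono : ∀ (xs : List A) {f g : A → ℚ} → (∀ x → f x ≤ g x) → ∑ xs f ≤ ∑ xs g
  ∑-mono xs h = ∑-mono-∈ xs (λ x _ → h x)

  ∑-+ : ∀ (xs : List A) (f g : A → ℚ) → ∑ xs (λ x → f x + g x) ≡ ∑ xs f + ∑ xs g
  ∑-+ [] f g = refl
  ∑-+ (x ∷ xs) f g = trans (cong ((f x + g x) +_) (∑-+ xs f g)) (lem (f x) (g x) (∑ xs f) (∑ xs g))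
    where
    lem : ∀ a b c d → (a + b) + (c + d) ≡ (a + c) + (b + d)
    lem = solve-∀ ℚr

  ∑-* : ∀ (xs : List A) c (f : A → ℚ) → ∑ xs (λ x → c * f x) ≡ c * ∑ xs f
  ∑-* [] c f = sym (*-zeroʳ c)
  ∑-* (x ∷ xs) c f = trans (cong (c * f x +_) (∑-* xs c f)) (sym (*-distribˡ-+ c (f x) (∑ xs f)))

  ∑-*ʳ : ∀ (xs : List A) c (f : A → ℚ) → ∑ xs (λ x → f x * c) ≡ ∑ xs f * c
  ∑-*ʳ xs c f = trans (∑-cong xs (λ x → *-comm (f x) c)) (trans (∑-* xs c f) (*-comm c (∑ xs f)))

  ∑-const : ∀ (xs : List A) c → ∑ xs (λ _ → c) ≡ ι (length xs) * c
  ∑-const [] c = sym (*-zeroˡ c)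
  ∑-const (x ∷ xs) c = trans (cong (c +_) (∑-const xs c)) (lem c (ι (length xs)))
    where
    lem : ∀ c l → c + l * c ≡ (1ℚ + l) * c
    lem = solve-∀ ℚr

  ∑-one : ∀ (xs : List A) → ∑ xs (λ _ → 1ℚ) ≡ ι (length xs)
  ∑-one xs = trans (∑-const xs 1ℚ) (*-identityʳ _)

  ∑-zero : ∀ (xs : List A) → ∑ xs (λ _ → 0ℚ) ≡ 0ℚ
  ∑-zero xs = trans (∑-const xs 0ℚ) (*-zeroʳ (ι (length xs)))

  ∑-nonneg : ∀ (xs : List A) {f : A → ℚ} → (∀ x → 0ℚ ≤ f x) → 0ℚ ≤ ∑ xs f
  ∑-nonneg xs {f} h = subst (_≤ ∑ xs f) (∑-zero xs) (∑-mono xs h)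

  ∑-member : ∀ {xs : List A} {x} {f : A → ℚ} → (∀ x → 0ℚ ≤ f x) → x ∈ xs → f x ≤ ∑ xs f
  ∑-member {y ∷ xs} {f = f} h (here refl) = ≤-by (∑-nonneg xs h) refl
  ∑-member {y ∷ xs} {f = f} h (there m) = ≤-trans (∑-member h m) (≤-by (h y) (+-comm (∑ xs f) (f y)))

  ∑-++ : ∀ (xs ys : List A) (f : A → ℚ) → ∑ (xs ++ ys) f ≡ ∑ xs f + ∑ ys f
  ∑-++ [] ys f = sym (+-identityˡ (∑ ys f))
  ∑-++ (x ∷ xs) ys f = trans (cong (f x +_) (∑-++ xs ys f)) (sym (+-assoc (f x) (∑ xs f) (∑ ys f)))

  ∑-map : ∀ {B : Set} (g : B → A) (xs : List B) (f : A → ℚ) → ∑ (map g xs) f ≡ ∑ xs (λ x → f (g x))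
  ∑-map g [] f = refl
  ∑-map g (x ∷ xs) f = cong (f (g x) +_) (∑-map g xs f)

∑-swap : ∀ {A B : Set} (xs : List A) (ys : List B) (f : A → B → ℚ) →
         ∑ xs (λ x → ∑ ys (f x)) ≡ ∑ ys (λ y → ∑ xs (λ x → f x y))
∑-swap [] ys f = sym (∑-zero ys)
∑-swap (x ∷ xs) ys f = trans (cong (∑ ys (f x) +_) (∑-swap xs ys f)) (sym (∑-+ ys (f x) (λ y → ∑ xs (λ x → f x y))))

minus-scale : ∀ a b → a - b ≡ a + (- 1ℚ) * b
minus-scale = solve-∀ ℚr

plus-zero* : ∀ a e → a ≡ a + 0ℚ * e
plus-zero* = solve-∀ ℚr

*-pull : ∀ a s b → a * (s * b) ≡ s * (a * b)
*-pull = solve-∀ ℚr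

regroup : ∀ i s t → i * (i * (s * t)) ≡ s * i * (i * t)
regroup = solve-∀ ℚr

step-bound : ∀ a a' i e → a + e ≤ a' → a + (1ℚ + i) * e ≤ a' + i * e
step-bound a a' i e p = ≤-by (sub-nonneg p) (solve (a ∷ a' ∷ i ∷ e ∷ []) ℚr)

gain-bound : ∀ a a' b b' c → b' - b ≤ a' - a → b + c ≤ b' → a + c ≤ a'
gain-bound a a' b b' c p q = ≤-by (sub-nonneg p ⊕ sub-nonneg q) (solve (a ∷ a' ∷ b ∷ b' ∷ c ∷ []) ℚr)

negate-bound : ∀ c η → c ≤ - η → η ≤ (- 1ℚ) * c
negate-bound c η p = ≤-by (sub-nonneg p) (solve (c ∷ η ∷ []) ℚr)

-- The library test a <? b computes to an integer comparison of normal forms; lt keeps it from unfolding.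
abstract

  lt : ℚ → ℚ → Bool
  lt a b = does (a <? b)

  lt-spec : ∀ a b → (lt a b ≡ true × a < b) ⊎ (lt a b ≡ false × b ≤ a)
  lt-spec a b = spec (a <? b)
    where
    spec : ∀ {a b} (d : Dec (a < b)) → (does d ≡ true × a < b) ⊎ (does d ≡ false × b ≤ a)
    spec (yes p) = inj₁ (refl , p)
    spec (no ¬p) = inj₂ (refl , ≮⇒≥ ¬p)

-- Scalar inequalities behind the counting step.

2ℚ ¼ : ℚ
2ℚ = 1ℚ + 1ℚ
¼ = ½ * ½

0<2 : 0ℚ < 2ℚ
0<2 = positive⁻¹ 2ℚ

0<¼ : 0ℚ < ¼
0<¼ = positive⁻¹ ¼

0≤½ : 0ℚ ≤ ½
0≤½ = <⇒≤ 0<½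

0≤¼ : 0ℚ ≤ ¼
0≤¼ = <⇒≤ 0<¼

0≤2 : 0ℚ ≤ 2ℚ
0≤2 = <⇒≤ 0<2

-- The difference of the two sides is i times the sum of (e - l/2)² and three quarters of l². It
-- trades a deviation for its square, whose mean the energy controls.
am-gm : ∀ {l i} e → l * i ≡ 1ℚ → 0ℚ ≤ i → e ≤ l + i * (e * e)
am-gm {l} {i} e li≡1 0≤i = ≤-by (0≤i ⊗ (sq-nonneg (e - ½ * l) ⊕ (0≤½ ⊕ 0≤¼) ⊗ sq-nonneg l))
  (trans (expand l i e) (trans (cong (λ z → e + i * (e * e) - z * e + z * l) li≡1) (collapse l i e)))
  where
  expand : ∀ l i e → e + i * ((e - ½ * l) * (e - ½ * l) + (½ + ¼) * (l * l)) ≡ e + i * (e * e) - l * i * e + l * i * l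
  expand = solve-∀ ℚr
  collapse : ∀ l i e → e + i * (e * e) - 1ℚ * e + 1ℚ * l ≡ l + i * (e * e)
  collapse = solve-∀ ℚr

am-gm⁻ : ∀ {l i} e → l * i ≡ 1ℚ → 0ℚ ≤ i → - e ≤ l + i * (e * e)
am-gm⁻ {l} {i} e li≡1 0≤i = subst (λ z → - e ≤ l + i * z) (neg² e) (am-gm {l} (- e) li≡1 0≤i)
  where
  neg² : ∀ e → (- e) * (- e) ≡ e * e
  neg² = solve-∀ ℚr

-- m₁ and c are the fine and the coarse mean of φ at a point where R = 1; W bounds (m₁ − c)².
module _ {l i : ℚ} (li≡1 : l * i ≡ 1ℚ) (0≤l : 0ℚ ≤ l) (0≤i : 0ℚ ≤ i) where

  upper-at : ∀ {φ m₁ c B K W} → 0ℚ ≤ B → B ≤ K → (m₁ - c) * (m₁ - c) ≤ W →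
    φ * (1ℚ * B) ≤ (φ - m₁) * (1ℚ * B) + c * (1ℚ * B) + K * (l * 1ℚ + i * (1ℚ * W))
  upper-at {φ} {m₁} {c} {B} {K} {W} 0≤B B≤K e²≤W =
    ≤-by (0≤B ⊗ sub-nonneg (am-gm {l} (m₁ - c) li≡1 0≤i) ⊕ 0≤B ⊗ (0≤i ⊗ sub-nonneg e²≤W) ⊕
          sub-nonneg B≤K ⊗ (0≤l ⊕ 0≤i ⊗ ≤-trans (sq-nonneg (m₁ - c)) e²≤W))
      (eq φ m₁ c B K W l i)
    where
    eq : ∀ φ m₁ c B K W l i → φ * (1ℚ * B) + (B * (l + i * ((m₁ - c) * (m₁ - c)) - (m₁ - c)) + B * (i * (W - (m₁ - c) * (m₁ - c))) + (K - B) * (l + i * W))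
      ≡ (φ - m₁) * (1ℚ * B) + c * (1ℚ * B) + K * (l * 1ℚ + i * (1ℚ * W))
    eq = solve-∀ ℚr

  lower-at : ∀ {φ m₁ c W} → (m₁ - c) * (m₁ - c) ≤ W → c * 1ℚ + (φ - m₁) * 1ℚ ≤ φ * 1ℚ + (l * 1ℚ + i * (1ℚ * W))
  lower-at {φ} {m₁} {c} {W} e²≤W =
    ≤-by (sub-nonneg (am-gm⁻ {l} (m₁ - c) li≡1 0≤i) ⊕ 0≤i ⊗ sub-nonneg e²≤W) (eq φ m₁ c W l i)
    where
    eq : ∀ φ m₁ c W l i → c * 1ℚ + (φ - m₁) * 1ℚ + (l + i * ((m₁ - c) * (m₁ - c)) - (- (m₁ - c)) + i * (W - (m₁ - c) * (m₁ - c)))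
      ≡ φ * 1ℚ + (l * 1ℚ + i * (1ℚ * W))
    eq = solve-∀ ℚr

upper-off : ∀ φ m₁ c B K W l i → φ * (0ℚ * B) ≡ (φ - m₁) * (0ℚ * B) + c * (0ℚ * B) + K * (l * 0ℚ + i * (0ℚ * W))
upper-off = solve-∀ ℚr

lower-off : ∀ φ m₁ c W l i → c * 0ℚ + (φ - m₁) * 0ℚ ≡ φ * 0ℚ + (l * 0ℚ + i * (0ℚ * W))
lower-off = solve-∀ ℚr

sq-diff-≤ : ∀ {a b K} → 0ℚ ≤ a → a ≤ K → 0ℚ ≤ b → b ≤ K → (a - b) * (a - b) ≤ K * K
sq-diff-≤ {a} {b} {K} p q p' q' = ≤-by ((sub-nonneg q ⊕ p') ⊗ (sub-nonneg q' ⊕ p)) (solve (a ∷ b ∷ K ∷ []) ℚr)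

-- A is the mass of the refined box, X the part of it lost to β, p̂ the sum of the d coarse densities of the removed cell,
-- r and S the plain and the weighted mass of the box before refinement.
counting-bound : ∀ {dq K c₀ l i C η δ p̂ r w S ρ A X} →
  (dq + dq * dq * K) * l ≡ ¼ * c₀ → ½ * c₀ * C ≡ (dq + dq * dq * K) * i → (dq + dq * dq * K) * η ≡ ¼ * (c₀ * δ) →
  0ℚ ≤ dq → 0ℚ ≤ C → 0ℚ ≤ r → 0ℚ ≤ w → 0ℚ ≤ δ → 0ℚ ≤ c₀ → c₀ ≤ p̂ →
  p̂ * r - dq * (l * r + i * w + η) ≤ dq * A →
  dq * X ≤ ¼ * (p̂ * r) + dq * (p̂ * ρ) + dq * dq * K * (l * r + i * w + η) →
  δ ≤ S → S ≤ r - 2ℚ * dq * ρ - C * w →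
  ¼ * (c₀ * δ) ≤ dq * (A - X)
counting-bound {dq} {K} {c₀} {l} {i} {C} {η} {δ} {p̂} {r} {w} {S} {ρ} {A} {X} e₁ e₂ e₃ 0≤d 0≤C 0≤r 0≤w 0≤δ 0≤c c≤p lowA upX δ≤S S≤ =
  ≤-trans
    -- A quarter of p̂r pays for ¼c₀r. As c₀ ≤ p̂, what remains is at least ½p̂S - ¼c₀δ, and S ≥ δ
    -- finishes.
    (≤-by (0≤½ ⊗ sub-nonneg c≤p ⊗ 0≤δ ⊕ 0≤½ ⊗ ≤-trans 0≤c c≤p ⊗ (sub-nonneg δ≤S ⊕ sub-nonneg S≤)
           ⊕ 0≤¼ ⊗ sub-nonneg c≤p ⊗ 0≤r ⊕ 0≤½ ⊗ sub-nonneg c≤p ⊗ (0≤C ⊗ 0≤w))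
      (eq₁ dq c₀ C δ p̂ r w S ρ))
    (subst (_≤ dq * (A - X)) (trans (eq₂ dq K l i η p̂ r w ρ)
        (trans (cong₂ (λ x y → ½ * (p̂ * r) + ¼ * (p̂ * r) - dq * (p̂ * ρ) - x * r - y * w - (dq + dq * dq * K) * η) e₁ (sym e₂))
               (cong (λ z → ½ * (p̂ * r) + ¼ * (p̂ * r) - dq * (p̂ * ρ) - ¼ * c₀ * r - ½ * c₀ * C * w - z) e₃)))
      (≤-by (sub-nonneg lowA ⊕ sub-nonneg upX) (eq₃ dq K l i η p̂ r w ρ A X)))
  where
  eq₁ : ∀ dq c₀ C δ p̂ r w S ρ → ¼ * (c₀ * δ) + (½ * (p̂ - c₀) * δ + ½ * p̂ * ((S - δ) + (r - 2ℚ * dq * ρ - C * w - S)) + ¼ * (p̂ - c₀) * r + ½ * (p̂ - c₀) * (C * w))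
    ≡ ½ * (p̂ * r) + ¼ * (p̂ * r) - dq * (p̂ * ρ) - ¼ * c₀ * r - ½ * c₀ * C * w - ¼ * (c₀ * δ)
  eq₁ = solve-∀ ℚr
  eq₂ : ∀ dq K l i η p̂ r w ρ → p̂ * r - dq * (l * r + i * w + η) - (¼ * (p̂ * r) + dq * (p̂ * ρ) + dq * dq * K * (l * r + i * w + η))
    ≡ ½ * (p̂ * r) + ¼ * (p̂ * r) - dq * (p̂ * ρ) - (dq + dq * dq * K) * l * r - (dq + dq * dq * K) * i * w - (dq + dq * dq * K) * η
  eq₂ = solve-∀ ℚr
  eq₃ : ∀ dq K l i η p̂ r w ρ A X → p̂ * r - dq * (l * r + i * w + η) - (¼ * (p̂ * r) + dq * (p̂ * ρ) + dq * dq * K * (l * r + i * w + η))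
    + (dq * A - (p̂ * r - dq * (l * r + i * w + η)) + (¼ * (p̂ * r) + dq * (p̂ * ρ) + dq * dq * K * (l * r + i * w + η) - dq * X)) ≡ dq * (A - X)
  eq₃ = solve-∀ ℚr

-- Pointwise Markov bound: once averaged, it shows that the points of a cell where its conditional
-- density is below c have measure at most c.
below-threshold : ∀ {m c} → 0ℚ ≤ c → m * ⟦ lt m c ⟧ ≤ c
below-threshold {m} {c} 0≤c with lt-spec m c
... | inj₁ (e , m<c) = subst (λ b → m * ⟦ b ⟧ ≤ c) (sym e) (subst (_≤ c) (sym (*-identityʳ m)) (<⇒≤ m<c))
... | inj₂ (e , _) = subst (λ b → m * ⟦ b ⟧ ≤ c) (sym e) (subst (_≤ c) (sym (*-zeroʳ m)) 0≤c)

lt-false : ∀ {a b} → lt a b ≡ false → b ≤ a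
lt-false {a} {b} p with lt-spec a b
... | inj₁ (e , _) = ⊥-elim (true≢false (trans (sym e) p))
  where
  true≢false : true ≢ false
  true≢false ()
... | inj₂ (_ , q) = q

-- Deliberately weakened to the right-hand side of `loss-outside`, so that the bounds for
-- coordinates inside and outside f can be summed in one expression.
loss-inside : ∀ {X K η p ρ om p̂ κ r} → X ≤ K * η + p * ρ + K * om → p ≤ p̂ → 0ℚ ≤ ρ → 0ℚ ≤ κ → 0ℚ ≤ p → 0ℚ ≤ r →
  X ≤ κ * (p * r) + p̂ * ρ + K * (om + η)
loss-inside {X} {K} {η} {p} {ρ} {om} {p̂} {κ} {r} h p≤ 0≤ρ 0≤κ 0≤p 0≤r =
  ≤-by (sub-nonneg h ⊕ sub-nonneg p≤ ⊗ 0≤ρ ⊕ 0≤κ ⊗ (0≤p ⊗ 0≤r)) (eq X K η p ρ om p̂ κ r)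
  where
  eq : ∀ X K η p ρ om p̂ κ r → X + (K * η + p * ρ + K * om - X + (p̂ - p) * ρ + κ * (p * r)) ≡ κ * (p * r) + p̂ * ρ + K * (om + η)
  eq = solve-∀ ℚr

loss-outside : ∀ {X K η p q ρ om p̂ κ r} → X ≤ η + q * r + 1ℚ * om → q ≤ κ * p → 0ℚ ≤ ρ → 0ℚ ≤ p̂ → 1ℚ ≤ K → 0ℚ ≤ om + η → 0ℚ ≤ r →
  X ≤ κ * (p * r) + p̂ * ρ + K * (om + η)
loss-outside {X} {K} {η} {p} {q} {ρ} {om} {p̂} {κ} {r} h q≤ 0≤ρ 0≤p̂ 1≤K 0≤om 0≤r =
  ≤-by (sub-nonneg h ⊕ sub-nonneg q≤ ⊗ 0≤r ⊕ 0≤p̂ ⊗ 0≤ρ ⊕ sub-nonneg 1≤K ⊗ 0≤om) (eq X K η p q ρ om p̂ κ r)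
  where
  eq : ∀ X K η p q ρ om p̂ κ r → X + (η + q * r + 1ℚ * om - X + (κ * p - q) * r + p̂ * ρ + (K - 1ℚ) * (om + η)) ≡ κ * (p * r) + p̂ * ρ + K * (om + η)
  eq = solve-∀ ℚr

scale-total : ∀ {d X κ a b c} → d * κ ≡ ¼ → 0ℚ ≤ d → X ≤ κ * a + b + d * c → d * X ≤ ¼ * a + d * b + d * d * c
scale-total {d} {X} {κ} {a} {b} {c} e 0≤d h = subst (d * X ≤_) (trans (eq d κ a b c) (cong (λ z → z * a + d * b + d * d * c) e)) (*-mono-≤ 0≤d h)
  where
  eq : ∀ d κ a b c → d * (κ * a + b + d * c) ≡ d * κ * a + d * b + d * d * c
  eq = solve-∀ ℚr

divide-out : ∀ {d v a b} → d * v ≡ 1ℚ → 0ℚ ≤ v → a ≤ d * b → a * v ≤ b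
divide-out {d} {v} {a} {b} e 0≤v h = subst₂ _≤_ (*-comm v a) (trans (eq d v b) (trans (cong (_* b) e) (*-identityˡ b))) (*-mono-≤ 0≤v h)
  where
  eq : ∀ d v b → v * (d * b) ≡ d * v * b
  eq = solve-∀ ℚr

divide-in : ∀ {d v p q} → d * v ≡ 1ℚ → 0ℚ ≤ v → 2ℚ * 2ℚ * d * q ≤ p → q ≤ ¼ * v * p
divide-in {d} {v} {p} {q} e 0≤v h = subst (_≤ ¼ * v * p) (trans (eq d v q) (trans (cong (_* q) e) (*-identityˡ q))) (*-mono-≤ (0≤¼ ⊗ 0≤v) h)
  where
  eq : ∀ d v q → ¼ * v * (2ℚ * 2ℚ * d * q) ≡ d * v * q
  eq = solve-∀ ℚr

-- Averages and conditional expectations on a finite set.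

module Average {P : Set} (xs : List P) (complete : ∀ x → x ∈ xs) (x₀ : P) where

  size : ℚ
  size = ι (length xs)

  size-pos : 0ℚ < size
  size-pos = lem (complete x₀)
    where
    lem : ∀ {ys : List P} → x₀ ∈ ys → 0ℚ < ι (length ys)
    lem {_ ∷ ys} _ = ι-pos (length ys)

  abstract

    𝔼 : (P → ℚ) → ℚ
    𝔼 f = inv size * ∑ xs f

    𝔼-def : ∀ f → 𝔼 f ≡ inv size * ∑ xs f
    𝔼-def f = refl

    size*𝔼 : ∀ f → size * 𝔼 f ≡ ∑ xs f
    size*𝔼 f = trans (sym (*-assoc size (inv size) (∑ xs f))) (trans (cong (_* ∑ xs f) (*-inv size-pos)) (*-identityˡ _))

    𝔼-cong : ∀ {f g} → (∀ x → f x ≡ g x) → 𝔼 f ≡ 𝔼 g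
    𝔼-cong h = cong (inv size *_) (∑-cong xs h)

    𝔼-mono : ∀ {f g} → (∀ x → f x ≤ g x) → 𝔼 f ≤ 𝔼 g
    𝔼-mono h = *-mono-≤ (inv-nonneg size-pos) (∑-mono xs h)

    𝔼-+ : ∀ f g → 𝔼 (λ x → f x + g x) ≡ 𝔼 f + 𝔼 g
    𝔼-+ f g = trans (cong (inv size *_) (∑-+ xs f g)) (*-distribˡ-+ (inv size) (∑ xs f) (∑ xs g))

    𝔼-* : ∀ c f → 𝔼 (λ x → c * f x) ≡ c * 𝔼 f
    𝔼-* c f = trans (cong (inv size *_) (∑-* xs c f)) (lem (inv size) c (∑ xs f))
      where
      lem : ∀ i c s → i * (c * s) ≡ c * (i * s)
      lem = solve-∀ ℚr

    𝔼-*ʳ : ∀ c f → 𝔼 (λ x → f x * c) ≡ 𝔼 f * c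
    𝔼-*ʳ c f = trans (𝔼-cong (λ x → *-comm (f x) c)) (trans (𝔼-* c f) (*-comm c (𝔼 f)))

    𝔼-- : ∀ f g → 𝔼 (λ x → f x - g x) ≡ 𝔼 f - 𝔼 g
    𝔼-- f g = trans (𝔼-cong (λ x → lem (f x) (g x))) (trans (𝔼-+ f (λ x → (- 1ℚ) * g x)) (trans (cong (𝔼 f +_) (𝔼-* (- 1ℚ) g)) (sym (lem (𝔼 f) (𝔼 g)))))
      where
      lem : ∀ a b → a - b ≡ a + (- 1ℚ) * b
      lem = solve-∀ ℚr

    𝔼-const : ∀ c → 𝔼 (λ _ → c) ≡ c
    𝔼-const c = trans (cong (inv size *_) (∑-const xs c)) (trans (lem (inv size) size c) (trans (cong (_* c) (*-inv size-pos)) (*-identityˡ c)))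
      where
      lem : ∀ i s c → i * (s * c) ≡ (s * i) * c
      lem = solve-∀ ℚr

    𝔼-∑ : ∀ {A : Set} (ys : List A) (f : P → A → ℚ) → 𝔼 (λ x → ∑ ys (f x)) ≡ ∑ ys (λ y → 𝔼 (λ x → f x y))
    𝔼-∑ ys f = trans (cong (inv size *_) (∑-swap xs ys f)) (sym (∑-* ys (inv size) (λ y → ∑ xs (λ x → f x y))))

    𝔼-swap : ∀ (f : P → P → ℚ) → 𝔼 (λ x → 𝔼 (f x)) ≡ 𝔼 (λ y → 𝔼 (λ x → f x y))
    𝔼-swap f = cong (inv size *_) (trans (∑-* xs (inv size) (λ x → ∑ xs (f x)))
      (trans (cong (inv size *_) (∑-swap xs xs f)) (sym (∑-* xs (inv size) (λ y → ∑ xs (λ x → f x y))))))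

    𝔼-nonneg : ∀ {f} → (∀ x → 0ℚ ≤ f x) → 0ℚ ≤ 𝔼 f
    𝔼-nonneg h = inv-nonneg size-pos ⊗ ∑-nonneg xs h

    𝔼-≤ : ∀ {f c} → (∀ x → f x ≤ c) → 𝔼 f ≤ c
    𝔼-≤ {f} {c} h = subst (𝔼 f ≤_) (𝔼-const c) (𝔼-mono h)

  module Conditional {C : Set} (_≟C_ : DecidableEquality C) where

    same : C → C → Bool
    same a b = does (a ≟C b)

    same-refl : ∀ a → same a a ≡ true
    same-refl a with a ≟C a
    ... | yes _ = refl
    ... | no ¬p = ⊥-elim (¬p refl)

    Measurable : (P → C) → {A : Set} → (P → A) → Set
    Measurable ℓ ψ = ∀ x y → ℓ x ≡ ℓ y → ψ x ≡ ψ y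

    abstract

      count : (P → C) → C → ℚ
      count ℓ c = ∑ xs (λ y → ⟦ same c (ℓ y) ⟧)

      atomAvg : (P → C) → (P → ℚ) → C → ℚ
      atomAvg ℓ φ c = inv (count ℓ c) * ∑ xs (λ y → ⟦ same c (ℓ y) ⟧ * φ y)

      cond : (P → C) → (P → ℚ) → P → ℚ
      cond ℓ φ x = atomAvg ℓ φ (ℓ x)

      cond-measurable : ∀ ℓ φ → Measurable ℓ (cond ℓ φ)
      cond-measurable ℓ φ x y = cong (atomAvg ℓ φ)

      count-pos : ∀ ℓ x → 0ℚ < count ℓ (ℓ x)
      count-pos ℓ x = <-≤-trans 0<1 (subst (λ b → ⟦ b ⟧ ≤ count ℓ (ℓ x)) (same-refl (ℓ x))
        (∑-member {f = λ y → ⟦ same (ℓ x) (ℓ y) ⟧} (λ y → ⟦⟧-nonneg (same (ℓ x) (ℓ y))) (complete x)))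

      -- Expanding the atom average gives a double sum over pairs in a common atom. On such a pair ψ
      -- and the atom size take equal values, so the sum over x collapses to the atom size and
      -- cancels its inverse.
      cond-adjoint : ∀ ℓ φ ψ → Measurable ℓ ψ → 𝔼 (λ x → cond ℓ φ x * ψ x) ≡ 𝔼 (λ x → φ x * ψ x)
      cond-adjoint ℓ φ ψ meas = trans (𝔼-def _) (trans (cong (inv size *_)
        (begin
          ∑ xs (λ x → cond ℓ φ x * ψ x)
            ≡⟨ ∑-cong xs (λ x → trans (lem₁ (inv (count ℓ (ℓ x))) _ (ψ x)) (sym (∑-*ʳ xs (inv (count ℓ (ℓ x)) * ψ x) _))) ⟩
          ∑ xs (λ x → ∑ xs (λ y → ⟦ same (ℓ x) (ℓ y) ⟧ * φ y * (inv (count ℓ (ℓ x)) * ψ x)))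
            ≡⟨ ∑-swap xs xs _ ⟩
          ∑ xs (λ y → ∑ xs (λ x → ⟦ same (ℓ x) (ℓ y) ⟧ * φ y * (inv (count ℓ (ℓ x)) * ψ x)))
            ≡⟨ ∑-cong xs (λ y → trans (∑-cong xs (λ x → pointwise x y)) (∑-*ʳ xs (inv (count ℓ (ℓ y)) * (φ y * ψ y)) _)) ⟩
          ∑ xs (λ y → count ℓ (ℓ y) * (inv (count ℓ (ℓ y)) * (φ y * ψ y)))
            ≡⟨ ∑-cong xs (λ y → trans (sym (*-assoc (count ℓ (ℓ y)) _ _)) (trans (cong (_* (φ y * ψ y)) (*-inv (count-pos ℓ y))) (*-identityˡ _))) ⟩
          ∑ xs (λ x → φ x * ψ x) ∎)) (sym (𝔼-def _)))
        where
        open ≡-Reasoning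
        lem₁ : ∀ i s p → i * s * p ≡ s * (i * p)
        lem₁ = solve-∀ ℚr
        lem₂ : ∀ i f p → 1ℚ * f * (i * p) ≡ 1ℚ * (i * (f * p))
        lem₂ = solve-∀ ℚr
        lem₃ : ∀ i f p i' p' → 0ℚ * f * (i * p) ≡ 0ℚ * (i' * (f * p'))
        lem₃ = solve-∀ ℚr
        pointwise : ∀ x y → ⟦ same (ℓ x) (ℓ y) ⟧ * φ y * (inv (count ℓ (ℓ x)) * ψ x) ≡ ⟦ same (ℓ y) (ℓ x) ⟧ * (inv (count ℓ (ℓ y)) * (φ y * ψ y))
        pointwise x y with ℓ x ≟C ℓ y | ℓ y ≟C ℓ x
        ... | yes p | yes q = trans (cong₂ (λ c s → 1ℚ * φ y * (inv (count ℓ c) * s)) p (meas x y p)) (lem₂ (inv (count ℓ (ℓ y))) (φ y) (ψ y))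
        ... | yes p | no q = ⊥-elim (q (sym p))
        ... | no p | yes q = ⊥-elim (p (sym q))
        ... | no p | no q = lem₃ (inv (count ℓ (ℓ x))) (φ y) (ψ x) (inv (count ℓ (ℓ y))) (ψ y)

      cond-nonneg : ∀ ℓ {φ} → (∀ x → 0ℚ ≤ φ x) → ∀ x → 0ℚ ≤ cond ℓ φ x
      cond-nonneg ℓ h x = inv-nonneg (count-pos ℓ x) ⊗ ∑-nonneg xs (λ y → ⟦⟧-nonneg (same (ℓ x) (ℓ y)) ⊗ h y)

      cond-≤ : ∀ ℓ {φ K} → (∀ x → φ x ≤ K) → ∀ x → cond ℓ φ x ≤ K
      cond-≤ ℓ {φ} {K} h x = subst (cond ℓ φ x ≤_) eq
        (*-mono-≤ (inv-nonneg (count-pos ℓ x)) (∑-mono xs (λ y → *-mono-≤ (⟦⟧-nonneg (same (ℓ x) (ℓ y))) (h y))))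
        where
        eq : inv (count ℓ (ℓ x)) * ∑ xs (λ y → ⟦ same (ℓ x) (ℓ y) ⟧ * K) ≡ K
        eq = trans (cong (inv (count ℓ (ℓ x)) *_) (∑-*ʳ xs K (λ y → ⟦ same (ℓ x) (ℓ y) ⟧))) (trans (lem (inv (count ℓ (ℓ x))) (count ℓ (ℓ x)) K) (trans (cong (_* K) (*-inv (count-pos ℓ x))) (*-identityˡ K)))
          where
          lem : ∀ i c k → i * (c * k) ≡ c * i * k
          lem = solve-∀ ℚr

    energy : (P → C) → (P → ℚ) → ℚ
    energy ℓ φ = 𝔼 (λ x → cond ℓ φ x * cond ℓ φ x)

    Refines : (P → C) → (P → C) → Set
    Refines ℓ' ℓ = ∀ x y → ℓ' x ≡ ℓ' y → ℓ x ≡ ℓ y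

    module _ {ℓ' ℓ : P → C} (ref : Refines ℓ' ℓ) (φ : P → ℚ) where

      -- The cross term becomes the mean of φ times the coarse expectation by adjointness for `ℓ'`,
      -- and then the coarse energy by adjointness for `ℓ`.
      pythagoras : 𝔼 (λ x → (cond ℓ' φ x - cond ℓ φ x) * (cond ℓ' φ x - cond ℓ φ x)) ≡ energy ℓ' φ - energy ℓ φ
      pythagoras = begin
        𝔼 (λ x → (a x - b x) * (a x - b x))
          ≡⟨ 𝔼-cong (λ x → lem (a x) (b x)) ⟩
        𝔼 (λ x → (a x * a x + b x * b x) - (1ℚ + 1ℚ) * (a x * b x))
          ≡⟨ trans (𝔼-- _ _) (cong₂ _-_ (𝔼-+ _ _) (𝔼-* (1ℚ + 1ℚ) _)) ⟩
        energy ℓ' φ + energy ℓ φ - (1ℚ + 1ℚ) * 𝔼 (λ x → a x * b x)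
          ≡⟨ cong (λ z → energy ℓ' φ + energy ℓ φ - (1ℚ + 1ℚ) * z)
               (trans (cond-adjoint ℓ' φ b (λ x y p → cond-measurable ℓ φ x y (ref x y p))) (sym (cond-adjoint ℓ φ b (cond-measurable ℓ φ)))) ⟩
        energy ℓ' φ + energy ℓ φ - (1ℚ + 1ℚ) * energy ℓ φ
          ≡⟨ lem₂ (energy ℓ' φ) (energy ℓ φ) ⟩
        energy ℓ' φ - energy ℓ φ ∎
        where
        open ≡-Reasoning
        a b : P → ℚ
        a = cond ℓ' φ
        b = cond ℓ φ
        lem : ∀ a b → (a - b) * (a - b) ≡ (a * a + b * b) - (1ℚ + 1ℚ) * (a * b)
        lem = solve-∀ ℚr
        lem₂ : ∀ a b → a + b - (1ℚ + 1ℚ) * b ≡ a - b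
        lem₂ = solve-∀ ℚr

      energy-mono : energy ℓ φ ≤ energy ℓ' φ
      energy-mono = ≤-by (subst (0ℚ ≤_) pythagoras (𝔼-nonneg (λ x → sq-nonneg (cond ℓ' φ x - cond ℓ φ x)))) (lem (energy ℓ φ) (energy ℓ' φ))
        where
        lem : ∀ a b → a + (b - a) ≡ b
        lem = solve-∀ ℚr

      -- The Cauchy–Schwarz inequality is replaced by u² ≥ 2ηug − η²g².
      energy-increment : ∀ {η} (g : P → ℚ) → Measurable ℓ' g → (∀ x → g x * g x ≤ 1ℚ) → 0ℚ ≤ η →
        η ≤ 𝔼 (λ x → (φ x - cond ℓ φ x) * g x) → energy ℓ φ + η * η ≤ energy ℓ' φ
      energy-increment {η} g meas g²≤1 0≤η corr = final _ _ _ η (subst ((1ℚ + 1ℚ) * η * 𝔼 (λ x → u x * g x) - η * η ≤_) pythagoras bound) 0≤η (subst (η ≤_) corr-eq corr)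
        where
        u : P → ℚ
        u x = cond ℓ' φ x - cond ℓ φ x
        distrib : ∀ a b c → (a - b) * c ≡ a * c - b * c
        distrib = solve-∀ ℚr
        corr-eq : 𝔼 (λ x → (φ x - cond ℓ φ x) * g x) ≡ 𝔼 (λ x → u x * g x)
        corr-eq = begin
          𝔼 (λ x → (φ x - cond ℓ φ x) * g x) ≡⟨ trans (𝔼-cong (λ x → distrib (φ x) _ (g x))) (𝔼-- _ _) ⟩
          𝔼 (λ x → φ x * g x) - 𝔼 (λ x → cond ℓ φ x * g x) ≡⟨ cong (_- 𝔼 (λ x → cond ℓ φ x * g x)) (sym (cond-adjoint ℓ' φ g meas)) ⟩
          𝔼 (λ x → cond ℓ' φ x * g x) - 𝔼 (λ x → cond ℓ φ x * g x) ≡⟨ sym (trans (𝔼-cong (λ x → distrib (cond ℓ' φ x) _ (g x))) (𝔼-- _ _)) ⟩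
          𝔼 (λ x → u x * g x) ∎
          where open ≡-Reasoning
        pointwise : ∀ u g η → g * g ≤ 1ℚ → (1ℚ + 1ℚ) * η * (u * g) - η * η ≤ u * u
        pointwise u g η h = ≤-by (sq-nonneg (u - η * g) ⊕ sq-nonneg η ⊗ sub-nonneg h) (solve (u ∷ g ∷ η ∷ []) ℚr)
        bound : (1ℚ + 1ℚ) * η * 𝔼 (λ x → u x * g x) - η * η ≤ 𝔼 (λ x → u x * u x)
        bound = subst (_≤ 𝔼 (λ x → u x * u x)) (trans (𝔼-- _ _) (cong₂ _-_ (𝔼-* ((1ℚ + 1ℚ) * η) _) (𝔼-const (η * η))))
          (𝔼-mono (λ x → pointwise (u x) (g x) η (g²≤1 x)))
        final : ∀ e e' c η → (1ℚ + 1ℚ) * η * c - η * η ≤ e' - e → 0ℚ ≤ η → η ≤ c → e + η * η ≤ e'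
        final e e' c η h p q = ≤-by (sub-nonneg h ⊕ (0≤1 ⊕ 0≤1) ⊗ p ⊗ sub-nonneg q) (solve (e ∷ e' ∷ c ∷ η ∷ []) ℚr)

    energy-≤ : ∀ ℓ {φ K} → (∀ x → 0ℚ ≤ φ x) → (∀ x → φ x ≤ K) → energy ℓ φ ≤ K * K
    energy-≤ ℓ {φ} {K} h₀ h₁ = 𝔼-≤ (λ x → sq (cond-nonneg ℓ h₀ x) (cond-≤ ℓ h₁ x))
      where
      sq : ∀ {a K} → 0ℚ ≤ a → a ≤ K → a * a ≤ K * K
      sq {a} {K} p q = ≤-by (sub-nonneg q ⊗ p ⊕ sub-nonneg q ⊗ ≤-trans p q) (solve (a ∷ K ∷ []) ℚr)

-- Imported only here: the ring solver's variable lists above must not see another constructor _∷_.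
open import Data.Vec using (Vec; []; _∷_; zipWith; lookup; replicate; toList)
open import Data.List.Relation.Unary.All using ([]; _∷_)
import Data.Vec as Vec
import Data.Vec.Properties as Vecₚ

∑-concatMap : ∀ {A B : Set} (g : A → List B) (xs : List A) (f : B → ℚ) → ∑ (concatMap g xs) f ≡ ∑ xs (λ x → ∑ (g x) f)
∑-concatMap g [] f = refl
∑-concatMap g (x ∷ xs) f = trans (∑-++ (g x) (concatMap g xs) f) (cong (∑ (g x) f +_) (∑-concatMap g xs f))

-- Points of the grid and functions of some of their coordinates.

length-allFin : ∀ n → length (allFin n) ≡ n
length-allFin n = Listₚ.length-tabulate {n = n} (λ i → i)

points : ∀ n d → List (Vec (Fin n) d)
points n zero = [] ∷ []
points n (suc d) = concatMap (λ v → map (v ∷_) (points n d)) (allFin n)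

∈-points : ∀ {n d} (x : Vec (Fin n) d) → x ∈ points n d
∈-points [] = here refl
∈-points {n} (v ∷ x) = ∈-concatMap⁺ (λ v → map (v ∷_) (points n _)) (Any.map (λ { refl → ∈-map⁺ (v ∷_) (∈-points x) }) (∈-allFin v))

∑-points : ∀ n d (f : Vec (Fin n) (suc d) → ℚ) → ∑ (points n (suc d)) f ≡ ∑ (allFin n) (λ v → ∑ (points n d) (λ x → f (v ∷ x)))
∑-points n d f = trans (∑-concatMap (λ v → map (v ∷_) (points n d)) (allFin n) f) (∑-cong (allFin n) (λ v → ∑-map (v ∷_) (points n d) f))

numPoints : ℕ → ℕ → ℚ
numPoints n d = ι (length (points n d))

numPoints-suc : ∀ n d → numPoints n (suc d) ≡ ι n * numPoints n d
numPoints-suc n d = begin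
  ι (length (points n (suc d)))                                  ≡⟨ sym (∑-one (points n (suc d))) ⟩
  ∑ (points n (suc d)) (λ _ → 1ℚ)                                ≡⟨ ∑-points n d (λ _ → 1ℚ) ⟩
  ∑ (allFin n) (λ v → ∑ (points n d) (λ _ → 1ℚ))                 ≡⟨ ∑-cong (allFin n) (λ _ → ∑-one (points n d)) ⟩
  ∑ (allFin n) (λ v → numPoints n d)                             ≡⟨ ∑-const (allFin n) _ ⟩
  ι (length (allFin n)) * numPoints n d                          ≡⟨ cong (λ m → ι m * numPoints n d) (length-allFin n) ⟩
  ι n * numPoints n d ∎
  where
  open ≡-Reasoning

-- A function g of vectors depends only on the coordinates in h exactly when g (mix h x z) ≡ g x for all x and z.

Coords : ℕ → Set
Coords d = Vec Bool d

mix : ∀ {A : Set} {d} → Coords d → Vec A d → Vec A d → Vec A d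
mix [] [] [] = []
mix (b ∷ e) (x ∷ xs) (z ∷ zs) = (if b then x else z) ∷ mix e xs zs

_∩_ : ∀ {d} → Coords d → Coords d → Coords d
_∩_ = zipWith _∧_

∩-idem : ∀ {d} (e : Coords d) → e ∩ e ≡ e
∩-idem = Vecₚ.zipWith-idem Boolₚ.∧-idem

∩-comm : ∀ {d} (e f : Coords d) → e ∩ f ≡ f ∩ e
∩-comm = Vecₚ.zipWith-comm Boolₚ.∧-comm

∩-assoc : ∀ {d} (e f g : Coords d) → (e ∩ f) ∩ g ≡ e ∩ (f ∩ g)
∩-assoc = Vecₚ.zipWith-assoc Boolₚ.∧-assoc

-- Fubini: in each coordinate only one of x and z is read, and the unread one contributes a factor
-- n.
∑-mix : ∀ n d (e : Coords d) (F : Vec (Fin n) d → ℚ) →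
  ∑ (points n d) (λ z → ∑ (points n d) (λ x → F (mix e x z))) ≡ numPoints n d * ∑ (points n d) F
∑-mix n zero [] F = lem (F [])
  where
  lem : ∀ a → a + 0ℚ + 0ℚ ≡ (1ℚ + 0ℚ) * (a + 0ℚ)
  lem = solve-∀ ℚr
∑-mix n (suc d) (b ∷ e) F = begin
  ∑ (points n (suc d)) (λ z → ∑ (points n (suc d)) (λ x → F (mix (b ∷ e) x z)))
    ≡⟨ trans (∑-points n d _) (∑-cong (allFin n) (λ w → ∑-cong (points n d) (λ z → ∑-points n d _))) ⟩
  ∑ (allFin n) (λ w → ∑ (points n d) (λ z → ∑ (allFin n) (λ v → ∑ (points n d) (λ x → F ((if b then v else w) ∷ mix e x z)))))
    ≡⟨ ∑-cong (allFin n) (λ w → trans (∑-swap (points n d) (allFin n) _) (∑-cong (allFin n) (λ v → ∑-mix n d e (λ x → F ((if b then v else w) ∷ x))))) ⟩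
  ∑ (allFin n) (λ w → ∑ (allFin n) (λ v → numPoints n d * ∑ (points n d) (λ x → F ((if b then v else w) ∷ x))))
    ≡⟨ pick b (λ v → numPoints n d * ∑ (points n d) (λ x → F (v ∷ x))) ⟩
  ι n * ∑ (allFin n) (λ v → numPoints n d * ∑ (points n d) (λ x → F (v ∷ x)))
    ≡⟨ cong (ι n *_) (∑-* (allFin n) (numPoints n d) _) ⟩
  ι n * (numPoints n d * ∑ (allFin n) (λ v → ∑ (points n d) (λ x → F (v ∷ x))))
    ≡⟨ sym (*-assoc (ι n) _ _) ⟩
  ι n * numPoints n d * ∑ (allFin n) (λ v → ∑ (points n d) (λ x → F (v ∷ x)))
    ≡⟨ sym (cong₂ _*_ (numPoints-suc n d) (∑-points n d F)) ⟩
  numPoints n (suc d) * ∑ (points n (suc d)) F ∎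
  where
  open ≡-Reasoning
  const-sum : ∀ c → ∑ (allFin n) (λ _ → c) ≡ ι n * c
  const-sum c = trans (∑-const (allFin n) c) (cong (λ m → ι m * c) (length-allFin n))
  pick : ∀ b (g : Fin n → ℚ) → ∑ (allFin n) (λ w → ∑ (allFin n) (λ v → g (if b then v else w))) ≡ ι n * ∑ (allFin n) g
  pick true g = const-sum _
  pick false g = trans (∑-cong (allFin n) (λ w → const-sum (g w))) (∑-* (allFin n) (ι n) g)

Supp : ∀ {V A : Set} {d} → Coords d → (Vec V d → A) → Set
Supp h g = ∀ x z → g (mix h x z) ≡ g x

module _ {V : Set} where

  mix-mix-∩ : ∀ {d} (h e : Coords d) (x w z : Vec V d) → mix h (mix e (mix (h ∩ e) x w) z) (mix e x z) ≡ mix e x z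
  mix-mix-∩ [] [] [] [] [] = refl
  mix-mix-∩ (a ∷ h) (b ∷ e) (x ∷ xs) (w ∷ ws) (z ∷ zs) = cong₂ _∷_ (head a b) (mix-mix-∩ h e xs ws zs)
    where
    head : ∀ a b → (if a then (if b then (if a ∧ b then x else w) else z) else (if b then x else z)) ≡ (if b then x else z)
    head true true = refl
    head true false = refl
    head false true = refl
    head false false = refl

  mix-⊆ : ∀ {d} (h e : Coords d) → h ∩ e ≡ h → ∀ (x z : Vec V d) → mix h (mix e x z) x ≡ x
  mix-⊆ [] [] _ [] [] = refl
  mix-⊆ (a ∷ h) (b ∷ e) p (x ∷ xs) (z ∷ zs) = cong₂ _∷_ (head a b (Vecₚ.∷-injectiveˡ p)) (mix-⊆ h e (Vecₚ.∷-injectiveʳ p) xs zs)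
    where
    head : ∀ a b → a ∧ b ≡ a → (if a then (if b then x else z) else x) ≡ x
    head true true _ = refl
    head false _ _ = refl

  module _ {A : Set} {d : ℕ} {g : Vec V d → A} where

    supp-agree : ∀ {h x y} → Supp h g → mix h x y ≡ y → g x ≡ g y
    supp-agree {h} {x} {y} s p = trans (sym (s x y)) (cong g p)

    supp-mono : ∀ {h e} → h ∩ e ≡ h → Supp h g → Supp e g
    supp-mono {h} {e} p s x z = supp-agree s (mix-⊆ h e p x z)

    -- Freezing the coordinates outside e leaves only those of h inside e; this is why tests and
    -- codes on e are built from the intersections h ∩ e.
    supp-mix : ∀ {h} e → Supp h g → ∀ z → Supp (h ∩ e) (λ x → g (mix e x z))
    supp-mix {h} e s z x w = supp-agree s (mix-mix-∩ h e x w z)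

all-true : ∀ {A : Set} (p : A → Bool) (xs : List A) → (∀ {x} → x ∈ xs → p x ≡ true) → all p xs ≡ true
all-true p [] h = refl
all-true p (x ∷ xs) h = cong₂ _∧_ (h (here refl)) (all-true p xs (λ m → h (there m)))

all-false : ∀ {A : Set} (p : A → Bool) {xs : List A} {x} → x ∈ xs → p x ≡ false → all p xs ≡ false
all-false p {y ∷ xs} (here refl) q = cong (_∧ all p xs) q
all-false p {y ∷ xs} (there m) q = trans (cong (p y ∧_) (all-false p m q)) (Boolₚ.∧-zeroʳ (p y))

all-∧ : ∀ {A : Set} (p q : A → Bool) (xs : List A) → all (λ x → p x ∧ q x) xs ≡ all p xs ∧ all q xs
all-∧ p q [] = refl
all-∧ p q (x ∷ xs) = trans (cong ((p x ∧ q x) ∧_) (all-∧ p q xs)) (lem (p x) (q x) (all p xs) (all q xs))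
  where
  lem : ∀ a b c d → (a ∧ b) ∧ (c ∧ d) ≡ (a ∧ c) ∧ (b ∧ d)
  lem true b true d = refl
  lem true b false d = Boolₚ.∧-zeroʳ b
  lem false b c d = refl

all-cong-∈ : ∀ {A : Set} (p q : A → Bool) (xs : List A) → (∀ {x} → x ∈ xs → p x ≡ q x) → all p xs ≡ all q xs
all-cong-∈ p q [] h = refl
all-cong-∈ p q (x ∷ xs) h = cong₂ _∧_ (h (here refl)) (all-cong-∈ p q xs (λ m → h (there m)))

map-cong-∈ : ∀ {A B : Set} (f g : A → B) (xs : List A) → (∀ {x} → x ∈ xs → f x ≡ g x) → map f xs ≡ map g xs
map-cong-∈ f g [] h = refl
map-cong-∈ f g (x ∷ xs) h = cong₂ _∷_ (h (here refl)) (map-cong-∈ f g xs (λ m → h (there m)))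

map-injective-∈ : ∀ {A B : Set} (f g : A → B) {xs : List A} → map f xs ≡ map g xs → ∀ {x} → x ∈ xs → f x ≡ g x
map-injective-∈ f g p (here refl) = Listₚ.∷-injectiveˡ p
map-injective-∈ f g p (there m) = map-injective-∈ f g (Listₚ.∷-injectiveʳ p) m

_≟C_ : ∀ {d} → DecidableEquality (Coords d)
_≟C_ = Vecₚ.≡-dec Boolₚ._≟_

-- Intersections with arbitrary e range over all subsets of h.
DownClosed : ∀ {d} → List (Coords d) → Set
DownClosed L = ∀ {h} → h ∈ L → ∀ e → (h ∩ e) ∈ L

∧-trueˡ : ∀ {a b} → a ∧ b ≡ true → a ≡ true
∧-trueˡ {true} _ = refl

∧-trueʳ : ∀ {a b} → a ∧ b ≡ true → b ≡ true
∧-trueʳ {true} p = p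

-- Labelled spaces, boxes, tests and cut regularity.

module Space (d n-1 : ℕ) where

  n : ℕ
  n = suc n-1

  P : Set
  P = Vec (Fin n) d

  origin : ∀ d → Vec (Fin n) d
  origin zero = []
  origin (suc d) = zero ∷ origin d

  open Average (points n d) ∈-points (origin d) public
  open Conditional (Listₚ.≡-dec ℕ._≟_) public

  𝔼-mix : ∀ e F → 𝔼 (λ z → 𝔼 (λ x → F (mix e x z))) ≡ 𝔼 F
  𝔼-mix e F = begin
    𝔼 (λ z → 𝔼 (λ x → F (mix e x z)))
      ≡⟨ trans (𝔼-def _) (cong (i *_) (∑-cong (points n d) (λ z → 𝔼-def (λ x → F (mix e x z))))) ⟩
    i * ∑ (points n d) (λ z → i * ∑ (points n d) (λ x → F (mix e x z)))
      ≡⟨ cong (i *_) (trans (∑-* (points n d) i _) (cong (i *_) (∑-mix n d e F))) ⟩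
    i * (i * (size * ∑ (points n d) F))
      ≡⟨ regroup i size (∑ (points n d) F) ⟩
    size * i * (i * ∑ (points n d) F)
      ≡⟨ trans (cong₂ _*_ (*-inv size-pos) (sym (𝔼-def F))) (*-identityˡ (𝔼 F)) ⟩
    𝔼 F ∎
    where
    open ≡-Reasoning
    i : ℚ
    i = inv size

  -- The partition complex of hypergraph regularity: one partition for every coordinate set, with N
  -- as the measure of complexity.
  record Labelling (N : ℕ) : Set where
    field
      lab : Coords d → P → ℕ
      lab< : ∀ h x → lab h x ℕ.< N
      lab-supp : ∀ h → Supp h (lab h)
  open Labelling public

  weaken : ∀ {N N'} → N ℕ.≤ N' → Labelling N → Labelling N'
  weaken p π = record { lab = lab π ; lab< = λ h x → ℕₚ.<-≤-trans (lab< π h x) p ; lab-supp = lab-supp π }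

  _⊑_ : ∀ {N N'} → Labelling N' → Labelling N → Set
  π' ⊑ π = ∀ h x y → lab π' h x ≡ lab π' h y → lab π h x ≡ lab π h y

  -- R is an intersection of cylinder sets, one inside the cell of x for each h in L. Asking for
  -- containment, not for the whole cell, lets a box of a finer labelling serve unchanged for a
  -- coarser one.
  data Box {N} (π : Labelling N) (x : P) : List (Coords d) → (P → Bool) → Set where
    [] : Box π x [] (λ _ → true)
    cons : ∀ {h L ρ R} → Supp h ρ → (∀ y → ρ y ≡ true → lab π h y ≡ lab π h x) → Box π x L R →
           Box π x (h ∷ L) (λ y → ρ y ∧ R y)

  box-member : ∀ {N} {π : Labelling N} {x L R} → Box π x L R → ∀ {h y} → h ∈ L → R y ≡ true → lab π h y ≡ lab π h x
  box-member (cons s c B) (here refl) p = c _ (∧-trueˡ p)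
  box-member (cons {ρ = ρ} s c B) {y = y} (there m) p = box-member B m (∧-trueʳ {ρ y} p)

  box-coarsen : ∀ {N N'} {π' : Labelling N'} {π : Labelling N} → π' ⊑ π → ∀ {x L R} → Box π' x L R → Box π x L R
  box-coarsen r [] = []
  box-coarsen r (cons {h = h} s c B) = cons s (λ y p → r h _ _ (c y p)) (box-coarsen r B)

  module Algebra (L : List (Coords d)) (down : DownClosed L) where

    -- G is indexed by coordinate sets and not by members of L, so that `refine` can absorb a test
    -- by adding one bit to the label of each set.
    Test : Coords d → (P → Bool) → Set
    Test e T = Σ (Coords d → P → Bool) λ G → (∀ g → Supp g (G g)) × (∀ y → T y ≡ all (λ h → G (h ∩ e) y) L)

    test-true : ∀ {e} → Test e (λ _ → true)
    test-true = (λ _ _ → true) , (λ _ _ _ → refl) , (λ y → sym (all-true _ L (λ _ → refl)))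

    test-∧ : ∀ {e T T'} → Test e T → Test e T' → Test e (λ y → T y ∧ T' y)
    test-∧ (G , s , p) (G' , s' , p') =
      (λ g y → G g y ∧ G' g y) , (λ g x z → cong₂ _∧_ (s g x z) (s' g x z)) ,
      (λ y → trans (cong₂ _∧_ (p y) (p' y)) (sym (all-∧ _ _ L)))

    test-atom : ∀ {e h ψ} → h ∈ L → Supp (h ∩ e) ψ → Test e ψ
    test-atom {e} {h} {ψ} m s = G , supp , eq
      where
      G : Coords d → P → Bool
      G g y = if does (g ≟C (h ∩ e)) then ψ y else true
      supp : ∀ g → Supp g (G g)
      supp g x z with g ≟C (h ∩ e)
      ... | yes refl = s x z
      ... | no _ = refl
      G-true : ∀ {y} g → ψ y ≡ true → G g y ≡ true
      G-true g p with does (g ≟C (h ∩ e))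
      ... | true = p
      ... | false = refl
      G-at : ∀ y → G (h ∩ e) y ≡ ψ y
      G-at y with (h ∩ e) ≟C (h ∩ e)
      ... | yes _ = refl
      ... | no ¬p = ⊥-elim (¬p refl)
      eq : ∀ y → ψ y ≡ all (λ h' → G (h' ∩ e) y) L
      eq y with ψ y in q
      ... | true = sym (all-true _ L (λ {h'} _ → trans (sym (cong (λ b → if does ((h' ∩ e) ≟C (h ∩ e)) then b else true) q)) (G-true (h' ∩ e) q)))
      ... | false = sym (all-false _ m (trans (sym (cong (λ b → if does ((h ∩ e) ≟C (h ∩ e)) then b else true) q)) (trans (G-at y) q)))

    box-test : ∀ {N} {π : Labelling N} {x L' R} → Box π x L' R → (∀ {h} → h ∈ L' → h ∈ L) → ∀ e z → Test e (λ y → R (mix e y z))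
    box-test [] sub e z = test-true
    box-test (cons s c B) sub e z = test-∧ (test-atom (sub (here refl)) (supp-mix e s z)) (box-test B (λ m → sub (there m)) e z)

    -- The list names the atom of x in the algebra on e generated by the labels of all h ∩ e with h
    -- in L.
    code : ∀ {N} → Labelling N → Coords d → P → List ℕ
    code π e x = map (λ h → lab π (h ∩ e) x) L

    code-supp : ∀ {N} (π : Labelling N) e → Supp e (code π e)
    code-supp π e x z = map-cong-∈ _ _ L (λ {h} _ → supp-mono {h = h ∩ e} {e = e} (trans (∩-assoc h e e) (cong (h ∩_) (∩-idem e))) (lab-supp π (h ∩ e)) x z)

    code-refines : ∀ {N N'} (π' : Labelling N') (π : Labelling N) → π' ⊑ π → ∀ e → Refines (code π' e) (code π e)
    code-refines π' π r e x y p = map-cong-∈ _ _ L (λ {h} m → r (h ∩ e) x y (map-injective-∈ _ _ p m))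

    box-code : ∀ {N} {π : Labelling N} {x R} → Box π x L R → ∀ e {y} → R y ≡ true → code π e y ≡ code π e x
    box-code B e p = map-cong-∈ _ _ L (λ m → box-member B (down m e) p)

    module _ {N : ℕ} (π : Labelling N) (G : Coords d → P → Bool) (G-supp : ∀ g → Supp g (G g)) where

      -- Encodes a bit together with a label below N in one label below 2N.
      shift : Bool → ℕ → ℕ
      shift b a = if b then N ℕ.+ a else a

      shift-injective : ∀ b b' {a a'} → a ℕ.< N → a' ℕ.< N → shift b a ≡ shift b' a' → b ≡ b' × a ≡ a'
      shift-injective true true p q e = refl , ℕₚ.+-cancelˡ-≡ N _ _ e
      shift-injective true false p q e = ⊥-elim (ℕₚ.<⇒≱ q (subst (N ℕ.≤_) e (ℕₚ.m≤m+n N _)))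
      shift-injective false true p q e = ⊥-elim (ℕₚ.<⇒≱ p (subst (N ℕ.≤_) (sym e) (ℕₚ.m≤m+n N _)))
      shift-injective false false p q e = refl , e

      shift< : ∀ b {a} → a ℕ.< N → shift b a ℕ.< N ℕ.+ N
      shift< true p = ℕₚ.+-monoʳ-< N p
      shift< false p = ℕₚ.<-≤-trans p (ℕₚ.m≤m+n N N)

      refine : Labelling (N ℕ.+ N)
      refine = record
        { lab = λ h x → shift (G h x) (lab π h x)
        ; lab< = λ h x → shift< (G h x) (lab< π h x)
        ; lab-supp = λ h x z → cong₂ shift (G-supp h x z) (lab-supp π h x z)
        }

      refine-⊑ : refine ⊑ π
      refine-⊑ h x y p = proj₂ (shift-injective (G h x) (G h y) (lab< π h x) (lab< π h y) p)

      refine-measurable : ∀ e → Measurable (code refine e) (λ y → all (λ h → G (h ∩ e) y) L)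
      refine-measurable e x y p = all-cong-∈ _ _ L (λ {h} m →
        proj₁ (shift-injective (G (h ∩ e) x) (G (h ∩ e) y) (lab< π (h ∩ e) x) (lab< π (h ∩ e) y) (map-injective-∈ _ _ p m)))

    record Fn (K : ℚ) : Set where
      field
        on : Coords d
        fn : P → ℚ
        fn-supp : Supp on fn
        fn-nonneg : ∀ x → 0ℚ ≤ fn x
        fn-≤ : ∀ x → fn x ≤ K
        off : Fin d
        off-missing : lookup on off ≡ false
    open Fn public

    mean : ∀ {N K} → Labelling N → Fn K → P → ℚ
    mean π t = cond (code π (on t)) (fn t)

    mean-supp : ∀ {N K} (π : Labelling N) (t : Fn K) → Supp (on t) (mean π t)
    mean-supp π t x z = cond-measurable (code π (on t)) (fn t) _ _ (code-supp π (on t) x z)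

    module _ {K : ℚ} (Φ : List (Fn K)) where

      totalEnergy : ∀ {N} → Labelling N → ℚ
      totalEnergy π = ∑ Φ (λ t → energy (code π (on t)) (fn t))

      -- Both signs are used: the upper bound for the mass lost to the weights, the lower bound for
      -- the mass of the refined box.
      CutRegular : ∀ {N} → ℚ → Labelling N → Set
      CutRegular η π = ∀ {t} → t ∈ Φ → ∀ {T} → Test (on t) T →
        𝔼 (λ x → (fn t x - mean π t x) * ⟦ T x ⟧) ≤ η × - η ≤ 𝔼 (λ x → (fn t x - mean π t x) * ⟦ T x ⟧)

      totalEnergy-≤ : ∀ {N} (π : Labelling N) → totalEnergy π ≤ ι (length Φ) * (K * K)
      totalEnergy-≤ π = subst (totalEnergy π ≤_) (∑-const Φ (K * K)) (∑-mono Φ (λ t → energy-≤ (code π (on t)) (fn-nonneg t) (fn-≤ t)))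

      totalEnergy-nonneg : ∀ {N} (π : Labelling N) → 0ℚ ≤ totalEnergy π
      totalEnergy-nonneg π = ∑-nonneg Φ (λ t → 𝔼-nonneg (λ x → sq-nonneg (mean π t x)))

      totalEnergy-increment : ∀ {N N'} (π' : Labelling N') (π : Labelling N) {c} → π' ⊑ π → ∀ {t} → t ∈ Φ →
        energy (code π (on t)) (fn t) + c ≤ energy (code π' (on t)) (fn t) → totalEnergy π + c ≤ totalEnergy π'
      totalEnergy-increment π' π {c} r {t} m h = gain-bound _ _ _ _ c
        (subst (E' t - E t ≤_) diff (∑-member (λ s → sub-nonneg (energy-mono (code-refines π' π r (on s)) (fn s))) m)) h
        where
        E E' : Fn K → ℚ
        E s = energy (code π (on s)) (fn s)
        E' s = energy (code π' (on s)) (fn s)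
        diff : ∑ Φ (λ s → E' s - E s) ≡ totalEnergy π' - totalEnergy π
        diff = trans (∑-cong Φ (λ s → minus-scale (E' s) (E s))) (trans (∑-+ Φ E' _) (trans (cong (totalEnergy π' +_) (∑-* Φ (- 1ℚ) E)) (sym (minus-scale (totalEnergy π') (totalEnergy π)))))

      increment : ∀ {N} (π : Labelling N) {η} → 0ℚ ≤ η → ∀ {t} → t ∈ Φ → ∀ {T} (test : Test (on t) T) (s : ℚ) → s * s ≡ 1ℚ → η ≤ 𝔼 (λ x → (fn t x - mean π t x) * (s * ⟦ T x ⟧)) →
        totalEnergy π + η * η ≤ totalEnergy (refine π (proj₁ test) (proj₁ (proj₂ test)))
      increment π {η} 0≤η {t} t∈Φ {T} (G , G-supp , T≡) s s²≡1 corr = totalEnergy-increment (refine π G G-supp) π (refine-⊑ π G G-supp) t∈Φ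
        (energy-increment (code-refines (refine π G G-supp) π (refine-⊑ π G G-supp) (on t)) (fn t) (λ x → s * ⟦ T x ⟧)
          (λ x y p → cong (λ b → s * ⟦ b ⟧) (trans (T≡ x) (trans (refine-measurable π G G-supp (on t) x y p) (sym (T≡ y)))))
          (λ x → sq (T x)) 0≤η corr)
        where
        sq : ∀ b → (s * ⟦ b ⟧) * (s * ⟦ b ⟧) ≤ 1ℚ
        sq true = ≤-reflexive (trans (cong₂ _*_ (*-identityʳ s) (*-identityʳ s)) s²≡1)
        sq false = subst (λ z → z * z ≤ 1ℚ) (sym (*-zeroʳ s)) 0≤1

      -- No search for a correlated test takes place. Assuming that there is no regular refinement,
      -- any given test is decided by comparing its correlation with η, and a violating one is
      -- absorbed at a gain of η² in energy. The numerical hypothesis says that m further gains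
      -- would exceed the largest possible energy.
      weak-regularity : ∀ {η} → 0ℚ ≤ η → ∀ m {N} (π : Labelling N) → ι (length Φ) * (K * K) < totalEnergy π + ι m * (η * η) →
        ¬ ¬ Σ (Labelling (2 ℕ.^ m ℕ.* N)) λ π' → (π' ⊑ π) × CutRegular η π'
      weak-regularity {η} 0≤η zero π h _ = <-irrefl refl (<-≤-trans h (subst (_≤ ι (length Φ) * (K * K)) (plus-zero* (totalEnergy π) (η * η)) (totalEnergy-≤ π)))
      weak-regularity {η} 0≤η (suc m) {N} π h k = k (weaken (ℕₚ.m≤n*m N (2 ℕ.^ suc m) {{ℕₚ.m^n≢0 2 (suc m)}}) π , (λ _ _ _ p → p) , regular)
        where
        continue : ∀ (G : Coords d → P → Bool) (s : ∀ g → Supp g (G g)) → totalEnergy π + η * η ≤ totalEnergy (refine π G s) → ⊥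
        continue G s inc = weak-regularity 0≤η m (refine π G s) (<-≤-trans h (step-bound (totalEnergy π) (totalEnergy (refine π G s)) (ι m) (η * η) inc))
          λ { (π' , r , reg) → k (weaken (ℕₚ.≤-reflexive size-eq) π' , (λ g x y p → refine-⊑ π G s g x y (r g x y p)) , reg) }
          where
          size-eq : 2 ℕ.^ m ℕ.* (N ℕ.+ N) ≡ 2 ℕ.^ suc m ℕ.* N
          size-eq = trans (cong (λ z → 2 ℕ.^ m ℕ.* (N ℕ.+ z)) (sym (ℕₚ.+-identityʳ N))) (trans (sym (ℕₚ.*-assoc (2 ℕ.^ m) 2 N)) (cong (ℕ._* N) (ℕₚ.*-comm (2 ℕ.^ m) 2)))
        regular : CutRegular η π
        regular {t} m∈ {T} test@(G , s , _) = upper , lower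
          where
          c : ℚ
          c = 𝔼 (λ x → (fn t x - mean π t x) * ⟦ T x ⟧)
          scaled : ∀ s → 𝔼 (λ x → (fn t x - mean π t x) * (s * ⟦ T x ⟧)) ≡ s * c
          scaled s = trans (𝔼-cong (λ x → *-pull (fn t x - mean π t x) s ⟦ T x ⟧)) (𝔼-* s _)
          upper : c ≤ η
          upper with c ≤? η
          ... | yes p = p
          ... | no ¬p = ⊥-elim (continue G s (increment π 0≤η m∈ test 1ℚ refl (subst (η ≤_) (sym (trans (scaled 1ℚ) (*-identityˡ c))) (<⇒≤ (≰⇒> ¬p)))))
          lower : - η ≤ c
          lower with - η ≤? c
          ... | yes p = p
          ... | no ¬p = ⊥-elim (continue G s (increment π 0≤η m∈ test (- 1ℚ) refl (subst (η ≤_) (sym (scaled (- 1ℚ))) (negate-bound c η (<⇒≤ (≰⇒> ¬p))))))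

-- The number of labels along the energy increment argument depends only on the parameters, not on the labelled space.
module Growth (Emax : ℚ) (η δ : ℕ → ℚ) (η-pos : ∀ N → 0ℚ < η N) where

  steps : ∀ N → ∃[ m ] Emax < ι m * (η N * η N)
  steps N = archimedean* Emax (mul-pos (η-pos N) (η-pos N))

  grow : ℕ → ℕ
  grow N = 2 ℕ.^ proj₁ (steps N) ℕ.* N

  -- The stage at which the iteration stops depends on the labelled space; the minimum over all
  -- possible stages does not.
  minAlong : ℕ → ℕ → ℚ
  minAlong zero N = δ N
  minAlong (suc k) N = δ N ⊓ minAlong k (grow N)

  minAlong-pos : (∀ N → 0ℚ < δ N) → ∀ k N → 0ℚ < minAlong k N
  minAlong-pos h zero N = h N
  minAlong-pos h (suc k) N = ⊓-pos (h N) (minAlong-pos h k (grow N))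

  module _ {d n-1 : ℕ} (L : List (Coords d)) (down : DownClosed L) where

    open Space d n-1
    open Algebra L down

    module _ {K : ℚ} (Φ : List (Fn K)) (Emax-eq : ι (length Φ) * (K * K) ≡ Emax) {gap : ℚ} where

      -- The accuracy of the fine labelling is dictated by the complexity `N₀` of the coarse one.
      -- The field `bound` lets b be named before `N₀` is known.
      record StrongRegular (b : ℚ) {N} (π : Labelling N) : Set where
        field
          {N₀ N₁} : ℕ
          π₀ : Labelling N₀
          π₁ : Labelling N₁
          π₀⊑π : π₀ ⊑ π
          π₁⊑π₀ : π₁ ⊑ π₀
          regular : CutRegular Φ (η N₀) π₁
          energy-gap : totalEnergy Φ π₁ ≤ totalEnergy Φ π₀ + gap
          bound : b ≤ δ N₀

      -- Weak regularity is iterated with the accuracy prescribed by the current complexity. A round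
      -- that gains at most `gap` ends the process; any other uses up one of the k gains that the
      -- energy bound permits.
      strong-regularity : ∀ k {N} (π : Labelling N) → Emax < totalEnergy Φ π + ι k * gap → ¬ ¬ StrongRegular (minAlong k N) π
      strong-regularity zero π h _ = <-irrefl refl (<-≤-trans h (subst₂ _≤_ (plus-zero* (totalEnergy Φ π) gap) Emax-eq (totalEnergy-≤ Φ π)))
      strong-regularity (suc k) {N} π h absurd =
        weak-regularity Φ (<⇒≤ (η-pos N)) (proj₁ (steps N)) π
          (subst (_< totalEnergy Φ π + ι (proj₁ (steps N)) * (η N * η N)) (sym Emax-eq)
            (<-≤-trans (proj₂ (steps N)) (≤-by (totalEnergy-nonneg Φ π) (+-comm _ (totalEnergy Φ π)))))
          continue
        where
        continue : ¬ Σ (Labelling (grow N)) λ π' → (π' ⊑ π) × CutRegular Φ (η N) π'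
        continue (π' , r , reg) with totalEnergy Φ π' ≤? totalEnergy Φ π + gap
        ... | yes p = absurd record { π₀ = π ; π₁ = π' ; π₀⊑π = λ _ _ _ q → q ; π₁⊑π₀ = r ; regular = reg ; energy-gap = p ; bound = p⊓q≤p (δ N) _ }
        ... | no ¬p = strong-regularity k π' (<-≤-trans h (step-bound (totalEnergy Φ π) (totalEnergy Φ π') (ι k) gap (<⇒≤ (≰⇒> ¬p))))
          λ s → let open StrongRegular s in absurd record
            { π₀ = π₀ ; π₁ = π₁ ; π₀⊑π = λ g x y q → r g x y (π₀⊑π g x y q) ; π₁⊑π₀ = π₁⊑π₀ ; regular = regular
            ; energy-gap = energy-gap ; bound = ≤-trans (p⊓q≤q (δ N) _) bound }

-- Sets omitting one coordinate, and counting inside a box.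

full : ∀ {d} → Coords d
full = replicate _ true

co : ∀ {d} → Fin d → Coords d
co zero = false ∷ full
co (suc i) = true ∷ co i

∩-full : ∀ {d} (f : Coords d) → f ∩ full ≡ f
∩-full = Vecₚ.zipWith-identityʳ Boolₚ.∧-identityʳ

lookup-co : ∀ {d} (i : Fin d) → lookup (co i) i ≡ false
lookup-co zero = refl
lookup-co (suc i) = lookup-co i

∩-co : ∀ {d} (f : Coords d) i → lookup f i ≡ false → f ∩ co i ≡ f
∩-co (b ∷ f) zero p = cong₂ _∷_ (trans (Boolₚ.∧-zeroʳ b) (sym p)) (∩-full f)
∩-co (b ∷ f) (suc i) p = cong₂ _∷_ (Boolₚ.∧-identityʳ b) (∩-co f i p)

∩-co≢ : ∀ {d} (f : Coords d) i → lookup f i ≡ true → f ∩ co i ≢ f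
∩-co≢ f i p e = case (trans (sym p) (trans (cong (λ h → lookup h i) (sym e)) (trans (Vecₚ.lookup-zipWith _∧_ i f (co i)) (trans (cong (lookup f i ∧_) (lookup-co i)) (Boolₚ.∧-zeroʳ (lookup f i))))))
  where
  case : true ≢ false
  case ()

mix-mix : ∀ {V : Set} {d} (k : Coords d) (x z w : Vec V d) → mix k (mix k x z) w ≡ mix k x w
mix-mix [] [] [] [] = refl
mix-mix (true ∷ k) (x ∷ xs) (z ∷ zs) (w ∷ ws) = cong (x ∷_) (mix-mix k xs zs ws)
mix-mix (false ∷ k) (x ∷ xs) (z ∷ zs) (w ∷ ws) = cong (w ∷_) (mix-mix k xs zs ws)

assoc-* : ∀ a b c → a * (b * c) ≡ a * b * c
assoc-* = solve-∀ ℚr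

swap-out : ∀ a b m → a * b + a * (m - b) ≡ m * (a * 1ℚ)
swap-out = solve-∀ ℚr

zero-out : ∀ a b m → a * b + b * (0ℚ - a) ≡ m * (a * 0ℚ)
zero-out = solve-∀ ℚr

module Counting {d n-1 : ℕ} (L : List (Coords d)) (down : DownClosed L) {K : ℚ} (Φ : List (Space.Algebra.Fn d n-1 L down K))
                {η : ℚ} {N₀ N₁ : ℕ} (π₀ : Space.Labelling d n-1 N₀) (π₁ : Space.Labelling d n-1 N₁)
                (reg : Space.Algebra.CutRegular d n-1 L down Φ η π₁) where

  open Space d n-1
  open Algebra L down

  err : Fn K → P → ℚ
  err t x = mean π₁ t x - mean π₀ t x

  W : P → ℚ
  W x = ∑ Φ (λ t → err t x * err t x)

  W-nonneg : ∀ x → 0ℚ ≤ W x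
  W-nonneg x = ∑-nonneg Φ (λ t → sq-nonneg (err t x))

  W-member : ∀ {t} → t ∈ Φ → ∀ x → err t x * err t x ≤ W x
  W-member m x = ∑-member (λ t → sq-nonneg (err t x)) m

  residue : Fn K → P → ℚ
  residue t x = fn t x - mean π₁ t x

  residue-supp : ∀ t → Supp (on t) (residue t)
  residue-supp t x z = cong₂ _-_ (fn-supp t x z) (mean-supp π₁ t x z)

  -- As B ignores the coordinates outside k, F can be averaged over them first.
  integrate-out : ∀ k (F B : P → ℚ) → Supp k B → 𝔼 (λ y → F y * B y) ≡ 𝔼 (λ y → 𝔼 (λ w → F (mix k y w)) * B y)
  integrate-out k F B s = begin
    𝔼 (λ y → F y * B y)                                       ≡⟨ sym (𝔼-mix k (λ y → F y * B y)) ⟩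
    𝔼 (λ w → 𝔼 (λ y → F (mix k y w) * B (mix k y w)))         ≡⟨ 𝔼-cong (λ w → 𝔼-cong (λ y → cong (F (mix k y w) *_) (s y w))) ⟩
    𝔼 (λ w → 𝔼 (λ y → F (mix k y w) * B y))                   ≡⟨ 𝔼-swap _ ⟩
    𝔼 (λ y → 𝔼 (λ w → F (mix k y w) * B y))                   ≡⟨ 𝔼-cong (λ y → 𝔼-*ʳ (B y) _) ⟩
    𝔼 (λ y → 𝔼 (λ w → F (mix k y w)) * B y) ∎
    where open ≡-Reasoning

  -- The weight B is replaced by M times the indicator of the set where its coefficient ψ is positive, which is again part of a test.
  cut-weight : ∀ {t} → t ∈ Φ → ∀ {T} → Test (on t) T → ∀ {k} → k ∈ L → k ∩ on t ≡ k →
    ∀ {B : P → ℚ} {M} → Supp k B → (∀ y → 0ℚ ≤ B y) → (∀ y → B y ≤ M) → 0ℚ ≤ M →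
    𝔼 (λ y → residue t y * (⟦ T y ⟧ * B y)) ≤ M * η
  cut-weight {t} m {T} test {k} k∈ k⊆ {B} {M} B-supp 0≤B B≤M 0≤M =
    subst (_≤ M * η) (sym (trans (𝔼-cong (λ y → assoc-* (residue t y) ⟦ T y ⟧ (B y))) (integrate-out k F B B-supp)))
      (≤-trans (𝔼-mono (λ y → pointwise (ψ y) (0≤B y) (B≤M y)))
        (subst (_≤ M * η) (sym (𝔼-* M (λ y → ψ y * ⟦ pos y ⟧))) (*-mono-≤ 0≤M
          (subst (_≤ η) (trans (𝔼-cong (λ y → trans (cong (residue t y *_) (⟦⟧-∧ (T y) (pos y))) (assoc-* (residue t y) ⟦ T y ⟧ ⟦ pos y ⟧)))
              (integrate-out k F (λ y → ⟦ pos y ⟧) (λ x z → cong ⟦_⟧ (pos-supp x z))))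
            (proj₁ (reg m (test-∧ test (test-atom k∈ (subst (λ h → Supp h pos) (sym k⊆) pos-supp)))))))))
    where
    F ψ : P → ℚ
    F y = residue t y * ⟦ T y ⟧
    ψ y = 𝔼 (λ w → F (mix k y w))
    pos : P → Bool
    pos y = lt 0ℚ (ψ y)
    pos-supp : Supp k pos
    pos-supp x z = cong (lt 0ℚ) (𝔼-cong (λ w → cong F (mix-mix k x z w)))
    pointwise : ∀ a {b M} → 0ℚ ≤ b → b ≤ M → a * b ≤ M * (a * ⟦ lt 0ℚ a ⟧)
    pointwise a {b} {M} p q with lt-spec 0ℚ a
    ... | inj₁ (e , 0<a) = subst (λ c → a * b ≤ M * (a * ⟦ c ⟧)) (sym e) (≤-by (<⇒≤ 0<a ⊗ sub-nonneg q) (swap-out a b M))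
    ... | inj₂ (e , a≤0) = subst (λ c → a * b ≤ M * (a * ⟦ c ⟧)) (sym e) (≤-by (p ⊗ sub-nonneg a≤0) (zero-out a b M))

  module _ {x : P} {R : P → Bool} (box : Box π₀ x L R) where

    -- The residue sees only `on t`, so the other coordinates can be frozen, and on each slice the
    -- box becomes a test.
    slices : ∀ t (B : P → ℚ) → 𝔼 (λ y → residue t y * (⟦ R y ⟧ * B y)) ≡ 𝔼 (λ z → 𝔼 (λ y → residue t y * (⟦ R (mix (on t) y z) ⟧ * B (mix (on t) y z))))
    slices t B = trans (sym (𝔼-mix (on t) (λ y → residue t y * (⟦ R y ⟧ * B y))))
      (𝔼-cong (λ z → 𝔼-cong (λ y → cong (_* (⟦ R (mix (on t) y z) ⟧ * B (mix (on t) y z))) (residue-supp t y z))))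

    test-slice : ∀ e z → Test e (λ y → R (mix e y z))
    test-slice = box-test box (λ m → m)

    cut-upper : ∀ {t} → t ∈ Φ → 𝔼 (λ y → residue t y * (⟦ R y ⟧ * 1ℚ)) ≤ η
    cut-upper {t} m = subst (_≤ η) (sym (slices t (λ _ → 1ℚ)))
      (𝔼-≤ (λ z → subst (_≤ η) (𝔼-cong (λ y → cong (residue t y *_) (sym (*-identityʳ _)))) (proj₁ (reg m (test-slice (on t) z)))))

    cut-lower : ∀ {t} → t ∈ Φ → - η ≤ 𝔼 (λ y → residue t y * ⟦ R y ⟧)
    cut-lower {t} m = subst₂ _≤_ (𝔼-const (- η)) (trans (sym (slices t (λ _ → 1ℚ))) (𝔼-cong (λ y → cong (residue t y *_) (*-identityʳ _))))
      (𝔼-mono (λ z → subst (- η ≤_) (𝔼-cong (λ y → cong (residue t y *_) (sym (*-identityʳ _)))) (proj₂ (reg m (test-slice (on t) z)))))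

    -- On a slice the weight lives on `on t ∩ co j`; membership of this set in L makes the
    -- positivity set in `cut-weight` an admissible factor of a test.
    cut-box-weight : ∀ {t} → t ∈ Φ → ∀ {j} → (on t ∩ co j) ∈ L → ∀ {B : P → ℚ} {M} → Supp (co j) B → (∀ y → 0ℚ ≤ B y) → (∀ y → B y ≤ M) → 0ℚ ≤ M →
      𝔼 (λ y → residue t y * (⟦ R y ⟧ * B y)) ≤ M * η
    cut-box-weight {t} m {j} k∈ {B} {M} s 0≤B B≤M 0≤M = subst (_≤ M * η) (sym (slices t B))
      (𝔼-≤ (λ z → cut-weight m (test-slice (on t) z) k∈ k⊆ {B = λ y → B (mix (on t) y z)}
        (subst (λ h → Supp h (λ y → B (mix (on t) y z))) (∩-comm (co j) (on t)) (supp-mix {h = co j} (on t) s z))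
        (λ y → 0≤B (mix (on t) y z)) (λ y → B≤M (mix (on t) y z)) 0≤M))
      where
      k⊆ : (on t ∩ co j) ∩ on t ≡ on t ∩ co j
      k⊆ = trans (∩-comm (on t ∩ co j) (on t)) (trans (sym (∩-assoc (on t) (on t) (co j))) (cong (_∩ co j) (∩-idem (on t))))

    mean-on-box : ∀ (t : Fn K) y → R y ≡ true → mean π₀ t y ≡ mean π₀ t x
    mean-on-box t y p = cond-measurable (code π₀ (on t)) (fn t) y x (box-code box (on t) p)

    r w : ℚ
    r = 𝔼 (λ y → ⟦ R y ⟧)
    w = 𝔼 (λ y → ⟦ R y ⟧ * W y)

    r-nonneg : 0ℚ ≤ r
    r-nonneg = 𝔼-nonneg (λ y → ⟦⟧-nonneg (R y))

    w-nonneg : 0ℚ ≤ w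
    w-nonneg = 𝔼-nonneg (λ y → ⟦⟧-nonneg (R y) ⊗ W-nonneg y)

    module _ {l i : ℚ} (li≡1 : l * i ≡ 1ℚ) (0≤l : 0ℚ ≤ l) (0≤i : 0ℚ ≤ i) {t : Fn K} (t∈Φ : t ∈ Φ) where

      err-at : ∀ y → R y ≡ true → (mean π₁ t y - mean π₀ t x) * (mean π₁ t y - mean π₀ t x) ≤ W y
      err-at y p = subst (λ c → (mean π₁ t y - c) * (mean π₁ t y - c) ≤ W y) (mean-on-box t y p) (W-member t∈Φ y)

      loss : 𝔼 (λ y → l * ⟦ R y ⟧ + i * (⟦ R y ⟧ * W y)) ≡ l * r + i * w
      loss = trans (𝔼-+ _ _) (cong₂ _+_ (𝔼-* l _) (𝔼-* i _))

      -- Here and in `upper`, the function is split into residue, fine minus coarse mean, and coarse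
      -- mean. Cut regularity controls the first, `am-gm` charges the second to W, and the third is
      -- constant on the box.
      lower : mean π₀ t x * r + - η ≤ 𝔼 (λ y → fn t y * ⟦ R y ⟧) + (l * r + i * w)
      lower = ≤-trans (+-monoʳ-≤ (mean π₀ t x * r) (cut-lower t∈Φ))
        (subst₂ _≤_ (trans (𝔼-+ _ _) (cong (_+ 𝔼 (λ y → residue t y * ⟦ R y ⟧)) (𝔼-* (mean π₀ t x) _))) (trans (𝔼-+ _ _) (cong (𝔼 (λ y → fn t y * ⟦ R y ⟧) +_) loss))
          (𝔼-mono pointwise))
        where
        pointwise : ∀ y → mean π₀ t x * ⟦ R y ⟧ + residue t y * ⟦ R y ⟧ ≤ fn t y * ⟦ R y ⟧ + (l * ⟦ R y ⟧ + i * (⟦ R y ⟧ * W y))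
        pointwise y with R y in p
        ... | true = lower-at {l} {i} li≡1 0≤l 0≤i {fn t y} {mean π₁ t y} {mean π₀ t x} (err-at y p)
        ... | false = ≤-reflexive (lower-off (fn t y) (mean π₁ t y) (mean π₀ t x) (W y) l i)

      upper : ∀ {B : P → ℚ} {M ν} → (∀ y → 0ℚ ≤ B y) → (∀ y → B y ≤ M) → 𝔼 (λ y → residue t y * (⟦ R y ⟧ * B y)) ≤ ν →
        𝔼 (λ y → fn t y * (⟦ R y ⟧ * B y)) ≤ ν + mean π₀ t x * 𝔼 (λ y → ⟦ R y ⟧ * B y) + M * (l * r + i * w)
      upper {B} {M} {ν} 0≤B B≤M cut = ≤-trans (𝔼-mono pointwise)
        (subst (_≤ ν + c * 𝔼 (λ y → ⟦ R y ⟧ * B y) + M * (l * r + i * w))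
          (sym (trans (𝔼-+ _ _) (cong₂ _+_ (trans (𝔼-+ _ _) (cong (𝔼 (λ y → residue t y * (⟦ R y ⟧ * B y)) +_) (𝔼-* c _))) (trans (𝔼-* M _) (cong (M *_) loss)))))
          (+-monoˡ-≤ _ (+-monoˡ-≤ _ cut)))
        where
        c : ℚ
        c = mean π₀ t x
        pointwise : ∀ y → fn t y * (⟦ R y ⟧ * B y) ≤ residue t y * (⟦ R y ⟧ * B y) + c * (⟦ R y ⟧ * B y) + M * (l * ⟦ R y ⟧ + i * (⟦ R y ⟧ * W y))
        pointwise y with R y in p
        ... | true = upper-at {l} {i} li≡1 0≤l 0≤i {fn t y} {mean π₁ t y} {c} (0≤B y) (B≤M y) (err-at y p)
        ... | false = ≤-reflexive (upper-off (fn t y) (mean π₁ t y) c (B y) M (W y) l i)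

-- Weights, exceptional sets and the treatment of one coordinate set f.

length-concatMap : ∀ {A B : Set} (g : A → List B) c (xs : List A) → (∀ x → length (g x) ≡ c) → length (concatMap g xs) ≡ length xs ℕ.* c
length-concatMap g c [] h = refl
length-concatMap g c (x ∷ xs) h = trans (Listₚ.length-++ (g x)) (cong₂ ℕ._+_ (h x) (length-concatMap g c xs h))

T⇒true : ∀ {b} → T b → b ≡ true
T⇒true {true} _ = refl

≡ᵇ-refl : ∀ v → (v ℕ.≡ᵇ v) ≡ true
≡ᵇ-refl v = T⇒true (ℕₚ.≡⇒≡ᵇ v v refl)

≡ᵇ-sound : ∀ {v s} → (v ℕ.≡ᵇ s) ≡ true → v ≡ s
≡ᵇ-sound {v} {s} p = ℕₚ.≡ᵇ⇒≡ v s (subst T (sym p) tt)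

indicator-sum-zero : ∀ {N v} → N ℕ.≤ v → ∑ (downFrom N) (λ s → ⟦ v ℕ.≡ᵇ s ⟧) ≡ 0ℚ
indicator-sum-zero {zero} _ = refl
indicator-sum-zero {suc N} {v} p with v ℕ.≡ᵇ N in e
... | true = ⊥-elim (ℕₚ.<-irrefl (sym (≡ᵇ-sound {v} {N} e)) p)
... | false = trans (+-identityˡ _) (indicator-sum-zero (ℕₚ.<⇒≤ p))

indicator-sum-≤ : ∀ N v → ∑ (downFrom N) (λ s → ⟦ v ℕ.≡ᵇ s ⟧) ≤ 1ℚ
indicator-sum-≤ zero v = 0≤1
indicator-sum-≤ (suc N) v with v ℕ.≡ᵇ N in e
... | true = ≤-reflexive (trans (cong (1ℚ +_) (indicator-sum-zero {N} {v} (ℕₚ.≤-reflexive (sym (≡ᵇ-sound {v} {N} e))))) (+-identityʳ 1ℚ))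
... | false = subst (_≤ 1ℚ) (sym (+-identityˡ _)) (indicator-sum-≤ N v)

∑-neg : ∀ {A : Set} (xs : List A) (f g : A → ℚ) → ∑ xs (λ x → f x - g x) ≡ ∑ xs f - ∑ xs g
∑-neg xs f g = trans (∑-cong xs (λ x → minus-scale (f x) (g x))) (trans (∑-+ xs f _) (trans (cong (∑ xs f +_) (∑-* xs (- 1ℚ) g)) (sym (minus-scale (∑ xs f) (∑ xs g)))))

∑-fin-const : ∀ d c → ∑ (allFin d) (λ _ → c) ≡ ι d * c
∑-fin-const d c = trans (∑-const (allFin d) c) (cong (λ m → ι m * c) (length-allFin d))

𝟙-∑ : ∀ {A : Set} (xs : List A) b (f : A → ℚ) → b * (1ℚ - ∑ xs f) ≡ b - ∑ xs (λ x → b * f x)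
𝟙-∑ xs b f = trans (eq b (∑ xs f)) (cong (λ z → b - z) (sym (∑-* xs b f)))
  where
  eq : ∀ b s → b * (1ℚ - s) ≡ b - b * s
  eq = solve-∀ ℚr

true-or-false : ∀ b → (b ≡ true) ⊎ (b ≡ false)
true-or-false true = inj₁ refl
true-or-false false = inj₂ refl

∧-false : ∀ {a b} → a ≡ true → a ∧ b ≡ false → b ≡ false
∧-false {true} _ p = p

∨-falseˡ : ∀ {a b} → a ∨ b ≡ false → a ≡ false
∨-falseˡ {false} _ = refl

∨-falseʳ : ∀ {a b} → a ∨ b ≡ false → b ≡ false
∨-falseʳ {false} p = p

module Target (d n-1 : ℕ) where

  open Space d n-1

  record Weights (K γ : ℚ) : Set where
    field
      β : Fin d → P → ℚ
      β-nonneg : ∀ i x → 0ℚ ≤ β i x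
      β-≤ : ∀ i x → β i x ≤ K
      β-supp : ∀ i → Supp (co i) (β i)
      β-small : ∀ i → 𝔼 (β i) ≤ γ

  -- Each `D i` ignores coordinate i: a point in it then carries a whole line inside it, which later
  -- turns small measure into few edges.
  record Conclusion (ε δ : ℚ) {N} (π : Labelling N) (β : Fin d → P → ℚ) (L : List (Coords d)) : Set where
    field
      D : Fin d → P → Bool
      D-supp : ∀ i → Supp (co i) (D i)
      D-small : ∀ i → 𝔼 (λ x → ⟦ D i x ⟧) ≤ ε
      box-at : ∀ x → (∀ i → D i x ≡ false) →
        Σ (P → Bool) λ R → Box π x L R × δ ≤ 𝔼 (λ y → ⟦ R y ⟧ * (1ℚ - ∑ (allFin d) (λ i → β i y)))

module Build {d n-1 : ℕ} {f : Coords d} {L : List (Coords d)} (down : DownClosed L)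
             (faces : ∀ h → h ∩ f ≡ h → h ≢ f → h ∈ L) (i₀ : Fin d) (miss : lookup f i₀ ≡ false)
             {N : ℕ} (π : Space.Labelling d n-1 N) {K γ : ℚ} (1≤K : 1ℚ ≤ K) (wt : Target.Weights d n-1 K γ) where

  open Space d n-1
  open Target d n-1
  open Algebra L down
  open Weights wt

  -- For i in f, the weight β i sees of f only `f ∩ co i`, a member of L, so the cell is averaged
  -- alone, on f. For i outside f the cell ignores i too, and cell and weight can be averaged
  -- together on `co i`.
  support : Fin d → Coords d
  support i = if lookup f i then f else co i

  f⊆support : ∀ i → f ∩ support i ≡ f
  f⊆support i with lookup f i in e
  ... | true = ∩-idem f
  ... | false = ∩-co f i e

  support-missing : ∀ i → Σ (Fin d) λ j → lookup (support i) j ≡ false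
  support-missing i with lookup f i
  ... | true = i₀ , miss
  ... | false = i , lookup-co i

  a : ℕ → P → ℚ
  a s y = ⟦ lab π f y ℕ.≡ᵇ s ⟧

  a-supp : ∀ s → Supp f (a s)
  a-supp s x z = cong (λ v → ⟦ v ℕ.≡ᵇ s ⟧) (lab-supp π f x z)

  a-nonneg : ∀ s y → 0ℚ ≤ a s y
  a-nonneg s y = ⟦⟧-nonneg (lab π f y ℕ.≡ᵇ s)

  -- Zero for i in f, where β i need not be a function on `support i`.
  β̃ : Fin d → P → ℚ
  β̃ i y = if lookup f i then 0ℚ else β i y

  β̃-supp : ∀ i → Supp (support i) (β̃ i)
  β̃-supp i x z with lookup f i
  ... | true = refl
  ... | false = β-supp i x z

  β̃-nonneg : ∀ i y → 0ℚ ≤ β̃ i y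
  β̃-nonneg i y with lookup f i
  ... | true = ≤-refl
  ... | false = β-nonneg i y

  β̃-≤ : ∀ i y → β̃ i y ≤ β i y
  β̃-≤ i y with lookup f i
  ... | true = β-nonneg i y
  ... | false = ≤-refl

  A B : ℕ → Fin d → Fn K
  A s i = record
    { on = support i ; fn = a s ; fn-supp = supp-mono {h = f} (f⊆support i) (a-supp s) ; fn-nonneg = a-nonneg s
    ; fn-≤ = λ y → ≤-trans (⟦⟧-≤1 (lab π f y ℕ.≡ᵇ s)) 1≤K
    ; off = proj₁ (support-missing i) ; off-missing = proj₂ (support-missing i) }
  B s i = record
    { on = support i ; fn = λ y → β̃ i y * a s y
    ; fn-supp = λ x z → cong₂ _*_ (β̃-supp i x z) (supp-mono {h = f} (f⊆support i) (a-supp s) x z)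
    ; fn-nonneg = λ y → β̃-nonneg i y ⊗ a-nonneg s y
    ; fn-≤ = λ y → ≤-trans (shrink (β̃-nonneg i y) (lab π f y ℕ.≡ᵇ s)) (≤-trans (β̃-≤ i y) (β-≤ i y))
    ; off = proj₁ (support-missing i) ; off-missing = proj₂ (support-missing i) }
    where
    shrink : ∀ {b} → 0ℚ ≤ b → ∀ c → b * ⟦ c ⟧ ≤ b
    shrink {b} p true = ≤-reflexive (*-identityʳ b)
    shrink {b} p false = subst (_≤ b) (sym (*-zeroʳ b)) p

  Φ : List (Fn K)
  Φ = concatMap (λ s → concatMap (λ i → A s i ∷ B s i ∷ []) (allFin d)) (downFrom N)

  length-Φ : length Φ ≡ N ℕ.* (d ℕ.* 2)
  length-Φ = trans (length-concatMap _ (d ℕ.* 2) (downFrom N) (λ s → trans (length-concatMap _ 2 (allFin d) (λ _ → refl)) (cong (ℕ._* 2) (length-allFin d))))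
    (cong (ℕ._* (d ℕ.* 2)) (Listₚ.length-downFrom N))

  Φ-member : ∀ {s t} i → s ℕ.< N → t ∈ (A s i ∷ B s i ∷ []) → t ∈ Φ
  Φ-member {s} i p m = ∈-concatMap⁺ (λ s → concatMap (λ i → A s i ∷ B s i ∷ []) (allFin d)) (Any.map (λ { refl → ∈-concatMap⁺ (λ i → A s i ∷ B s i ∷ []) (Any.map (λ { refl → m }) (∈-allFin i)) }) (∈-downFrom⁺ p))

  A∈Φ : ∀ {s} i → s ℕ.< N → A s i ∈ Φ
  A∈Φ i p = Φ-member i p (here refl)

  B∈Φ : ∀ {s} i → s ℕ.< N → B s i ∈ Φ
  B∈Φ i p = Φ-member i p (there (here refl))

  -- Fixing the label first makes `cond-adjoint` applicable to each term.
  by-level : ∀ (G : ℕ → P → ℚ) → (∀ s x → 0ℚ ≤ G s x) → 𝔼 (λ x → G (lab π f x) x) ≤ ∑ (downFrom N) (λ s → 𝔼 (λ x → a s x * G s x))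
  by-level G h = subst (𝔼 (λ x → G (lab π f x) x) ≤_) (𝔼-∑ (downFrom N) (λ x s → a s x * G s x))
    (𝔼-mono (λ x → subst (_≤ ∑ (downFrom N) (λ s → a s x * G s x)) (trans (cong (λ b → ⟦ b ⟧ * G (lab π f x) x) (≡ᵇ-refl (lab π f x))) (*-identityˡ _))
      (∑-member (λ s → a-nonneg s x ⊗ h s x) (∈-downFrom⁺ (lab< π f x)))))

  module Levels {N₀} (π₀ : Labelling N₀) where

    p q : Fin d → P → ℚ
    p i x = mean π₀ (A (lab π f x) i) x
    q i x = mean π₀ (B (lab π f x) i) x

    mean-nonneg : ∀ (t : Fn K) x → 0ℚ ≤ mean π₀ t x
    mean-nonneg t = cond-nonneg (code π₀ (on t)) (fn-nonneg t)

    -- Each label contributes at most c. The resulting factor N is harmless because the threshold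
    -- may depend on N.
    sparse-small : ∀ i {c} → 0ℚ ≤ c → 𝔼 (λ x → ⟦ lt (p i x) c ⟧) ≤ ι N * c
    sparse-small i {c} 0≤c = ≤-trans (by-level (λ s x → ⟦ lt (mean π₀ (A s i) x) c ⟧) (λ s x → ⟦⟧-nonneg (lt (mean π₀ (A s i) x) c)))
      (subst (∑ (downFrom N) (λ s → 𝔼 (λ x → a s x * ⟦ lt (mean π₀ (A s i) x) c ⟧)) ≤_)
        (trans (∑-const (downFrom N) c) (cong (λ m → ι m * c) (Listₚ.length-downFrom N)))
        (∑-mono (downFrom N) (λ s → subst (_≤ c) (cond-adjoint (code π₀ (support i)) (a s) _ (λ x y e → cong (λ m → ⟦ lt m c ⟧) (cond-measurable (code π₀ (support i)) (a s) x y e)))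
          (𝔼-≤ (λ x → below-threshold {mean π₀ (A s i) x} 0≤c)))))

    -- Free of N: adjointness turns densities into masses, and the weighted masses of disjoint cells
    -- add up to at most the mean of β i. This permits γ to be chosen before the complexity.
    heavy-small : ∀ i {k} → 0ℚ ≤ k → 𝔼 (λ x → ⟦ lt (p i x) (k * q i x) ⟧) ≤ k * γ
    heavy-small i {k} 0≤k = ≤-trans (by-level (λ s x → ⟦ lt (mean π₀ (A s i) x) (k * mean π₀ (B s i) x) ⟧) (λ s x → ⟦⟧-nonneg (lt (mean π₀ (A s i) x) _)))
      (≤-trans (∑-mono (downFrom N) level)
        (subst (_≤ k * γ) (sym (trans (∑-* (downFrom N) k _) (cong (k *_) (sym (𝔼-∑ (downFrom N) (λ x s → β̃ i x * a s x))))))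
          (*-mono-≤ 0≤k (≤-trans (𝔼-mono total) (β-small i)))))
      where
      ℓ : P → List ℕ
      ℓ = code π₀ (support i)
      mean-𝔼 : ∀ φ → 𝔼 (cond ℓ φ) ≡ 𝔼 φ
      mean-𝔼 φ = trans (𝔼-cong (λ x → sym (*-identityʳ _))) (trans (cond-adjoint ℓ φ (λ _ → 1ℚ) (λ _ _ _ → refl)) (𝔼-cong (λ x → *-identityʳ _)))
      level : ∀ s → 𝔼 (λ x → a s x * ⟦ lt (mean π₀ (A s i) x) (k * mean π₀ (B s i) x) ⟧) ≤ k * 𝔼 (λ x → β̃ i x * a s x)
      level s = subst₂ _≤_
        (cond-adjoint ℓ (a s) _ (λ x y e → cong₂ (λ m m' → ⟦ lt m (k * m') ⟧) (cond-measurable ℓ (a s) x y e) (cond-measurable ℓ (fn (B s i)) x y e)))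
        (trans (𝔼-* k _) (cong (k *_) (mean-𝔼 (fn (B s i)))))
        (𝔼-mono (λ x → below-threshold {mean π₀ (A s i) x} (0≤k ⊗ mean-nonneg (B s i) x)))
      total : ∀ x → ∑ (downFrom N) (λ s → β̃ i x * a s x) ≤ β i x
      total x = ≤-trans (subst (_≤ β̃ i x * 1ℚ) (sym (∑-* (downFrom N) (β̃ i x) (λ s → a s x))) (*-mono-≤ (β̃-nonneg i x) (indicator-sum-≤ N (lab π f x))))
        (≤-trans (≤-reflexive (*-identityʳ _)) (β̃-≤ i x))

    level-supp : ∀ i → lookup f i ≡ false → ∀ (t : ℕ → Fn K) → (∀ s → on (t s) ≡ support i) → Supp (co i) (λ x → mean π₀ (t (lab π f x)) x)
    level-supp i e t on≡ x z = trans (cong (λ s → mean π₀ (t s) (mix (co i) x z)) (supp-mono {h = f} (∩-co f i e) (lab-supp π f) x z))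
      (subst (λ h → Supp h (mean π₀ (t (lab π f x)))) (trans (on≡ _) (cong (λ b → if b then f else co i) e)) (mean-supp π₀ (t (lab π f x))) x z)

    module Bad (c₀ k : ℚ) where

      -- Restricted to i outside f, where the densities ignore i and the set can serve as an
      -- exceptional `D i`. For i in f the loss is bounded without comparing p and q.
      bad : Fin d → P → Bool
      bad i x = not (lookup f i) ∧ (lt (p i x) c₀ ∨ lt (p i x) (k * q i x))

      bad-supp : ∀ i → Supp (co i) (bad i)
      bad-supp i x z with true-or-false (lookup f i)
      ... | inj₁ e = trans (cong (λ b → not b ∧ heavy (mix (co i) x z)) e) (sym (cong (λ b → not b ∧ heavy x) e))
        where
        heavy : P → Bool
        heavy y = lt (p i y) c₀ ∨ lt (p i y) (k * q i y)
      ... | inj₂ e = cong (not (lookup f i) ∧_) (cong₂ (λ u v → lt u c₀ ∨ lt u (k * v))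
              (level-supp i e (λ s → A s i) (λ _ → refl) x z) (level-supp i e (λ s → B s i) (λ _ → refl) x z))

      bad-small : ∀ i → 0ℚ ≤ c₀ → 0ℚ ≤ k → 𝔼 (λ x → ⟦ bad i x ⟧) ≤ ι N * c₀ + k * γ
      bad-small i 0≤c 0≤k = ≤-trans (𝔼-mono pointwise) (subst (_≤ ι N * c₀ + k * γ) (sym (𝔼-+ _ _)) (+-mono-≤ (sparse-small i 0≤c) (heavy-small i 0≤k)))
        where
        pointwise : ∀ x → ⟦ bad i x ⟧ ≤ ⟦ lt (p i x) c₀ ⟧ + ⟦ lt (p i x) (k * q i x) ⟧
        pointwise x with lookup f i
        ... | true = ⟦⟧-nonneg (lt _ c₀) ⊕ ⟦⟧-nonneg (lt _ (k * _))
        ... | false = ⟦⟧-∨ (lt _ c₀) (lt _ (k * _))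

-- `l` and `il` are the reciprocal pair of `am-gm`, `C` is the factor of the squared error in the
-- next weights, `gap` bounds its mean, and `K⁻` bounds the size of those weights.
record Constants (d N : ℕ) (K γ γ₁ ε : ℚ) : Set where
  field
    c₀ l il C gap K⁻ : ℚ
    c₀-pos : 0ℚ < c₀
    gap-pos : 0ℚ < gap
    1≤K⁻ : 1ℚ ≤ K⁻
    l-nonneg : 0ℚ ≤ l
    il-nonneg : 0ℚ ≤ il
    C-nonneg : 0ℚ ≤ C
    l*il : l * il ≡ 1ℚ
    Q*l : (ι d + ι d * ι d * K) * l ≡ ¼ * c₀
    Q*il : ½ * c₀ * C ≡ (ι d + ι d * ι d * K) * il
    weight-small : 2ℚ * ι d * γ + C * gap ≤ γ₁
    weight-bounded : 2ℚ * ι d * K + C * (ι (N ℕ.* (d ℕ.* 2)) * (K * K)) ≤ K⁻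
    exceptions-small : ½ * ε + (ι N * c₀ + 2ℚ * 2ℚ * ι d * γ) ≤ ε

module Finish {d n-1 : ℕ} {f : Coords d} {L : List (Coords d)} (down : DownClosed L)
              (faces : ∀ h → h ∩ f ≡ h → h ≢ f → h ∈ L) (i₀ : Fin d) (miss : lookup f i₀ ≡ false)
              {N : ℕ} (π : Space.Labelling d n-1 N) {K γ γ₁ ε : ℚ} (1≤K : 1ℚ ≤ K) (wt : Target.Weights d n-1 K γ)
              (0<d : 0ℚ < ι d) (consts : Constants d N K γ γ₁ ε) {η δ : ℚ} (0≤η : 0ℚ ≤ η) (0≤δ : 0ℚ ≤ δ)
              (Q*η : (ι d + ι d * ι d * K) * η ≡ ¼ * (Constants.c₀ consts * δ))
              {N₀ N₁ : ℕ} (π₀ : Space.Labelling d n-1 N₀) (π₁ : Space.Labelling d n-1 N₁)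
              (π₀⊑π : Space._⊑_ d n-1 π₀ π) (π₁⊑π₀ : Space._⊑_ d n-1 π₁ π₀)
              (regular : Space.Algebra.CutRegular d n-1 L down (Build.Φ down faces i₀ miss π 1≤K wt) η π₁)
              (energy-gap : Space.Algebra.totalEnergy d n-1 L down (Build.Φ down faces i₀ miss π 1≤K wt) π₁
                ≤ Space.Algebra.totalEnergy d n-1 L down (Build.Φ down faces i₀ miss π 1≤K wt) π₀ + Constants.gap consts) where

  open Space d n-1
  open Target d n-1
  open Algebra L down
  open Build down faces i₀ miss π 1≤K wt
  open Constants consts
  open Counting L down Φ π₀ π₁ regular
  open Weights wt
  open Levels π₀
  -- With the ratio 4d, the losses from the weighted cells over all d coordinates stay within a
  -- quarter of the expected mass.
  open Bad c₀ (2ℚ * 2ℚ * ι d)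

  0≤d : 0ℚ ≤ ι d
  0≤d = <⇒≤ 0<d

  0≤K : 0ℚ ≤ K
  0≤K = ≤-trans 0≤1 1≤K

  0≤c₀ : 0ℚ ≤ c₀
  0≤c₀ = <⇒≤ c₀-pos

  term : Fin d → P → Fn K → ℚ
  term i x t = if lookup (on t) i then 0ℚ else err t x * err t x

  term-nonneg : ∀ i x t → 0ℚ ≤ term i x t
  term-nonneg i x t with lookup (on t) i
  ... | true = ≤-refl
  ... | false = sq-nonneg (err t x)

  term-≤ : ∀ i x t → term i x t ≤ err t x * err t x
  term-≤ i x t with lookup (on t) i
  ... | true = sq-nonneg (err t x)
  ... | false = ≤-refl

  -- Every summand of W omits some coordinate, so W is dominated by weights that each omit one.
  Wᵢ : Fin d → P → ℚ
  Wᵢ i x = ∑ Φ (term i x)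

  W≤∑Wᵢ : ∀ x → W x ≤ ∑ (allFin d) (λ i → Wᵢ i x)
  W≤∑Wᵢ x = subst (W x ≤_) (sym (∑-swap (allFin d) Φ (λ i → term i x)))
    (∑-mono Φ (λ t → subst (_≤ ∑ (allFin d) (λ i → term i x t)) (cong (λ b → if b then 0ℚ else err t x * err t x) (off-missing t))
      (∑-member (λ i → term-nonneg i x t) (∈-allFin (off t)))))

  err-sq-≤ : ∀ t x → err t x * err t x ≤ K * K
  err-sq-≤ t x = sq-diff-≤ (cond-nonneg (code π₁ (on t)) (fn-nonneg t) x) (cond-≤ (code π₁ (on t)) (fn-≤ t) x)
    (cond-nonneg (code π₀ (on t)) (fn-nonneg t) x) (cond-≤ (code π₀ (on t)) (fn-≤ t) x)

  -- By Pythagoras the mean of W is exactly the energy gained from `π₀` to `π₁`.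
  𝔼W : 𝔼 W ≤ gap
  𝔼W = subst (_≤ gap) (sym eq) (cancel energy-gap)
    where
    eq : 𝔼 W ≡ totalEnergy Φ π₁ - totalEnergy Φ π₀
    eq = trans (𝔼-∑ Φ (λ x t → err t x * err t x)) (trans (∑-cong Φ (λ t → pythagoras (code-refines π₁ π₀ π₁⊑π₀ (on t)) (fn t))) (∑-neg Φ _ _))
    cancel : ∀ {a b c} → a ≤ b + c → a - b ≤ c
    cancel {a} {b} {c} h = ≤-by (sub-nonneg h) (ring a b c)
      where
      ring : ∀ a b c → a - b + (b + c - a) ≡ c
      ring = solve-∀ ℚr

  -- The factors 2d and C are those subtracted in `counting-bound`: a box keeping mass δ against
  -- these weights still has enough mass once a cell of f is imposed.
  β⁻ : Fin d → P → ℚ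
  β⁻ i x = 2ℚ * ι d * β i x + C * Wᵢ i x

  wt⁻ : Weights K⁻ γ₁
  wt⁻ = record
    { β = β⁻
    ; β-nonneg = λ i x → 0≤2 ⊗ 0≤d ⊗ β-nonneg i x ⊕ C-nonneg ⊗ ∑-nonneg Φ (term-nonneg i x)
    ; β-≤ = λ i x → ≤-trans (+-mono-≤ (*-mono-≤ (0≤2 ⊗ 0≤d) (β-≤ i x)) (*-mono-≤ C-nonneg
        (subst (Wᵢ i x ≤_) (trans (∑-const Φ (K * K)) (cong (λ m → ι m * (K * K)) length-Φ)) (∑-mono Φ (λ t → ≤-trans (term-≤ i x t) (err-sq-≤ t x))))))
        weight-bounded
    ; β-supp = λ i x z → cong₂ (λ u v → 2ℚ * ι d * u + C * v) (β-supp i x z) (∑-cong Φ (λ t → term-supp i t x z))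
    ; β-small = λ i → ≤-trans (subst (_≤ 2ℚ * ι d * γ + C * gap) (sym (trans (𝔼-+ _ _) (cong₂ _+_ (𝔼-* (2ℚ * ι d) (β i)) (𝔼-* C (Wᵢ i)))))
        (+-mono-≤ (*-mono-≤ (0≤2 ⊗ 0≤d) (β-small i)) (*-mono-≤ C-nonneg (≤-trans (𝔼-mono (λ x → ∑-mono Φ (term-≤ i x))) 𝔼W))))
        weight-small
    }
    where
    term-supp : ∀ i t → Supp (co i) (λ x → term i x t)
    term-supp i t x z with true-or-false (lookup (on t) i)
    ... | inj₁ e = trans (cong (λ b → if b then 0ℚ else err t (mix (co i) x z) * err t (mix (co i) x z)) e) (sym (cong (λ b → if b then 0ℚ else err t x * err t x) e))
    ... | inj₂ e = cong (λ u → if lookup (on t) i then 0ℚ else u * u)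
            (cong₂ _-_ (supp-mono {h = on t} (∩-co (on t) i e) (mean-supp π₁ t) x z) (supp-mono {h = on t} (∩-co (on t) i e) (mean-supp π₀ t) x z))

  module AtPoint (x : P) {R : P → Bool} (box : Box π₀ x L R) (S≥δ : δ ≤ 𝔼 (λ y → ⟦ R y ⟧ * (1ℚ - ∑ (allFin d) (λ i → β⁻ i y))))
                 (good : ∀ i → bad i x ≡ false) where

    s : ℕ
    s = lab π f x

    s<N : s ℕ.< N
    s<N = lab< π f x

    ρ : P → Bool
    ρ y = lab π f y ℕ.≡ᵇ s

    om mass : ℚ
    om = l * r box + il * w box
    mass = 𝔼 (λ y → a s y * ⟦ R y ⟧)

    om-nonneg : 0ℚ ≤ om
    om-nonneg = l-nonneg ⊗ r-nonneg box ⊕ il-nonneg ⊗ w-nonneg box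

    p-nonneg : ∀ i → 0ℚ ≤ p i x
    p-nonneg i = mean-nonneg (A s i) x

    -- Conditioning the same cell on d different supports gives d coarse densities. Each bounds the
    -- mass below, so their sum bounds d times the mass, and the sum dominates every density in the
    -- losses.
    p̂ : ℚ
    p̂ = ∑ (allFin d) (λ i → p i x)

    p≤p̂ : ∀ i → p i x ≤ p̂
    p≤p̂ i = ∑-member p-nonneg (∈-allFin i)

    p̂-nonneg : 0ℚ ≤ p̂
    p̂-nonneg = ∑-nonneg (allFin d) p-nonneg

    good-light : ∀ i → lookup f i ≡ false → lt (p i x) c₀ ∨ lt (p i x) (2ℚ * 2ℚ * ι d * q i x) ≡ false
    good-light i e = ∧-false (cong not e) (good i)

    c₀≤p̂ : c₀ ≤ p̂
    c₀≤p̂ = ≤-trans (lt-false (∨-falseˡ (good-light i₀ miss))) (p≤p̂ i₀)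

    weightedMass : Fin d → ℚ
    weightedMass i = 𝔼 (λ y → ⟦ R y ⟧ * β i y)

    weightedMass-nonneg : ∀ i → 0ℚ ≤ weightedMass i
    weightedMass-nonneg i = 𝔼-nonneg (λ y → ⟦⟧-nonneg (R y) ⊗ β-nonneg i y)

    lost : Fin d → ℚ
    lost i = 𝔼 (λ y → a s y * (⟦ R y ⟧ * β i y))

    κ : ℚ
    κ = ¼ * inv (ι d)

    -- For i in f the weight is a multiplier of the cell. For i outside f the weighted cell is
    -- itself a member of Φ, and goodness of x bounds its coarse mean q by p/(4d).
    lost-≤ : ∀ i → lost i ≤ κ * (p i x * r box) + p̂ * weightedMass i + K * (om + η)
    lost-≤ i with true-or-false (lookup f i)
    ... | inj₁ e = loss-inside {lost i} {K} {η} {p i x} {weightedMass i} {om} {p̂} {κ} {r box}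
            (upper box {l} {il} l*il l-nonneg il-nonneg (A∈Φ i s<N) (β-nonneg i) (β-≤ i)
              (cut-box-weight box (A∈Φ i s<N) {i} (subst (λ h → (h ∩ co i) ∈ L) (sym (cong (λ b → if b then f else co i) e)) k∈L) (β-supp i) (β-nonneg i) (β-≤ i) 0≤K))
            (p≤p̂ i) (weightedMass-nonneg i) (0≤¼ ⊗ inv-nonneg 0<d) (p-nonneg i) (r-nonneg box)
      where
      k∈L : (f ∩ co i) ∈ L
      k∈L = faces (f ∩ co i) (trans (∩-comm (f ∩ co i) f) (trans (sym (∩-assoc f f (co i))) (cong (_∩ co i) (∩-idem f)))) (∩-co≢ f i e)
    ... | inj₂ e = loss-outside {lost i} {K} {η} {p i x} {q i x} {weightedMass i} {om} {p̂} {κ} {r box}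
            (subst₂ (λ u v → u ≤ η + q i x * v + 1ℚ * om) (𝔼-cong rearrange) (𝔼-cong (λ y → *-identityʳ ⟦ R y ⟧))
              (upper box {l} {il} l*il l-nonneg il-nonneg (B∈Φ i s<N) (λ _ → 0≤1) (λ _ → ≤-refl) (cut-upper box (B∈Φ i s<N))))
            (divide-in {ι d} {inv (ι d)} (*-inv 0<d) (inv-nonneg 0<d) (lt-false (∨-falseʳ {lt (p i x) c₀} (good-light i e))))
            (weightedMass-nonneg i) p̂-nonneg 1≤K (om-nonneg ⊕ 0≤η) (r-nonneg box)
      where
      move : ∀ b a r → b * a * (r * 1ℚ) ≡ a * (r * b)
      move = solve-∀ ℚr
      rearrange : ∀ y → β̃ i y * a s y * (⟦ R y ⟧ * 1ℚ) ≡ a s y * (⟦ R y ⟧ * β i y)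
      rearrange y = trans (move (β̃ i y) (a s y) ⟦ R y ⟧) (cong (λ b → a s y * (⟦ R y ⟧ * (if b then 0ℚ else β i y))) e)

    mass-lower : p̂ * r box - ι d * (om + η) ≤ ι d * mass
    mass-lower = collect {p̂ * r box} {ι d} {mass} {om} {η} (subst₂ _≤_ (∑-*ʳ (allFin d) (r box) (λ i → p i x)) (∑-fin-const d (mass + om + η))
      (∑-mono (allFin d) (λ i → move {p i x * r box} {mass} {om} {η} (lower box {l} {il} l*il l-nonneg il-nonneg (A∈Φ i s<N)))))
      where
      move : ∀ {a b c e} → a + - e ≤ b + c → a ≤ b + c + e
      move {a} {b} {c} {e} h = ≤-by (sub-nonneg h) (ring a b c e)
        where
        ring : ∀ a b c e → a + (b + c - (a + - e)) ≡ b + c + e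
        ring = solve-∀ ℚr
      collect : ∀ {a d m o e} → a ≤ d * (m + o + e) → a - d * (o + e) ≤ d * m
      collect {a} {d} {m} {o} {e} h = ≤-by (sub-nonneg h) (ring a d m o e)
        where
        ring : ∀ a d m o e → a - d * (o + e) + (d * (m + o + e) - a) ≡ d * m
        ring = solve-∀ ℚr

    lost-upper : ι d * ∑ (allFin d) lost ≤ ¼ * (p̂ * r box) + ι d * (p̂ * ∑ (allFin d) weightedMass) + ι d * ι d * K * (om + η)
    lost-upper = subst (λ z → ι d * ∑ (allFin d) lost ≤ ¼ * (p̂ * r box) + ι d * (p̂ * ∑ (allFin d) weightedMass) + z) (sym (*-assoc (ι d * ι d) K (om + η)))
      (scale-total {κ = κ} (κ-eq (ι d) (inv (ι d)) (*-inv 0<d)) 0≤d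
      (subst (∑ (allFin d) lost ≤_)
        (trans (∑-+ (allFin d) _ _) (cong₂ _+_ (trans (∑-+ (allFin d) _ _)
          (cong₂ _+_ (trans (∑-* (allFin d) κ _) (cong (κ *_) (∑-*ʳ (allFin d) (r box) (λ i → p i x)))) (∑-* (allFin d) p̂ weightedMass)))
          (∑-fin-const d (K * (om + η)))))
        (∑-mono (allFin d) lost-≤)))
      where
      ring : ∀ d v → d * (¼ * v) ≡ ¼ * (d * v)
      ring = solve-∀ ℚr
      κ-eq : ∀ d v → d * v ≡ 1ℚ → d * (¼ * v) ≡ ¼
      κ-eq d v e = trans (ring d v) (trans (cong (¼ *_) e) (*-identityʳ ¼))

    S : ℚ
    S = 𝔼 (λ y → ⟦ R y ⟧ * (1ℚ - ∑ (allFin d) (λ i → β⁻ i y)))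

    S-upper : S ≤ r box - 2ℚ * ι d * ∑ (allFin d) weightedMass - C * w box
    S-upper = subst (S ≤_) (trans (𝔼-- _ _) (cong₂ _-_ (trans (𝔼-- _ _) (cong (λ z → r box - z) (trans (𝔼-* (2ℚ * ι d) _) (cong (2ℚ * ι d *_) (𝔼-∑ (allFin d) (λ y i → ⟦ R y ⟧ * β i y)))))) (𝔼-* C _)))
      (𝔼-mono (λ y → pointwise (⟦⟧-nonneg (R y)) (W≤∑Wᵢ y) (split y)))
      where
      split : ∀ y → ∑ (allFin d) (λ i → β⁻ i y) ≡ 2ℚ * ι d * ∑ (allFin d) (λ i → β i y) + C * ∑ (allFin d) (λ i → Wᵢ i y)
      split y = trans (∑-+ (allFin d) _ _) (cong₂ _+_ (∑-* (allFin d) (2ℚ * ι d) (λ i → β i y)) (∑-* (allFin d) C (λ i → Wᵢ i y)))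
      ring : ∀ b t u v k c → b * (1ℚ - (k * u + c * v)) + b * (c * (v - t)) ≡ b - k * (b * u) - c * (b * t)
      ring = solve-∀ ℚr
      pointwise : ∀ {b t y u v} → 0ℚ ≤ b → t ≤ v → u ≡ 2ℚ * ι d * ∑ (allFin d) (λ i → β i y) + C * v →
        b * (1ℚ - u) ≤ b - 2ℚ * ι d * ∑ (allFin d) (λ i → b * β i y) - C * (b * t)
      pointwise {b} {t} {y} {u} {v} 0≤b t≤v e = subst₂ (λ g h → b * (1ℚ - g) ≤ b - 2ℚ * ι d * h - C * (b * t)) (sym e) (sym (∑-* (allFin d) b (λ i → β i y)))
        (≤-by (0≤b ⊗ (C-nonneg ⊗ sub-nonneg t≤v)) (ring b t (∑ (allFin d) (λ i → β i y)) v (2ℚ * ι d) C))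

    total : 𝔼 (λ y → ⟦ ρ y ∧ R y ⟧ * (1ℚ - ∑ (allFin d) (λ i → β i y))) ≡ mass - ∑ (allFin d) lost
    total = trans (𝔼-cong pointwise) (trans (𝔼-- _ _) (cong (λ z → mass - z) (𝔼-∑ (allFin d) (λ y i → a s y * (⟦ R y ⟧ * β i y)))))
      where
      pointwise : ∀ y → ⟦ ρ y ∧ R y ⟧ * (1ℚ - ∑ (allFin d) (λ i → β i y)) ≡ a s y * ⟦ R y ⟧ - ∑ (allFin d) (λ i → a s y * (⟦ R y ⟧ * β i y))
      pointwise y = trans (cong (_* (1ℚ - ∑ (allFin d) (λ i → β i y))) (⟦⟧-∧ (ρ y) (R y)))
        (trans (𝟙-∑ (allFin d) (a s y * ⟦ R y ⟧) (λ i → β i y)) (cong (λ z → a s y * ⟦ R y ⟧ - z) (∑-cong (allFin d) (λ i → *-assoc (a s y) ⟦ R y ⟧ (β i y)))))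

    estimate : ¼ * (c₀ * δ) * inv (ι d) ≤ 𝔼 (λ y → ⟦ ρ y ∧ R y ⟧ * (1ℚ - ∑ (allFin d) (λ i → β i y)))
    estimate = subst (¼ * (c₀ * δ) * inv (ι d) ≤_) (sym total)
      (divide-out {ι d} {inv (ι d)} {b = mass - ∑ (allFin d) lost} (*-inv 0<d) (inv-nonneg 0<d)
        (counting-bound {ι d} {K} {c₀} {l} {il} {C} {η} {δ} {p̂} {r box} {w box} {S} {∑ (allFin d) weightedMass} {mass} {∑ (allFin d) lost} Q*l Q*il Q*η 0≤d C-nonneg (r-nonneg box) (w-nonneg box) 0≤δ 0≤c₀ c₀≤p̂ mass-lower lost-upper S≥δ S-upper))

    full-box : Box π x (f ∷ L) (λ y → ρ y ∧ R y)
    full-box = cons (λ y z → cong (λ v → v ℕ.≡ᵇ s) (lab-supp π f y z)) (λ y e → ≡ᵇ-sound {lab π f y} {s} e) (box-coarsen π₀⊑π box)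

  finish : Conclusion (½ * ε) δ π₀ β⁻ L → Conclusion ε (¼ * (c₀ * δ) * inv (ι d)) π β (f ∷ L)
  finish c = record
    { D = λ i x → C.D i x ∨ bad i x
    ; D-supp = λ i x z → cong₂ _∨_ (C.D-supp i x z) (bad-supp i x z)
    ; D-small = λ i → ≤-trans (≤-trans (𝔼-mono (λ x → ⟦⟧-∨ (C.D i x) (bad i x)))
        (subst (_≤ ½ * ε + (ι N * c₀ + 2ℚ * 2ℚ * ι d * γ)) (sym (𝔼-+ _ _)) (+-mono-≤ (C.D-small i) (bad-small i 0≤c₀ (0≤2 ⊗ 0≤2 ⊗ 0≤d)))))
        exceptions-small
    ; box-at = λ x good → let (R , box , S≥δ) = C.box-at x (λ i → ∨-falseˡ (good i))
                              module X = AtPoint x box S≥δ (λ i → ∨-falseʳ {C.D i x} (good i))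
                          in (λ y → X.ρ y ∧ R y) , X.full-box , X.estimate
    }
    where module C = Conclusion c

-- Choice of the constants.

cancel-inv : ∀ {q} → 0ℚ < q → ∀ x → q * (x * inv q) ≡ x
cancel-inv {q} 0<q x = trans (ring q x (inv q)) (trans (cong (x *_) (*-inv 0<q)) (*-identityʳ x))
  where
  ring : ∀ q x v → q * (x * v) ≡ x * (q * v)
  ring = solve-∀ ℚr

16ℚ : ℚ
16ℚ = 2ℚ * 2ℚ * 2ℚ * 2ℚ

0<16 : 0ℚ < 16ℚ
0<16 = positive⁻¹ 16ℚ

scaleQ : ℚ → ℚ → ℚ
scaleQ dq K = dq + dq * dq * K

scaleQ-pos : ∀ {dq K} → 0ℚ < dq → 1ℚ ≤ K → 0ℚ < scaleQ dq K
scaleQ-pos 0<d 1≤K = <-≤-trans 0<d (≤-by (<⇒≤ 0<d ⊗ <⇒≤ 0<d ⊗ ≤-trans 0≤1 1≤K) refl)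

module Choose (d : ℕ) (0<d : 0ℚ < ι d) {ε γ₁ : ℚ} (0<ε : 0ℚ < ε) (0<γ₁ : 0ℚ < γ₁) where

  -- Two demands meet here, 2dγ ≤ γ₁/2 and 4dγ ≤ ε/4; neither mentions N or K.
  g γ : ℚ
  g = γ₁ ⊓ ε
  γ = g * inv (16ℚ * ι d)

  0<16d : 0ℚ < 16ℚ * ι d
  0<16d = mul-pos 0<16 0<d

  γ-pos : 0ℚ < γ
  γ-pos = mul-pos (⊓-pos 0<γ₁ 0<ε) (inv-pos 0<16d)

  16dγ : 16ℚ * ι d * γ ≡ g
  16dγ = cancel-inv 0<16d g

  2dγ≤ : 2ℚ * ι d * γ ≤ ½ * γ₁
  2dγ≤ = subst (_≤ ½ * γ₁) (sym (trans (ring (ι d) γ) (cong (½ * ½ * ½ *_) 16dγ)))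
    (≤-trans (*-mono-≤ (0≤½ ⊗ 0≤½ ⊗ 0≤½) (p⊓q≤p γ₁ ε)) (≤-by ((0≤½ ⊗ 0≤½ ⊗ 0≤½ ⊕ 0≤¼) ⊗ <⇒≤ 0<γ₁) (ring₂ γ₁)))
    where
    ring : ∀ d γ → 2ℚ * d * γ ≡ ½ * ½ * ½ * (16ℚ * d * γ)
    ring = solve-∀ ℚr
    ring₂ : ∀ x → ½ * ½ * ½ * x + (½ * ½ * ½ + ¼) * x ≡ ½ * x
    ring₂ = solve-∀ ℚr

  4dγ≤ : 2ℚ * 2ℚ * ι d * γ ≤ ¼ * ε
  4dγ≤ = subst (_≤ ¼ * ε) (sym (trans (ring (ι d) γ) (cong (¼ *_) 16dγ))) (*-mono-≤ 0≤¼ (p⊓q≤q γ₁ ε))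
    where
    ring : ∀ d γ → 2ℚ * 2ℚ * d * γ ≡ ¼ * (16ℚ * d * γ)
    ring = solve-∀ ℚr

  module _ (N : ℕ) {K : ℚ} (1≤K : 1ℚ ≤ K) where

    -- `c₀` makes N sparse cells fit into ε/4, with `suc N` to cover N = 0. Then `l` solves Q·l =
    -- c₀/4, `C` solves ½·c₀·C = Q·il, and `gap` solves C·gap = γ₁/2.
    Q c₀ l il C gap K⁻ rest : ℚ
    Q = scaleQ (ι d) K
    c₀ = ¼ * ε * inv (ι (suc N))
    l = ¼ * c₀ * inv Q
    il = inv l
    C = 2ℚ * (Q * il) * inv c₀
    gap = ½ * γ₁ * inv C
    rest = 2ℚ * ι d * K + C * (ι (N ℕ.* (d ℕ.* 2)) * (K * K))
    K⁻ = 1ℚ + rest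

    0<Q : 0ℚ < Q
    0<Q = scaleQ-pos 0<d 1≤K

    0<c₀ : 0ℚ < c₀
    0<c₀ = mul-pos (mul-pos 0<¼ 0<ε) (inv-pos (ι-pos N))

    0<l : 0ℚ < l
    0<l = mul-pos (mul-pos 0<¼ 0<c₀) (inv-pos 0<Q)

    0<C : 0ℚ < C
    0<C = mul-pos (mul-pos 0<2 (mul-pos 0<Q (inv-pos 0<l))) (inv-pos 0<c₀)

    0≤K : 0ℚ ≤ K
    0≤K = ≤-trans 0≤1 1≤K

    0≤rest : 0ℚ ≤ rest
    0≤rest = 0≤2 ⊗ <⇒≤ 0<d ⊗ 0≤K ⊕ <⇒≤ 0<C ⊗ (ι-nonneg (N ℕ.* (d ℕ.* 2)) ⊗ (0≤K ⊗ 0≤K))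

    constants : Constants d N K γ γ₁ ε
    constants = record
      { c₀ = c₀ ; l = l ; il = il ; C = C ; gap = gap ; K⁻ = K⁻
      ; c₀-pos = 0<c₀
      ; gap-pos = mul-pos (mul-pos 0<½ 0<γ₁) (inv-pos 0<C)
      ; 1≤K⁻ = ≤-by 0≤rest refl
      ; l-nonneg = <⇒≤ 0<l
      ; il-nonneg = inv-nonneg 0<l
      ; C-nonneg = <⇒≤ 0<C
      ; l*il = *-inv 0<l
      ; Q*l = cancel-inv 0<Q (¼ * c₀)
      ; Q*il = trans (ring c₀ (2ℚ * (Q * il)) (inv c₀)) (trans (cong (½ *_) (cancel-inv 0<c₀ (2ℚ * (Q * il)))) (half (Q * il)))
      ; weight-small = subst (2ℚ * ι d * γ + C * gap ≤_) (halves γ₁) (+-mono-≤ 2dγ≤ (≤-reflexive (cancel-inv 0<C (½ * γ₁))))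
      ; weight-bounded = ≤-by 0≤1 (+-comm rest 1ℚ)
      ; exceptions-small = subst (½ * ε + (ι N * c₀ + 2ℚ * 2ℚ * ι d * γ) ≤_) (quarters ε)
          (+-monoʳ-≤ (½ * ε) (+-mono-≤ sparse 4dγ≤))
      }
      where
      ring : ∀ c x v → ½ * c * (x * v) ≡ ½ * (c * (x * v))
      ring = solve-∀ ℚr
      half : ∀ x → ½ * (2ℚ * x) ≡ x
      half = solve-∀ ℚr
      halves : ∀ x → ½ * x + ½ * x ≡ x
      halves = solve-∀ ℚr
      quarters : ∀ x → ½ * x + (¼ * x + ¼ * x) ≡ x
      quarters = solve-∀ ℚr
      sparse : ι N * c₀ ≤ ¼ * ε
      sparse = subst (ι N * c₀ ≤_) (cancel-inv (ι-pos N) (¼ * ε)) (subst₂ _≤_ (*-comm c₀ (ι N)) (*-comm c₀ (ι (suc N))) (*-mono-≤ (<⇒≤ 0<c₀) (≤-by 0≤1 (+-comm (ι N) 1ℚ))))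

-- The order of quantifiers is essential: γ is chosen before the complexity N and the size K of the weights.
Claim : (d : ℕ) → List (Coords d) → Set
Claim d L = ∀ ε → 0ℚ < ε → Σ ℚ λ γ → 0ℚ < γ × (∀ N K → 1ℚ ≤ K → Σ ℚ λ δ → 0ℚ < δ ×
  (∀ n-1 (π : Space.Labelling d n-1 N) (wt : Target.Weights d n-1 K γ) → ¬ ¬ Target.Conclusion d n-1 ε δ π (Target.Weights.β wt) L))

-- Induction over the coordinate sets.

lower-conclusion : ∀ {d n-1 ε δ δ' N} {π : Space.Labelling d n-1 N} {β : Fin d → Space.P d n-1 → ℚ} {L} →
  δ' ≤ δ → Target.Conclusion d n-1 ε δ π β L → Target.Conclusion d n-1 ε δ' π β L
lower-conclusion p c = record
  { D = D ; D-supp = D-supp ; D-small = D-small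
  ; box-at = λ x good → let (R , box , q) = box-at x good in R , box , ≤-trans p q }
  where open Target.Conclusion c

fin-pos : ∀ {d} → Fin d → 0ℚ < ι d
fin-pos {suc d} _ = ι-pos d

-- With no coordinate set left the box is the whole space, and the d weights take away at most half
-- of it; `suc d` covers d = 0.
claim-base : ∀ d → Claim d []
claim-base d ε 0<ε = γ , γ-pos , λ N K _ → ½ , 0<½ , λ n-1 π wt absurd → absurd (conclusion n-1 π wt)
  where
  γ : ℚ
  γ = ½ * inv (ι (suc d))
  γ-pos : 0ℚ < γ
  γ-pos = mul-pos 0<½ (inv-pos (ι-pos d))
  module _ (n-1 : ℕ) {N : ℕ} (π : Space.Labelling d n-1 N) {K : ℚ} (wt : Target.Weights d n-1 K γ) where
    open Space d n-1
    open Target d n-1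
    open Weights wt
    sum-small : 𝔼 (λ y → ∑ (allFin d) (λ i → β i y)) ≤ ½
    sum-small = subst (_≤ ½) (sym (𝔼-∑ (allFin d) (λ y i → β i y)))
      (≤-trans (∑-mono (allFin d) β-small) (subst (_≤ ½) (sym (∑-fin-const d γ))
        (subst (ι d * γ ≤_) (cancel-inv (ι-pos d) ½) (subst₂ _≤_ (*-comm γ (ι d)) (*-comm γ (ι (suc d))) (*-mono-≤ (<⇒≤ γ-pos) (≤-by 0≤1 (+-comm (ι d) 1ℚ)))))))
    complement : ∀ {x} → x ≤ ½ → ½ ≤ 1ℚ - x
    complement {x} p = ≤-by (sub-nonneg p) (ring x)
      where
      ring : ∀ x → ½ + (½ - x) ≡ 1ℚ - x
      ring = solve-∀ ℚr
    conclusion : Conclusion ε ½ π β []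
    conclusion = record
      { D = λ _ _ → false ; D-supp = λ _ _ _ → refl ; D-small = λ _ → ≤-trans (≤-reflexive (𝔼-const 0ℚ)) (<⇒≤ 0<ε)
      ; box-at = λ x _ → (λ _ → true) , [] , subst (½ ≤_)
          (sym (trans (𝔼-cong (λ y → *-identityˡ _)) (trans (𝔼-- (λ _ → 1ℚ) _) (cong (_- 𝔼 (λ y → ∑ (allFin d) (λ i → β i y))) (𝔼-const 1ℚ)))))
          (complement sum-small) }

-- The hypothesis yields `γ₁` before N and K are given, but its δ only for a known coarse complexity
-- `N₀`. Accuracy and box mass are therefore functions of `N₀`, as `Growth` expects. Half of ε is
-- reserved for the new bad sets.
claim-step : ∀ {d} {f : Coords d} {L} (i₀ : Fin d) → lookup f i₀ ≡ false → (∀ h → h ∩ f ≡ h → h ≢ f → h ∈ L) → DownClosed L →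
  Claim d L → Claim d (f ∷ L)
claim-step {d} {f} {L} i₀ miss faces down ih ε 0<ε = Choice.γ , Choice.γ-pos , main
  where
  0<½ε : 0ℚ < ½ * ε
  0<½ε = mul-pos 0<½ 0<ε
  γ₁ : ℚ
  γ₁ = proj₁ (ih (½ * ε) 0<½ε)
  0<d : 0ℚ < ι d
  0<d = fin-pos i₀
  module Choice = Choose d 0<d {ε} {γ₁} 0<ε (proj₁ (proj₂ (ih (½ * ε) 0<½ε)))
  module _ (N : ℕ) (K : ℚ) (1≤K : 1ℚ ≤ K) where
    consts : Constants d N K Choice.γ γ₁ ε
    consts = Choice.constants N 1≤K
    open Constants consts
    inner : ∀ N₀ → Σ ℚ λ δ → 0ℚ < δ ×
      (∀ n-1 (π : Space.Labelling d n-1 N₀) (wt : Target.Weights d n-1 K⁻ γ₁) → ¬ ¬ Target.Conclusion d n-1 (½ * ε) δ π (Target.Weights.β wt) L)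
    inner N₀ = proj₂ (proj₂ (ih (½ * ε) 0<½ε)) N₀ K⁻ 1≤K⁻
    δ⁻ δ₀ η : ℕ → ℚ
    δ⁻ N₀ = proj₁ (inner N₀)
    δ₀ N₀ = ¼ * (c₀ * δ⁻ N₀) * inv (ι d)
    η N₀ = ¼ * (c₀ * δ⁻ N₀) * inv (scaleQ (ι d) K)
    δ⁻-pos : ∀ N₀ → 0ℚ < δ⁻ N₀
    δ⁻-pos N₀ = proj₁ (proj₂ (inner N₀))
    δ₀-pos : ∀ N₀ → 0ℚ < δ₀ N₀
    δ₀-pos N₀ = mul-pos (mul-pos 0<¼ (mul-pos c₀-pos (δ⁻-pos N₀))) (inv-pos 0<d)
    η-pos : ∀ N₀ → 0ℚ < η N₀
    η-pos N₀ = mul-pos (mul-pos 0<¼ (mul-pos c₀-pos (δ⁻-pos N₀))) (inv-pos (scaleQ-pos 0<d 1≤K))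
    Emax : ℚ
    Emax = ι (N ℕ.* (d ℕ.* 2)) * (K * K)
    open Growth Emax η δ₀ η-pos
    k : ℕ
    k = proj₁ (archimedean* Emax gap-pos)
    main : Σ ℚ λ δ → 0ℚ < δ × (∀ n-1 (π : Space.Labelling d n-1 N) (wt : Target.Weights d n-1 K Choice.γ) →
      ¬ ¬ Target.Conclusion d n-1 ε δ π (Target.Weights.β wt) (f ∷ L))
    main = minAlong k N , minAlong-pos δ₀-pos k N , λ n-1 π wt absurd →
      let open Space d n-1
          open Algebra L down
          open Build {d} {n-1} down faces i₀ miss π 1≤K wt
      in strong-regularity L down Φ (cong (λ m → ι m * (K * K)) length-Φ) {gap} k π
          (<-≤-trans (proj₂ (archimedean* Emax gap-pos)) (≤-by (totalEnergy-nonneg Φ π) (+-comm _ (totalEnergy Φ π))))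
          λ sr → let open StrongRegular sr
                     module F = Finish down faces i₀ miss π 1≤K wt 0<d consts (<⇒≤ (η-pos N₀)) (<⇒≤ (δ⁻-pos N₀))
                                  (cancel-inv (scaleQ-pos 0<d 1≤K) (¼ * (c₀ * δ⁻ N₀))) π₀ π₁ π₀⊑π π₁⊑π₀ regular energy-gap
                 in proj₂ (proj₂ (inner N₀)) n-1 π₀ F.wt⁻ (λ c → absurd (lower-conclusion {d} {n-1} bound (F.finish c)))

-- Keeps what `claim-step` needs: every listed set omits a coordinate, and its proper subsets come
-- later.
data Descending {d} : List (Coords d) → Set where
  [] : Descending []
  cons : ∀ {f L} i → lookup f i ≡ false → (∀ h → h ∩ f ≡ h → h ≢ f → h ∈ L) → Descending L → Descending (f ∷ L)

subset-∩ : ∀ {d} (h e : Coords d) → (h ∩ e) ∩ h ≡ h ∩ e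
subset-∩ h e = trans (∩-comm (h ∩ e) h) (trans (sym (∩-assoc h h e)) (cong (_∩ e) (∩-idem h)))

descending-down : ∀ {d} {L : List (Coords d)} → Descending L → DownClosed L
descending-down (cons i p faces D) {h} (here refl) e with (h ∩ e) ≟C h
... | yes q = here q
... | no ¬q = there (faces (h ∩ e) (subset-∩ h e) ¬q)
descending-down (cons i p faces D) (there m) e = there (descending-down D m e)

claim : ∀ {d} {L : List (Coords d)} → Descending L → Claim d L
claim [] = claim-base _
claim (cons i p faces D) = claim-step i p faces (descending-down D) (claim D)

-- Sets containing the first coordinate precede those omitting it; for the latter, all remaining
-- coordinates together still form a proper set.
proper : ∀ d → List (Coords d)
proper zero = []
proper (suc d) = map (true ∷_) (proper d) ++ map (false ∷_) (full ∷ proper d)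

∈-proper : ∀ {d} (h : Coords d) → h ≢ full → h ∈ proper d
∈-all : ∀ {d} (h : Coords d) → h ∈ full ∷ proper d
∈-proper [] ne = ⊥-elim (ne refl)
∈-proper (true ∷ h) ne = ∈-++⁺ˡ (∈-map⁺ (true ∷_) (∈-proper h (λ e → ne (cong (true ∷_) e))))
∈-proper {suc d} (false ∷ h) ne = ∈-++⁺ʳ (map (true ∷_) (proper d)) (∈-map⁺ (false ∷_) (∈-all h))
∈-all h with h ≟C full
... | yes e = here e
... | no ne = there (∈-proper h ne)

proper-descending : ∀ d → Descending (proper d)
proper-descending zero = []
proper-descending (suc d) = upper (proper-descending d)
  where
  tail : List (Coords (suc d))
  tail = map (false ∷_) (full ∷ proper d)
  lower : ∀ {A : List (Coords d)} → Descending A → Descending (map (false ∷_) A)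
  lower [] = []
  lower {f ∷ A} (cons i p faces D) = cons zero refl faces' (lower D)
    where
    faces' : ∀ h → h ∩ (false ∷ f) ≡ h → h ≢ false ∷ f → h ∈ map (false ∷_) A
    faces' (true ∷ h) () ne
    faces' (false ∷ h) e ne = ∈-map⁺ (false ∷_) (faces h (Vecₚ.∷-injectiveʳ e) (λ q → ne (cong (false ∷_) q)))
  bottom : Descending tail
  bottom = cons zero refl faces' (lower (proper-descending d))
    where
    faces' : ∀ h → h ∩ (false ∷ full) ≡ h → h ≢ false ∷ full → h ∈ map (false ∷_) (proper d)
    faces' (true ∷ h) () ne
    faces' (false ∷ h) e ne = ∈-map⁺ (false ∷_) (∈-proper h (λ q → ne (cong (false ∷_) q)))
  upper : ∀ {A : List (Coords d)} → Descending A → Descending (map (true ∷_) A ++ tail)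
  upper [] = bottom
  upper {f ∷ A} (cons i p faces D) = cons (suc i) p faces' (upper D)
    where
    faces' : ∀ h → h ∩ (true ∷ f) ≡ h → h ≢ true ∷ f → h ∈ map (true ∷_) A ++ tail
    faces' (true ∷ h) e ne = ∈-++⁺ˡ (∈-map⁺ (true ∷_) (faces h (Vecₚ.∷-injectiveʳ e) (λ q → ne (cong (true ∷_) q))))
    faces' (false ∷ h) e ne = ∈-++⁺ʳ (map (true ∷_) A) (∈-map⁺ (false ∷_) (∈-all h))

open Sub using (Subset; ⋃; ∣_∣; ⁅_⁆; _∪_)

-- Cardinalities of subsets covered by lists.

elements : ∀ {n} → Subset n → List (Fin n)
elements [] = []
elements (true ∷ p) = zero ∷ map suc (elements p)
elements (false ∷ p) = map suc (elements p)

length-elements : ∀ {n} (p : Subset n) → length (elements p) ≡ ∣ p ∣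
length-elements [] = refl
length-elements (true ∷ p) = cong suc (trans (Listₚ.length-map suc (elements p)) (length-elements p))
length-elements (false ∷ p) = trans (Listₚ.length-map suc (elements p)) (length-elements p)

∈-elements : ∀ {n} {p : Subset n} {x} → x Sub.∈ p → x ∈ elements p
∈-elements {p = true ∷ p} Vec.here = here refl
∈-elements {p = true ∷ p} (Vec.there m) = there (∈-map⁺ suc (∈-elements m))
∈-elements {p = false ∷ p} (Vec.there m) = ∈-map⁺ suc (∈-elements m)

∣∪∣-≤ : ∀ {n} (p q : Subset n) → ∣ p ∪ q ∣ ℕ.≤ ∣ p ∣ ℕ.+ ∣ q ∣
∣∪∣-≤ [] [] = ℕ.z≤n
∣∪∣-≤ (true ∷ p) (true ∷ q) = ℕ.s≤s (ℕₚ.≤-trans (∣∪∣-≤ p q) (ℕₚ.+-monoʳ-≤ ∣ p ∣ (ℕₚ.n≤1+n ∣ q ∣)))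
∣∪∣-≤ (true ∷ p) (false ∷ q) = ℕ.s≤s (∣∪∣-≤ p q)
∣∪∣-≤ (false ∷ p) (true ∷ q) = ℕₚ.≤-trans (ℕ.s≤s (∣∪∣-≤ p q)) (ℕₚ.≤-reflexive (sym (ℕₚ.+-suc ∣ p ∣ ∣ q ∣)))
∣∪∣-≤ (false ∷ p) (false ∷ q) = ∣∪∣-≤ p q

∣⋃-singletons∣-≤ : ∀ {n} (xs : List (Fin n)) → ∣ ⋃ (map ⁅_⁆ xs) ∣ ℕ.≤ length xs
∣⋃-singletons∣-≤ {n} [] = ℕₚ.≤-reflexive (Subₚ.∣⊥∣≡0 n)
∣⋃-singletons∣-≤ (x ∷ xs) = ℕₚ.≤-trans (∣∪∣-≤ ⁅ x ⁆ (⋃ (map ⁅_⁆ xs))) (ℕₚ.+-mono-≤ (ℕₚ.≤-reflexive (Subₚ.∣⁅x⁆∣≡1 x)) (∣⋃-singletons∣-≤ xs))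

∈-⋃-singletons : ∀ {n} {xs : List (Fin n)} {x} → x ∈ xs → x Sub.∈ ⋃ (map ⁅_⁆ xs)
∈-⋃-singletons {x = x} (here refl) = Subₚ.x∈p∪q⁺ (inj₁ (Subₚ.x∈⁅x⁆ x))
∈-⋃-singletons (there m) = Subₚ.x∈p∪q⁺ (inj₂ (∈-⋃-singletons m))

cover-≤ : ∀ {n} (xs : List (Fin n)) {p : Subset n} → (∀ {x} → x Sub.∈ p → x ∈ xs) → ∣ p ∣ ℕ.≤ length xs
cover-≤ xs h = ℕₚ.≤-trans (Subₚ.p⊆q⇒∣p∣≤∣q∣ (λ m → ∈-⋃-singletons (h m))) (∣⋃-singletons∣-≤ xs)

-- Short lists are padded with the default v.
firsts : ∀ {A : Set} → A → ∀ d → List A → Vec A d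
firsts v zero xs = []
firsts v (suc d) [] = v ∷ firsts v d []
firsts v (suc d) (x ∷ xs) = x ∷ firsts v d xs

firsts-or-rest : ∀ {A : Set} (v : A) d {xs x} → x ∈ xs → (∃[ j ] x ≡ lookup (firsts v d xs) j) ⊎ (x ∈ drop d xs)
firsts-or-rest v zero m = inj₂ m
firsts-or-rest v (suc d) (here e) = inj₁ (zero , e)
firsts-or-rest v (suc d) {x ∷ xs} (there m) with firsts-or-rest v d m
... | inj₁ (j , e) = inj₁ (suc j , e)
... | inj₂ m' = inj₂ m'

lookup-∈ : ∀ {A : Set} {d} (y : Vec A d) j → lookup y j ∈ toList y
lookup-∈ (y ∷ ys) zero = here refl
lookup-∈ (y ∷ ys) (suc j) = there (lookup-∈ ys j)

-- Tuples agreeing on a set of coordinates.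

agree : ∀ {n d} → Coords d → Vec (Fin n) d → Vec (Fin n) d → Bool
agree [] [] [] = true
agree (b ∷ h) (u ∷ us) (x ∷ xs) = (not b ∨ does (u Finₚ.≟ x)) ∧ agree h us xs

does-refl : ∀ {n} (u : Fin n) → does (u Finₚ.≟ u) ≡ true
does-refl u = dec-true (u Finₚ.≟ u) refl

does-sound : ∀ {n} {u x : Fin n} → does (u Finₚ.≟ x) ≡ true → u ≡ x
does-sound {u = u} {x} p with u Finₚ.≟ x
... | yes q = q

agree-refl : ∀ {n d} (h : Coords d) (u : Vec (Fin n) d) → agree h u u ≡ true
agree-refl [] [] = refl
agree-refl (true ∷ h) (u ∷ us) = cong₂ _∧_ (does-refl u) (agree-refl h us)
agree-refl (false ∷ h) (u ∷ us) = agree-refl h us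

agree-supp : ∀ {n d} (h : Coords d) (u : Vec (Fin n) d) → Supp h (agree h u)
agree-supp [] [] [] [] = refl
agree-supp (true ∷ h) (u ∷ us) (x ∷ xs) (z ∷ zs) = cong (does (u Finₚ.≟ x) ∧_) (agree-supp h us xs zs)
agree-supp (false ∷ h) (u ∷ us) (x ∷ xs) (z ∷ zs) = agree-supp h us xs zs

agree-lookup : ∀ {n d} (h : Coords d) (u x : Vec (Fin n) d) → agree h u x ≡ true → ∀ j → lookup h j ≡ true → lookup u j ≡ lookup x j
agree-lookup (true ∷ h) (u ∷ us) (x ∷ xs) p zero q = does-sound (∧-trueˡ p)
agree-lookup (b ∷ h) (u ∷ us) (x ∷ xs) p (suc j) q = agree-lookup h us xs (∧-trueʳ {not b ∨ does (u Finₚ.≟ x)} p) j q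

agree-mix : ∀ {n d} (h : Coords d) (u x : Vec (Fin n) d) → agree h u x ≡ true → mix h x u ≡ u
agree-mix [] [] [] _ = refl
agree-mix (true ∷ h) (u ∷ us) (x ∷ xs) p with u Finₚ.≟ x
... | yes refl = cong (u ∷_) (agree-mix h us xs p)
agree-mix (false ∷ h) (u ∷ us) (x ∷ xs) p = cong (u ∷_) (agree-mix h us xs p)

lookup-co≢ : ∀ {d} (i j : Fin d) → j ≢ i → lookup (co i) j ≡ true
lookup-co≢ zero zero ne = ⊥-elim (ne refl)
lookup-co≢ zero (suc j) ne = Vecₚ.lookup-replicate j true
lookup-co≢ (suc i) zero ne = refl
lookup-co≢ (suc i) (suc j) ne = lookup-co≢ i j (λ e → ne (cong suc e))

co≢full : ∀ {d} (i : Fin d) → co i ≢ full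
co≢full i e = case (trans (sym (lookup-co i)) (trans (cong (λ h → lookup h i) e) (Vecₚ.lookup-replicate i true)))
  where
  case : false ≢ true
  case ()

-- The coordinate ignored by one agreement is checked by the other.
agree-two : ∀ {n d} (u x : Vec (Fin n) d) {i j} → i ≢ j → agree (co i) u x ≡ true → agree (co j) u x ≡ true → u ≡ x
agree-two u x {i} {j} i≢j p q = lookup-ext u x same-at
  where
  lookup-ext : ∀ {A : Set} {d} (u x : Vec A d) → (∀ t → lookup u t ≡ lookup x t) → u ≡ x
  lookup-ext [] [] h = refl
  lookup-ext (u ∷ us) (x ∷ xs) h = cong₂ _∷_ (h zero) (lookup-ext us xs (λ t → h (suc t)))
  same-at : ∀ t → lookup u t ≡ lookup x t
  same-at t with t Finₚ.≟ i
  ... | no t≢i = agree-lookup (co i) u x p t (lookup-co≢ i t t≢i)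
  ... | yes refl = agree-lookup (co j) u x q t (lookup-co≢ j t i≢j)

∑-agree : ∀ {n d} (b : Bool) (h : Coords d) (u : Fin n) (us : Vec (Fin n) d) →
  ∑ (points n (suc d)) (λ x → ⟦ agree (b ∷ h) (u ∷ us) x ⟧) ≡ ∑ (allFin n) (λ v → ⟦ not b ∨ does (u Finₚ.≟ v) ⟧) * ∑ (points n d) (λ x → ⟦ agree h us x ⟧)
∑-agree {n} {d} b h u us = trans (∑-points n d _)
  (trans (∑-cong (allFin n) (λ v → trans (∑-cong (points n d) (λ x → ⟦⟧-∧ (not b ∨ does (u Finₚ.≟ v)) (agree h us x))) (∑-* (points n d) ⟦ not b ∨ does (u Finₚ.≟ v) ⟧ _)))
    (∑-*ʳ (allFin n) _ _))

∑-indicator : ∀ {A : Set} (p : A → Bool) (xs : List A) → ∑ xs (λ x → ⟦ p x ⟧) ≡ ι (length (filter (λ x → p x Boolₚ.≟ true) xs))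
∑-indicator p [] = refl
∑-indicator p (x ∷ xs) with p x
... | true = cong (1ℚ +_) (∑-indicator p xs)
... | false = trans (+-identityˡ _) (∑-indicator p xs)

numPoints-pow : ∀ n d → numPoints n d ≡ ι (n ℕ.^ d)
numPoints-pow n zero = refl
numPoints-pow n (suc d) = trans (numPoints-suc n d) (trans (cong (ι n *_) (numPoints-pow n d)) (sym (ι-* n (n ℕ.^ d))))

any-cong : ∀ {A : Set} {p q : A → Bool} (xs : List A) → (∀ x → p x ≡ q x) → any p xs ≡ any q xs
any-cong [] h = refl
any-cong (x ∷ xs) h = cong₂ _∨_ (h x) (any-cong xs h)

any-intro : ∀ {A : Set} {p : A → Bool} {xs x} → x ∈ xs → p x ≡ true → any p xs ≡ true
any-intro {p = p} {y ∷ xs} (here refl) q = cong (_∨ any p xs) q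
any-intro {p = p} {y ∷ xs} (there m) q = trans (cong (p y ∨_) (any-intro m q)) (Boolₚ.∨-zeroʳ (p y))

any-elim : ∀ {A : Set} (p : A → Bool) xs → any p xs ≡ true → ∃[ x ] x ∈ xs × p x ≡ true
any-elim p (x ∷ xs) q with p x in e
... | true = x , here refl , e
... | false = let (y , m , r) = any-elim p xs q in y , there m , r

any-elim? : ∀ {A : Set} (p : A → Bool) xs → (∃[ x ] x ∈ xs × p x ≡ true) ⊎ (∀ {x} → x ∈ xs → p x ≡ false)
any-elim? p [] = inj₂ λ ()
any-elim? p (x ∷ xs) with true-or-false (p x) | any-elim? p xs
... | inj₁ e | _ = inj₁ (x , here refl , e)
... | inj₂ _ | inj₁ (z , m , q) = inj₁ (z , there m , q)
... | inj₂ e | inj₂ h = inj₂ λ { (here refl) → e ; (there m) → h m }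

∑-allFin-suc : ∀ {n} (f : Fin (suc n) → ℚ) → ∑ (allFin (suc n)) f ≡ f zero + ∑ (allFin n) (λ v → f (suc v))
∑-allFin-suc {n} f = cong (f zero +_) (trans (cong (λ xs → ∑ xs f) (sym (Listₚ.map-tabulate (λ v → v) suc))) (∑-map suc (allFin n) f))

one-agrees-only : ∀ {n} (u : Fin n) → ∑ (allFin n) (λ v → ⟦ does (u Finₚ.≟ v) ⟧) ≡ 1ℚ
one-agrees-only {suc n} zero = trans (∑-allFin-suc {n} (λ v → ⟦ does (zero Finₚ.≟ v) ⟧)) (trans (cong (1ℚ +_) (∑-zero (allFin n))) (+-identityʳ 1ℚ))
one-agrees-only {suc n} (suc u) = trans (∑-allFin-suc {n} (λ v → ⟦ does (suc u Finₚ.≟ v) ⟧)) (trans (+-identityˡ _) (one-agrees-only u))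

agree-full : ∀ {n d} (u : Vec (Fin n) d) → ∑ (points n d) (λ x → ⟦ agree full u x ⟧) ≡ 1ℚ
agree-full [] = refl
agree-full {n} {suc d} (u ∷ us) = trans (∑-agree true full u us) (trans (cong₂ _*_ (one-agrees-only u) (agree-full us)) (*-identityˡ 1ℚ))

agree-co : ∀ {n d} (i : Fin d) (u : Vec (Fin n) d) → ∑ (points n d) (λ x → ⟦ agree (co i) u x ⟧) ≡ ι n
agree-co {n} {suc d} zero (u ∷ us) = trans (∑-agree false full u us) (trans (cong₂ _*_ (∑-fin-const n 1ℚ) (agree-full us)) (trans (*-identityʳ _) (*-identityʳ (ι n))))
agree-co {n} (suc i) (u ∷ us) = trans (∑-agree true (co i) u us) (trans (cong₂ _*_ (one-agrees-only u) (agree-co i us)) (*-identityˡ (ι n)))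

cancel-≤ : ∀ {q x y} → 0ℚ < q → q * x ≤ q * y → x ≤ y
cancel-≤ {q} p = *-cancelˡ-≤-pos q {{positive p}}

-- Edges near a point, shadows, and the bound on the number of edges.

module Edges {n-1 r k e : ℕ} (k<r : suc k ℕ.≤ r) (e≤d : e ℕ.≤ suc k) (H : Hypergraph (suc n-1))
             (uniform : Uniform r H) (free : GFree (e ℕ.* (r ℕ.∸ k) ℕ.+ k ℕ.+ 1) e H) where

  open Space (suc k) n-1

  τ : Subset n → P
  τ E = firsts zero (suc k) (elements E)

  Near : P → Subset n → Set
  Near y E = ∃[ i ] agree (co i) (τ E) y ≡ true

  rest : Fin (suc k) → Subset n → List (Fin n)
  rest i E = lookup (τ E) i ∷ drop (suc k) (elements E)

  length-rest : ∀ i E → ∣ E ∣ ≡ r → length (rest i E) ≡ r ℕ.∸ k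
  length-rest i E p = trans (cong suc (trans (Listₚ.length-drop (suc k) (elements E)) (cong (ℕ._∸ suc k) (trans (length-elements E) p)))) (sym (ℕₚ.+-∸-assoc 1 k<r))

  ∈-rest : ∀ {E i y x} → agree (co i) (τ E) y ≡ true → x Sub.∈ E → x ∈ toList y ⊎ x ∈ rest i E
  ∈-rest {E} {i} {y} p m with firsts-or-rest zero (suc k) (∈-elements m)
  ... | inj₂ m' = inj₂ (there m')
  ... | inj₁ (j , refl) with j Finₚ.≟ i
  ...   | yes refl = inj₂ (here refl)
  ...   | no j≢i = inj₁ (subst (_∈ toList y) (sym (agree-lookup (co i) (τ E) y p j (lookup-co≢ i j j≢i))) (lookup-∈ y j))

  -- A nearby edge has at most r - k vertices outside y: the one in the free position of τ(E), and
  -- the r - (k + 1) not listed in τ(E). With the k + 1 entries of y, e such edges span at most the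
  -- forbidden number of vertices.
  cover : ∀ y (Es : List (Subset n)) → All (λ E → ∣ E ∣ ≡ r × Near y E) Es →
    Σ (List (Fin n)) λ xs → (length xs ≡ length Es ℕ.* (r ℕ.∸ k)) × (∀ {x} → x Sub.∈ ⋃ Es → x ∈ toList y ⊎ x ∈ xs)
  cover y [] [] = [] , refl , λ m → ⊥-elim (Subₚ.∉⊥ m)
  cover y (E ∷ Es) ((size , i , p) ∷ hs) with cover y Es hs
  ... | xs , len , covers = rest i E ++ xs , trans (Listₚ.length-++ (rest i E)) (cong₂ ℕ._+_ (length-rest i E size) len) , split
    where
    split : ∀ {x} → x Sub.∈ (E ∪ ⋃ Es) → x ∈ toList y ⊎ x ∈ rest i E ++ xs
    split m with Subₚ.x∈p∪q⁻ E (⋃ Es) m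
    ... | inj₁ m₁ with ∈-rest {E} {i} {y} p m₁
    ...   | inj₁ q = inj₁ q
    ...   | inj₂ q = inj₂ (∈-++⁺ˡ q)
    split m | inj₂ m₂ with covers m₂
    ...   | inj₁ q = inj₁ q
    ...   | inj₂ q = inj₂ (∈-++⁺ʳ (rest i E) q)

  few-near : ∀ y Es → Es ⊆ₗ edges H → Unique Es → length Es ≡ e → All (Near y) Es → ⊥
  few-near y Es sub uniq len near with cover y Es (All.zipWith (λ (a , b) → a , b) (All.tabulate (λ m → All.lookup uniform (sub m)) , near))
  ... | xs , len-xs , covers = ℕₚ.<⇒≱ (free Es sub uniq len)
    (ℕₚ.≤-trans (cover-≤ (toList y ++ xs) (λ m → join (covers m))) (ℕₚ.≤-reflexive count-eq))
    where
    join : ∀ {x} → x ∈ toList y ⊎ x ∈ xs → x ∈ toList y ++ xs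
    join (inj₁ q) = ∈-++⁺ˡ q
    join (inj₂ q) = ∈-++⁺ʳ (toList y) q
    count-eq : length (toList y ++ xs) ≡ e ℕ.* (r ℕ.∸ k) ℕ.+ k ℕ.+ 1
    count-eq = trans (Listₚ.length-++ (toList y)) (trans (cong₂ ℕ._+_ (Vecₚ.length-toList y) (trans len-xs (cong (ℕ._* (r ℕ.∸ k)) len)))
      (trans (ℕₚ.+-comm (suc k) (e ℕ.* (r ℕ.∸ k))) (trans (cong (e ℕ.* (r ℕ.∸ k) ℕ.+_) (ℕₚ.+-comm 1 k)) (sym (ℕₚ.+-assoc (e ℕ.* (r ℕ.∸ k)) k 1)))))

  multiplicity : ∀ i y → ∑ (edges H) (λ E → ⟦ agree (co i) (τ E) y ⟧) ≤ ι e
  multiplicity i y = subst (_≤ ι e) (sym (∑-indicator (λ E → agree (co i) (τ E) y) (edges H))) (ι-mono (ℕₚ.≮⇒≥ too-many))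
    where
    P? : ∀ E → _
    P? E = agree (co i) (τ E) y Boolₚ.≟ true
    near : List (Subset n)
    near = filter P? (edges H)
    take-sub : ∀ {E} → E ∈ take e near → E ∈ near
    take-sub m = subst (_ ∈_) (Listₚ.take++drop≡id e near) (∈-++⁺ˡ m)
    too-many : ¬ (e ℕ.< length near)
    too-many big = few-near y (take e near) (λ m → proj₁ (∈-filter⁻ P? (take-sub m))) (Uniqueₚ.take⁺ e (Uniqueₚ.filter⁺ P? (unique H)))
      (trans (Listₚ.length-take e near) (ℕₚ.m≤n⇒m⊓n≡m (ℕₚ.<⇒≤ big)))
      (All.tabulate (λ m → i , proj₂ (∈-filter⁻ P? {xs = edges H} (take-sub m))))

  -- Double counting: if τ(E) lies in D, so do the n points of its line in direction i, and by
  -- `multiplicity` each point is counted for at most e edges.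
  edge-sum : ∀ i (D : P → Bool) {c} → Supp (co i) D → 𝔼 (λ x → ⟦ D x ⟧) ≤ c → ∑ (edges H) (λ E → ⟦ D (τ E) ⟧) ≤ ι e * (ι (n ℕ.^ k) * c)
  edge-sum i D {c} s small = cancel-≤ (ι-pos n-1) (≤-trans lower-bound upper-bound)
    where
    ring₁ : ∀ n e p c → e * ((n * p) * c) ≡ n * (e * (p * c))
    ring₁ = solve-∀ ℚr
    per-edge : ∀ E → ι n * ⟦ D (τ E) ⟧ ≤ ∑ (points n (suc k)) (λ x → ⟦ agree (co i) (τ E) x ⟧ * ⟦ D x ⟧)
    per-edge E = subst₂ _≤_ (*-comm ⟦ D (τ E) ⟧ (ι n)) (trans (sym (∑-* (points n (suc k)) ⟦ D (τ E) ⟧ _)) (∑-cong (points n (suc k)) same-D))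
      (*-mono-≤ (⟦⟧-nonneg (D (τ E))) (≤-reflexive (sym (agree-co i (τ E)))))
      where
      same-D : ∀ x → ⟦ D (τ E) ⟧ * ⟦ agree (co i) (τ E) x ⟧ ≡ ⟦ agree (co i) (τ E) x ⟧ * ⟦ D x ⟧
      same-D x with agree (co i) (τ E) x in q
      ... | true = trans (*-comm ⟦ D (τ E) ⟧ 1ℚ) (cong (λ b → 1ℚ * ⟦ b ⟧) (sym (supp-agree {h = co i} s (agree-mix (co i) (τ E) x q))))
      ... | false = trans (*-comm ⟦ D (τ E) ⟧ 0ℚ) (trans (*-zeroˡ ⟦ D (τ E) ⟧) (sym (*-zeroˡ ⟦ D x ⟧)))
    lower-bound : ι n * ∑ (edges H) (λ E → ⟦ D (τ E) ⟧) ≤ ∑ (points n (suc k)) (λ x → ⟦ D x ⟧ * ι e)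
    lower-bound = ≤-trans (subst (_≤ ∑ (edges H) (λ E → ∑ (points n (suc k)) (λ x → ⟦ agree (co i) (τ E) x ⟧ * ⟦ D x ⟧))) (∑-* (edges H) (ι n) _) (∑-mono (edges H) per-edge))
      (subst (_≤ ∑ (points n (suc k)) (λ x → ⟦ D x ⟧ * ι e)) (sym (∑-swap (edges H) (points n (suc k)) (λ E x → ⟦ agree (co i) (τ E) x ⟧ * ⟦ D x ⟧)))
        (∑-mono (points n (suc k)) (λ x → subst (_≤ ⟦ D x ⟧ * ι e) (trans (*-comm ⟦ D x ⟧ _) (sym (∑-*ʳ (edges H) ⟦ D x ⟧ _))) (*-mono-≤ (⟦⟧-nonneg (D x)) (multiplicity i x)))))
    upper-bound : ∑ (points n (suc k)) (λ x → ⟦ D x ⟧ * ι e) ≤ ι n * (ι e * (ι (n ℕ.^ k) * c))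
    upper-bound = subst₂ _≤_ (trans (*-comm (ι e) _) (trans (cong (_* ι e) (size*𝔼 (λ x → ⟦ D x ⟧))) (sym (∑-*ʳ (points n (suc k)) (ι e) _))))
      (trans (cong (λ z → ι e * (z * c)) (trans (numPoints-suc n k) (cong (ι n *_) (numPoints-pow n k)))) (ring₁ (ι n) (ι e) (ι (n ℕ.^ k)) c))
      (*-mono-≤ (ι-nonneg e) (*-mono-≤ (<⇒≤ size-pos) small))

  occupied : Coords (suc k) → P → Bool
  occupied h x = any (λ E → agree h (τ E) x) (edges H)

  toℕ₂ : Bool → ℕ
  toℕ₂ b = if b then 1 else 0

  -- Two labels, occupied or not: every point of a box at some τ(E) has all its faces occupied by
  -- edges.
  shadows : Labelling 2
  shadows = record
    { lab = λ h x → toℕ₂ (occupied h x)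
    ; lab< = λ h x → small (occupied h x)
    ; lab-supp = λ h x z → cong toℕ₂ (any-cong (edges H) (λ E → agree-supp h (τ E) x z)) }
    where
    small : ∀ b → toℕ₂ b ℕ.< 2
    small true = ℕ.s≤s (ℕ.s≤s ℕ.z≤n)
    small false = ℕ.s≤s ℕ.z≤n

  toℕ₂-true : ∀ {b} → toℕ₂ b ≡ 1 → b ≡ true
  toℕ₂-true {true} _ = refl

  -- An edge agreeing with y off two different coordinates has τ(E) = y; hence the edges found are distinct if y is not in τ(H).
  no-simplex : ∀ y → (∀ i → occupied (co i) y ≡ true) → ∃[ E ] E ∈ edges H × τ E ≡ y
  no-simplex y occ with any-elim? (λ E → agree full (τ E) y) (edges H)
  ... | inj₁ (E , m , p) = E , m , sym (trans (sym (mix-full y (τ E))) (agree-mix full (τ E) y p))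
    where
    mix-full : ∀ {A : Set} {d} (x z : Vec A d) → mix full x z ≡ x
    mix-full [] [] = refl
    mix-full (x ∷ xs) (z ∷ zs) = cong (x ∷_) (mix-full xs zs)
  ... | inj₂ none = ⊥-elim (few-near y (map edge (allFin e)) sub (Uniqueₚ.map⁺ edge-injective (Uniqueₚ.allFin⁺ e)) (trans (Listₚ.length-map edge (allFin e)) (length-allFin e)) near)
    where
    at : ∀ i → ∃[ E ] E ∈ edges H × agree (co i) (τ E) y ≡ true
    at i = any-elim (λ E → agree (co i) (τ E) y) (edges H) (occ i)
    pos : Fin e → Fin (suc k)
    pos j = inject≤ j e≤d
    edge : Fin e → Subset n
    edge j = proj₁ (at (pos j))
    edge∈ : ∀ j → edge j ∈ edges H
    edge∈ j = proj₁ (proj₂ (at (pos j)))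
    edge-near : ∀ j → agree (co (pos j)) (τ (edge j)) y ≡ true
    edge-near j = proj₂ (proj₂ (at (pos j)))
    edge-injective : ∀ {a b} → edge a ≡ edge b → a ≡ b
    edge-injective {a} {b} q with a Finₚ.≟ b
    ... | yes p = p
    ... | no a≢b = ⊥-elim (false≢true (trans (sym (none (edge∈ a))) (subst (λ u → agree full (τ (edge a)) u ≡ true)
            (agree-two (τ (edge a)) y (λ p → a≢b (Finₚ.inject≤-injective e≤d e≤d a b p)) (edge-near a)
              (subst (λ E → agree (co (pos b)) (τ E) y ≡ true) (sym q) (edge-near b)))
            (agree-refl full (τ (edge a))))))
      where
      false≢true : false ≢ true
      false≢true ()
    sub : map edge (allFin e) ⊆ₗ edges H
    sub m with ∈-map⁻ edge m
    ... | j , _ , refl = edge∈ j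
    near : All (Near y) (map edge (allFin e))
    near = Allₚ.map⁺ (All.tabulate (λ {j} _ → pos j , edge-near j))

  noWeights : ∀ {K γ} → 0ℚ ≤ K → 0ℚ ≤ γ → Target.Weights (suc k) n-1 K γ
  noWeights {K} {γ} 0≤K 0≤γ = record
    { β = λ _ _ → 0ℚ ; β-nonneg = λ _ _ → ≤-refl ; β-≤ = λ _ _ → 0≤K ; β-supp = λ _ _ _ → refl
    ; β-small = λ _ → ≤-trans (≤-reflexive (𝔼-const 0ℚ)) 0≤γ }

  -- The case of `edge-sum` in which D is everything and c = 1.
  edge-count : ι (length (edges H)) ≤ ι e * ι (n ℕ.^ k)
  edge-count = subst₂ _≤_ (∑-one (edges H)) (cong (ι e *_) (*-identityʳ _)) (edge-sum zero (λ _ → true) (λ _ _ → refl) (≤-reflexive (𝔼-const 1ℚ)))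

  -- By `no-simplex` every point of the box is some τ(E'), so the box has no more points than H has
  -- edges.
  box-small : ∀ {E R} → E ∈ edges H → Box shadows (τ E) (proper (suc k)) R → ∑ (points n (suc k)) (λ y → ⟦ R y ⟧) ≤ ι e * ι (n ℕ.^ k)
  box-small {E} {R} E∈ box = ≤-trans (∑-mono (points n (suc k)) in-image)
    (≤-trans (≤-reflexive (trans (∑-swap (points n (suc k)) (edges H) (λ y E' → ⟦ agree full (τ E') y ⟧)) (trans (∑-cong (edges H) (λ E' → agree-full (τ E'))) (∑-one (edges H))))) edge-count)
    where
    in-image : ∀ y → ⟦ R y ⟧ ≤ ∑ (edges H) (λ E' → ⟦ agree full (τ E') y ⟧)
    in-image y with R y in Ry
    ... | false = ∑-nonneg (edges H) (λ E' → ⟦⟧-nonneg (agree full (τ E') y))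
    ... | true = let (E' , E'∈ , τE'≡y) = no-simplex y near-all in
      subst (_≤ ∑ (edges H) (λ E' → ⟦ agree full (τ E') y ⟧)) (cong ⟦_⟧ (subst (λ u → agree full (τ E') u ≡ true) τE'≡y (agree-refl full (τ E'))))
        (∑-member (λ E' → ⟦⟧-nonneg (agree full (τ E') y)) E'∈)
      where
      near-all : ∀ i → occupied (co i) y ≡ true
      near-all i = toℕ₂-true (trans (box-member box (∈-proper (co i) (co≢full i)) Ry) (cong toℕ₂ (any-intro E∈ (agree-refl (co i) (τ E)))))

  -- If every τ(E) is exceptional, `edge-sum` over the d = k + 1 directions gives the bound, as ε =
  -- 1/(m·d·e). Otherwise some τ(E) has a box of at least δ·n^d points, more than the e·n^k allowed
  -- by `box-small` once n·δ > e.
  sparse : ∀ {m ε δ} → 0ℚ < ι m * ι (suc k) * ι e → ε ≡ inv (ι m * ι (suc k) * ι e) → ι e < ι n * δ →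
    Target.Conclusion (suc k) n-1 ε δ shadows (λ _ _ → 0ℚ) (proper (suc k)) → ι m * ι (length (edges H)) ≤ ι (n ℕ.^ k)
  sparse {m} {ε} {δ} 0<mde ε≡ large c with any-elim? (λ E → not (any (λ i → Target.Conclusion.D c i (τ E)) (allFin (suc k)))) (edges H)
  ... | inj₂ all-bad = subst (ι m * ι (length (edges H)) ≤_) (trans (ring (ι m) (ι (suc k)) (ι e) (ι (n ℕ.^ k)) ε) (trans (cong (_* ι (n ℕ.^ k)) (trans (cong (ι m * ι (suc k) * ι e *_) ε≡) (*-inv 0<mde))) (*-identityˡ _)))
      (*-mono-≤ (ι-nonneg m) (≤-trans (subst (_≤ ∑ (edges H) (λ E → ∑ (allFin (suc k)) (λ i → ⟦ D i (τ E) ⟧))) (∑-one (edges H)) (∑-mono-∈ (edges H) hit))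
        (subst (_≤ ι (suc k) * (ι e * (ι (n ℕ.^ k) * ε))) (∑-swap (allFin (suc k)) (edges H) (λ i E → ⟦ D i (τ E) ⟧))
          (subst (∑ (allFin (suc k)) (λ i → ∑ (edges H) (λ E → ⟦ D i (τ E) ⟧)) ≤_) (∑-fin-const (suc k) _) (∑-mono (allFin (suc k)) (λ i → edge-sum i (D i) (D-supp i) (D-small i)))))))
    where
    open Target.Conclusion c
    ring : ∀ m d e p ε → m * (d * (e * (p * ε))) ≡ (m * d * e * ε) * p
    ring = solve-∀ ℚr
    not-false : ∀ {b} → not b ≡ false → b ≡ true
    not-false {true} _ = refl
    hit : ∀ E → E ∈ edges H → 1ℚ ≤ ∑ (allFin (suc k)) (λ i → ⟦ D i (τ E) ⟧)
    hit E E∈ with any-elim (λ i → D i (τ E)) (allFin (suc k)) (not-false (all-bad E∈))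
    ... | i , i∈ , q = subst (_≤ ∑ (allFin (suc k)) (λ i → ⟦ D i (τ E) ⟧)) (cong ⟦_⟧ q) (∑-member (λ i → ⟦⟧-nonneg (D i (τ E))) i∈)
  ... | inj₁ (E , E∈ , q) with Target.Conclusion.box-at c (τ E) avoids
    where
    open Target.Conclusion c
    avoids : ∀ i → D i (τ E) ≡ false
    avoids i with true-or-false (D i (τ E))
    ... | inj₂ p = p
    ... | inj₁ p = ⊥-elim (false≢true (trans (cong not (sym (any-intro {p = λ i → D i (τ E)} (∈-allFin i) p))) q))
      where
      false≢true : false ≢ true
      false≢true ()
  ... | R , box , δ≤ = ⊥-elim (<-irrefl refl (<-≤-trans large (cancel-≤ pow-pos (subst₂ _≤_ lhs (*-comm (ι e) (ι (n ℕ.^ k))) (≤-trans mass (box-small E∈ box))))))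
    where
    pow-pos : 0ℚ < ι (n ℕ.^ k)
    pow-pos = <-≤-trans 0<1 (ι-mono {1} (ℕₚ.m^n>0 n k))
    trivial : 𝔼 (λ y → ⟦ R y ⟧ * (1ℚ - ∑ (allFin (suc k)) (λ _ → 0ℚ))) ≡ 𝔼 (λ y → ⟦ R y ⟧)
    trivial = 𝔼-cong (λ y → trans (cong (λ z → ⟦ R y ⟧ * (1ℚ - z)) (∑-zero (allFin (suc k)))) (*-identityʳ ⟦ R y ⟧))
    mass : size * δ ≤ ∑ (points n (suc k)) (λ y → ⟦ R y ⟧)
    mass = subst (size * δ ≤_) (trans (cong (size *_) trivial) (size*𝔼 _)) (*-mono-≤ (<⇒≤ size-pos) δ≤)
    swap : ∀ n p δ → n * p * δ ≡ p * (n * δ)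
    swap = solve-∀ ℚr
    lhs : size * δ ≡ ι (n ℕ.^ k) * (ι n * δ)
    lhs = trans (cong (_* δ) (trans (numPoints-suc n k) (cong (ι n *_) (numPoints-pow n k)))) (swap (ι n) (ι (n ℕ.^ k)) δ)

theorem1 : (r k e : ℕ) → k ℕ.+ 1 ℕ.≤ r → e ℕ.≤ k ℕ.+ 1 → 3 ℕ.≤ e →
    (m : ℕ) → 1 ℕ.≤ m → ∃[ N ] ((n : ℕ) → N ℕ.≤ n → (H : Hypergraph n) →
    Uniform r H → GFree (e ℕ.* (r ℕ.∸ k) ℕ.+ k ℕ.+ 1) e H →
    m ℕ.* numEdges H ℕ.≤ n ℕ.^ k)
theorem1 r k e@(suc e-1) k<r e≤d _ m@(suc m-1) _ = suc N₀ , bound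
  where
  mde ε : ℚ
  mde = ι m * ι (suc k) * ι e
  ε = inv mde
  0<mde : 0ℚ < mde
  0<mde = mul-pos (mul-pos (ι-pos m-1) (ι-pos k)) (ι-pos e-1)
  claimed = claim (proper-descending (suc k)) ε (inv-pos 0<mde)
  γ : ℚ
  γ = proj₁ claimed
  -- Two labels for `shadows`; the initial weights vanish, so 1 bounds their size.
  at-two = proj₂ (proj₂ claimed) 2 1ℚ ≤-refl
  δ : ℚ
  δ = proj₁ at-two
  δ-pos : 0ℚ < δ
  δ-pos = proj₁ (proj₂ at-two)
  N₀ : ℕ
  N₀ = proj₁ (archimedean* (ι e) δ-pos)
  bound : (n : ℕ) → suc N₀ ℕ.≤ n → (H : Hypergraph n) → Uniform r H → GFree (e ℕ.* (r ℕ.∸ k) ℕ.+ k ℕ.+ 1) e H → m ℕ.* numEdges H ℕ.≤ n ℕ.^ k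
  bound (suc n-1) N₀<n H uniform free with m ℕ.* numEdges H ℕ.≤? suc n-1 ℕ.^ k
  ... | yes p = p
  ... | no ¬p = ⊥-elim (proj₂ (proj₂ at-two) n-1 X.shadows (X.noWeights 0≤1 (<⇒≤ (proj₁ (proj₂ claimed))))
      λ c → ¬p (ι-cancel-≤ (subst (_≤ ι (suc n-1 ℕ.^ k)) (sym (ι-* m (numEdges H))) (X.sparse {m} 0<mde refl large c))))
    where
    module X = Edges (subst (ℕ._≤ r) (ℕₚ.+-comm k 1) k<r) (subst (e ℕ.≤_) (ℕₚ.+-comm k 1) e≤d) H uniform free
    large : ι e < ι (suc n-1) * δ
    large = <-≤-trans (proj₂ (archimedean* (ι e) δ-pos)) (subst₂ _≤_ (*-comm δ _) (*-comm δ _) (*-mono-≤ (<⇒≤ δ-pos) (ι-mono (ℕₚ.<⇒≤ N₀<n))))
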